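{- Let $D$ be an arbitrary finite set, let $f\colon D\times D\to D$, and let $\mathcal{P}$ be a cyclic partition of $f$. Then there exists an algorithm which, given $g,h\colon D^n\to\mathbb{Z}$, computes $g\circledast_f h$ in time $\widetilde{\mathcal{O}}\left((\mathrm{cost}(\mathcal{P})^n+|D|^n)\cdot\mathrm{polylog}(M)\right)$, where $M$ is the maximum absolute value of the integers in the input.
   Context: For $\mathbf{u},\mathbf{w}\in D^n$ write $\mathbf{u}\oplus_f\mathbf{w}=(f(\mathbf{u}_1,\mathbf{w}_1),\ldots,f(\mathbf{u}_n,\mathbf{w}_n))$. For $g,h\colon D^n\to\mathbb{Z}$ the $f$-convolution $g\circledast_f h\colon D^n\to\mathbb{Z}$ is $$(g\circledast_f h)(\mathbf{v})=\sum_{\mathbf{v}_g,\mathbf{v}_h\in D^n\text{ s.t. }\mathbf{v}=\mathbf{v}_g\oplus_f\mathbf{v}_h} g(\mathbf{v}_g)\cdot h(\mathbf{v}_h)\qquad(\mathbf{v}\in D^n).$$ The functions $g,h$ are given by listing all their values and all values of $g\circledast_f h$ are to be output. $D$, $f$ and $\mathcal{P}$ are fixed (of constant size). The notation $\widetilde{\mathcal{O}}(\cdot)$ hides polylogarithmic factors. For $k\in\mathbb{N}$ let $\mathbb{Z}_k=\{0,1,\ldots,k-1\}$. A function $f\colon A\times B\to C$ is $k$-cyclic if there are functions $\sigma_A\colon A\to\mathbb{Z}_k$, $\sigma_B\colon B\to\mathbb{Z}_k$ and $\sigma_C\colon\mathbb{Z}_k\to C$ such that $f(a,b)=\sigma_C(\sigma_A(a)+\sigma_B(b)\bmod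 k)$ for all $a\in A$, $b\in B$. For $f\colon D\times D\to D$, a triple $(A,B,k)$ with $A,B\subseteq D$, $k\in\mathbb{N}$, is a cyclic minor of $f$ if the restriction of $f$ to $A\times B$ is $k$-cyclic. A cyclic partition of $f$ is a set $\mathcal{P}=\{(A_1,B_1,k_1),\ldots,(A_m,B_m,k_m)\}$ of cyclic minors of $f$ such that for every $(a,b)\in D\times D$ there is a unique $i\in\{1,\ldots,m\}$ with $(a,b)\in A_i\times B_i$. Its cost is $\mathrm{cost}(\mathcal{P})=\sum_{i=1}^m k_i$. -}

module Defs where

open import Data.Bool using (Bool; T)
open import Data.Fin using (Fin; toℕ)
open import Data.Fin.Properties using (inj⇒≟)
open import Data.Integer using (ℤ; _<_; +_; -[1+_]; +[1+_]; ∣_∣; 0ℤ) renaming (_+_ to _+ᶻ_; _-_ to _-ᶻ_; _*_ to _*ᶻ_)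
open import Data.Integer.DivMod using () renaming (_/_ to _/ᶻ_)
open import Data.List using (List; []; _∷_; [_]; _++_; map; foldr; filter; applyUpTo; tabulate; cartesianProduct; cartesianProductWith)
open import Data.Nat using (ℕ; zero; suc; _+_; _*_; _^_; _⊔_; _≟_)
open import Data.Nat.DivMod using (_mod_)
open import Data.Nat.ListAction using (sum)
open import Data.Nat.Logarithm using (⌈log₂_⌉)
open import Data.Product using (Σ; ∃!; _×_; _,_; proj₁)
open import Data.Vec using (Vec; zipWith) renaming ([] to []ᵛ; _∷_ to _∷ᵛ_)
open import Data.Vec.Properties using (≡-dec)
open import Function.Bundles using (_↔_; Inverse)
open import Function.Properties.Inverse using (↔⇒↣)
open import Relation.Binary.Definitions using (DecidableEquality)
open import Relation.Binary.PropositionalEquality using (_≡_)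
open import Relation.Nullary using (¬_; yes; no)

------------------------------------------------------------------------
-- Cyclic minors and cyclic partitions

infixl 6 _⊞_

_⊞_ : ∀ {k} → Fin k → Fin k → Fin k
_⊞_ {suc k} x y = (toℕ x + toℕ y) mod suc k

record IsCyclic (k : ℕ) {A B C : Set} (f : A → B → C) : Set where
  field
    σA : A → Fin k
    σB : B → Fin k
    σC : Fin k → C
    factorises : ∀ a b → f a b ≡ σC (σA a ⊞ σB b)

-- Subsets of a finite set, by their characteristic functions.
Subset : Set → Set
Subset D = D → Bool

infix 4 _∈_

_∈_ : {D : Set} → D → Subset D → Set
x ∈ A = T (A x)

El : {D : Set} → Subset D → Set
El {D} A = Σ D (_∈ A)

restrict : {D : Set} (f : D → D → D) (A B : Subset D) → El A → El B → D
restrict f A B a b = f (proj₁ a) (proj₁ b)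

record CyclicMinor {D : Set} (f : D → D → D) : Set where
  field
    A B      : Subset D
    k        : ℕ
    isCyclic : IsCyclic k (restrict f A B)

record CyclicPartition {D : Set} (f : D → D → D) : Set where
  field
    m         : ℕ
    minor     : Fin m → CyclicMinor f
  open module Minor i = CyclicMinor (minor i) public
  field
    partition : ∀ a b → ∃! _≡_ λ i → a ∈ A i × b ∈ B i

cost : {D : Set} {f : D → D → D} → CyclicPartition f → ℕ
cost P = sum (tabulate k)
  where open CyclicPartition P

------------------------------------------------------------------------
-- f-convolution over a finite set D listed by a bijection with Fin d

module Convolution {D : Set} {d : ℕ} (enum : D ↔ Fin d) where

  _≟ᴰ_ : DecidableEquality D
  _≟ᴰ_ = inj⇒≟ (↔⇒↣ enum)

  elements : List D
  elements = tabulate (Inverse.from enum)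

  -- All of Dⁿ without repetition, in lexicographic order; a function on Dⁿ
  -- is presented to an algorithm as the list of its values in this order.
  tuples : ∀ n → List (Vec D n)
  tuples zero    = [ []ᵛ ]
  tuples (suc n) = cartesianProductWith _∷ᵛ_ elements (tuples n)

  values : ∀ {n} → (Vec D n → ℤ) → List ℤ
  values {n} g = map g (tuples n)

  sumᶻ : List ℤ → ℤ
  sumᶻ = foldr _+ᶻ_ 0ℤ

  convolution : (D → D → D) → ∀ {n} → (Vec D n → ℤ) → (Vec D n → ℤ) → Vec D n → ℤ
  convolution f {n} g h v =
    sumᶻ (map (λ (u , w) → g u *ᶻ h w)
         (filter (λ (u , w) → ≡-dec _≟ᴰ_ v (zipWith f u w))
         (cartesianProduct (tuples n) (tuples n))))

  maxAbs : List ℤ → ℕ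
  maxAbs = foldr (λ z r → ∣ z ∣ ⊔ r) 0

  inputMax : ∀ {n} → (Vec D n → ℤ) → (Vec D n → ℤ) → ℕ
  inputMax g h = maxAbs (values g ++ values h)

------------------------------------------------------------------------
-- Algorithms: random access machines with logarithmic cost
--
-- Every operation is charged by the bit lengths of the integers (operands,
-- results, addresses) it touches; multiplication and division are charged
-- the schoolbook product of the operand lengths.  Control flow is
-- structured, and memory is split into registers and arrays of which a
-- program names finitely many; compared with a single memory and jumps this
-- changes running times by a constant factor only.

Reg Arr : Set
Reg = ℕ
Arr = ℕ

record State : Set where
  constructor ⟪_,_⟫
  field
    reg : Reg → ℤ
    arr : Arr → ℕ → ℤ

open State public

data Op : Set where
  plus minus times quot : Op

data Expr : Set where
  const : ℤ → Expr
  var   : Reg → Expr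
  read  : Arr → Expr → Expr
  bin   : Op → Expr → Expr → Expr

infixr 5 _⨟_

data Program : Set where
  skip            : Program
  assign          : Reg → Expr → Program
  write           : Arr → Expr → Expr → Program   -- array, address, value
  _⨟_             : Program → Program → Program
  if>0_then_else_ : Expr → Program → Program → Program
  while>0_loop_   : Expr → Program → Program

-- 1 + number of binary digits
log⁺ : ℕ → ℕ
log⁺ x = suc ⌈log₂ suc x ⌉

size : ℤ → ℕ
size z = log⁺ ∣ z ∣

-- Integer quotient with non-negative remainder; division by 0 yields 0.
_÷_ : ℤ → ℤ → ℤ
x ÷ (+ 0)        = 0ℤ
x ÷ y@(+[1+ _ ]) = x /ᶻ y
x ÷ y@(-[1+ _ ]) = x /ᶻ y

apply : Op → ℤ → ℤ → ℤ
apply plus  x y = x +ᶻ y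
apply minus x y = x -ᶻ y
apply times x y = x *ᶻ y
apply quot  x y = x ÷ y

opCost : Op → ℤ → ℤ → ℕ
opCost plus  x y = size x + size y
opCost minus x y = size x + size y
opCost times x y = size x * size y
opCost quot  x y = size x * size y

-- An address is the absolute value of the integer computed for it.
⟦_⟧ : Expr → State → ℤ
⟦ const z ⟧   s = z
⟦ var x ⟧     s = reg s x
⟦ read a e ⟧  s = arr s a ∣ ⟦ e ⟧ s ∣
⟦ bin o e₁ e₂ ⟧ s = apply o (⟦ e₁ ⟧ s) (⟦ e₂ ⟧ s)

evalCost : Expr → State → ℕ
evalCost (const z)     s = size z
evalCost (var x)       s = size (reg s x)
evalCost (read a e)    s = evalCost e s + size (⟦ e ⟧ s) + size (⟦ read a e ⟧ s)
evalCost (bin o e₁ e₂) s =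
  evalCost e₁ s + evalCost e₂ s + opCost o (⟦ e₁ ⟧ s) (⟦ e₂ ⟧ s)

update : {X : Set} → (ℕ → X) → ℕ → X → ℕ → X
update φ i x j with i ≟ j
... | yes _ = x
... | no  _ = φ j

setReg : Reg → ℤ → State → State
setReg x z s = ⟪ update (reg s) x z , arr s ⟫

setArr : Arr → ℕ → ℤ → State → State
setArr a i z s = ⟪ reg s , update (arr s) a (update (arr s a) i z) ⟫

Positive : ℤ → Set
Positive z = 0ℤ < z

infix 3 ⟨_,_⟩⇓⟨_,_⟩

-- ⟨ p , s ⟩⇓⟨ s′ , t ⟩ : started in s, program p halts in s′ after time t.
data ⟨_,_⟩⇓⟨_,_⟩ : Program → State → State → ℕ → Set where
  ⇓skip   : ∀ {s} → ⟨ skip , s ⟩⇓⟨ s , 1 ⟩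
  ⇓assign : ∀ {x e s} →
            ⟨ assign x e , s ⟩⇓⟨ setReg x (⟦ e ⟧ s) s , evalCost e s + size (⟦ e ⟧ s) ⟩
  ⇓write  : ∀ {a i e s} →
            ⟨ write a i e , s ⟩⇓⟨ setArr a ∣ ⟦ i ⟧ s ∣ (⟦ e ⟧ s) s
                               , evalCost i s + evalCost e s + size (⟦ i ⟧ s) + size (⟦ e ⟧ s) ⟩
  ⇓seq    : ∀ {p q s s′ s″ t t′} →
            ⟨ p , s ⟩⇓⟨ s′ , t ⟩ → ⟨ q , s′ ⟩⇓⟨ s″ , t′ ⟩ →
            ⟨ p ⨟ q , s ⟩⇓⟨ s″ , t + t′ ⟩
  ⇓then   : ∀ {e p q s s′ t} → Positive (⟦ e ⟧ s) → ⟨ p , s ⟩⇓⟨ s′ , t ⟩ →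
            ⟨ if>0 e then p else q , s ⟩⇓⟨ s′ , suc (evalCost e s + t) ⟩
  ⇓else   : ∀ {e p q s s′ t} → ¬ Positive (⟦ e ⟧ s) → ⟨ q , s ⟩⇓⟨ s′ , t ⟩ →
            ⟨ if>0 e then p else q , s ⟩⇓⟨ s′ , suc (evalCost e s + t) ⟩
  ⇓loop   : ∀ {e p s s′ s″ t t′} → Positive (⟦ e ⟧ s) →
            ⟨ p , s ⟩⇓⟨ s′ , t ⟩ → ⟨ while>0 e loop p , s′ ⟩⇓⟨ s″ , t′ ⟩ →
            ⟨ while>0 e loop p , s ⟩⇓⟨ s″ , suc (evalCost e s + t + t′) ⟩
  ⇓exit   : ∀ {e p s} → ¬ Positive (⟦ e ⟧ s) →
            ⟨ while>0 e loop p , s ⟩⇓⟨ s , suc (evalCost e s) ⟩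

load : List ℤ → ℕ → ℤ
load []       _       = 0ℤ
load (z ∷ zs) zero    = z
load (z ∷ zs) (suc i) = load zs i

-- Input: n in register 0, the two value lists in arrays 0 and 1, 0 elsewhere.
input : ℕ → List ℤ → List ℤ → State
input n xs ys = ⟪ load [ + n ] , arrays ⟫
  where
  arrays : Arr → ℕ → ℤ
  arrays 0 = load xs
  arrays 1 = load ys
  arrays _ = λ _ → 0ℤ

-- Output: the leading l cells of array 2.
output : ℕ → State → List ℤ
output l s = applyUpTo (arr s 2) l

-- The bound C · X · polylog(X) behind Õ(X), with leading constant C and
-- exponent q.  The maximum with 1 matters only for X = 0, which can occur
-- for empty D, where no positive running time would be admitted.
Õ[_,_] : (C q : ℕ) → ℕ → ℕ
Õ[ C , q ] X = C * (X ⊔ 1) * log⁺ X ^ q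

{-# OPTIONS --safe #-}
module Submission where

-- A cyclic partition P of f is a decomposition of rank cost P of the tensor
-- [f(u,w) = v]: on the minor (A, B, k) the convolution is one over the cyclic
-- group of order k, which the discrete Fourier transform diagonalises.  The
-- n-th tensor power of this decomposition is applied by Yates' algorithm, one
-- coordinate at a time: both inputs are transformed from dⁿ to cost(P)ⁿ points,
-- multiplied pointwise, and the product is transformed back.
--
-- The roots of unity are taken in a quotient of the group ring ℤ[x]/(x^K − 1),
-- K = cost(P)!, by the elements that annihilate a weight v on ℤ/K.  With v
-- obtained from the indicator of 0 by applying 1 − T^(K/p) for every prime p
-- dividing K (T the shift), x becomes a principal K-th root of unity, and the
-- integer result, scaled by Kⁿ, is read off by evaluating on v.  All
-- arithmetic is exact on K-tuples of integers of O(n + log M) bits.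

open import Defs

-- Complex roots of unity would force rounding, so the transforms use a ring of integer tuples.
-- Every nonzero k_i divides K = cost(P)!, so the powers x^(K/k_i) serve all minors in one ring, and
-- K is constant for fixed P.
--
-- Inverting a transform only needs root sums to cancel: if K divides ks but not s, the values of v
-- along a + ls, l < k, must sum to 0. This sum is invariant under a nontrivial subgroup of ℤ/K,
-- hence under one of prime order p, and 1 - T^(K/p) makes the sums over its cosets telescope; this
-- is why there is one operator per prime. The program never reduces modulo the ideal: it computes
-- with representatives, whose entries grow by a constant factor per layer. Scaling each inverse by
-- K instead of dividing by k_i gives the same factor for all minors.
--
-- There are O(n) passes over at most cost(P)^n + |D|^n tuples each, with quadratic cost per
-- arithmetic operation. For |D| ≥ 2 the resulting powers of n are polylogarithmic in |D|^n. For |D|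
-- ≤ 1 this argument fails, but the convolution is then at most a single product.

module MonoidSums where

  open import Algebra.Bundles using (CommutativeMonoid)
  open import Data.Fin using (Fin; punchIn)
  open import Data.Fin.Properties using (punchInᵢ≢i)
  open import Data.Nat using (suc)
  open import Relation.Binary.PropositionalEquality

  module _ {c ℓ} (M : CommutativeMonoid c ℓ) where
    open CommutativeMonoid M renaming (refl to ≈-refl; sym to ≈-sym; trans to ≈-trans)
    open import Algebra.Properties.CommutativeMonoid.Sum M using (sum-cong-≋; sum-replicate-zero; sum-remove) renaming (sum to ∑)

    sum-zero : ∀ {n} {t : Fin n → Carrier} → (∀ i → t i ≈ ε) → ∑ t ≈ ε
    sum-zero {n} h = ≈-trans (sum-cong-≋ h) (sum-replicate-zero n)

    sum-single : ∀ {n} (i : Fin n) (t : Fin n → Carrier) → (∀ j → j ≢ i → t j ≈ ε) → ∑ t ≈ t i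
    sum-single {suc n} i t h = ≈-trans (sum-remove {i = i} t)
      (≈-trans (∙-congˡ (sum-zero (λ j → h (punchIn i j) (punchInᵢ≢i i j)))) (identityʳ (t i)))

-- Finite sums of integers

module IntegerSums where

  open import Data.Fin using (Fin; zero; suc; toℕ)
  open import Data.Integer using (ℤ; 0ℤ; 1ℤ; +_) renaming (_+_ to _+ᶻ_; _*_ to _*ᶻ_; _-_ to _-ᶻ_)
  import Data.Integer.Properties as ℤₚ
  import Data.Integer.Tactic.RingSolver as ℤ-Solver
  open import Data.Nat as ℕ using (ℕ; zero; suc)
  open import Function using (_∘_)
  open import Relation.Binary.PropositionalEquality
  open import Relation.Nullary using (Dec; yes; no)

  open import Algebra.Properties.Semiring.Sum ℤₚ.+-*-semiring using (sum-cong-≗; sum-replicate-zero)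
  open import Algebra.Properties.Semiring.Sum ℤₚ.+-*-semiring public
    using (sum; *-distribˡ-sum; *-distribʳ-sum; ∑-comm; ∑-distrib-+)

  ∑-cong : ∀ {n} {f g : Fin n → ℤ} → (∀ i → f i ≡ g i) → sum f ≡ sum g
  ∑-cong = sum-cong-≗

  ∑-zero : ∀ {n} {f : Fin n → ℤ} → (∀ i → f i ≡ 0ℤ) → sum f ≡ 0ℤ
  ∑-zero {n} h = trans (∑-cong h) (sum-replicate-zero n)

  ∑-const : ∀ n x → sum {n} (λ _ → x) ≡ + n *ᶻ x
  ∑-const zero    x = sym (ℤₚ.*-zeroˡ x)
  ∑-const (suc n) x = begin
    x +ᶻ sum {n} (λ _ → x)  ≡⟨ cong (x +ᶻ_) (∑-const n x) ⟩
    x +ᶻ + n *ᶻ x  ≡⟨ cong (_+ᶻ + n *ᶻ x) (ℤₚ.*-identityˡ x) ⟨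
    1ℤ *ᶻ x +ᶻ + n *ᶻ x  ≡⟨ ℤₚ.*-distribʳ-+ x 1ℤ (+ n) ⟨
    + suc n *ᶻ x  ∎
    where open ≡-Reasoning

  ∑-distrib-- : ∀ {n} (f g : Fin n → ℤ) → sum (λ i → f i -ᶻ g i) ≡ sum f -ᶻ sum g
  ∑-distrib-- {zero}  f g = refl
  ∑-distrib-- {suc n} f g = trans (cong (f zero -ᶻ g zero +ᶻ_) (∑-distrib-- (λ i → f (suc i)) (λ i → g (suc i))))
    (lemma (f zero) (g zero) _ _)
    where
    lemma : ∀ a b c d → (a -ᶻ b) +ᶻ (c -ᶻ d) ≡ (a +ᶻ c) -ᶻ (b +ᶻ d)
    lemma = ℤ-Solver.solve-∀

  -- Both sides add φ over 0, ..., k. When `φ k ≡ φ 0`, cancelling the extra terms shows that a sum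
  -- over a full period is unchanged by a shift.
  ∑-shift : ∀ k (φ : ℕ → ℤ) →
    sum {k} (λ i → φ (suc (toℕ i))) +ᶻ φ 0 ≡ sum {k} (φ ∘ toℕ) +ᶻ φ k
  ∑-shift zero    φ = refl
  ∑-shift (suc k) φ = begin
    (φ 1 +ᶻ sum {k} (λ i → φ (suc (suc (toℕ i))))) +ᶻ φ 0  ≡⟨ lemma (φ 1) _ (φ 0) ⟩
    φ 0 +ᶻ (sum {k} (λ i → φ (suc (suc (toℕ i)))) +ᶻ φ 1)  ≡⟨ cong (φ 0 +ᶻ_) (∑-shift k (λ j → φ (suc j))) ⟩
    φ 0 +ᶻ (sum {k} (λ i → φ (suc (toℕ i))) +ᶻ φ (suc k))  ≡⟨ ℤₚ.+-assoc (φ 0) _ _ ⟨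
    (φ 0 +ᶻ sum {k} (λ i → φ (suc (toℕ i)))) +ᶻ φ (suc k)  ∎
    where
    open ≡-Reasoning
    lemma : ∀ a b c → (a +ᶻ b) +ᶻ c ≡ c +ᶻ (b +ᶻ a)
    lemma = ℤ-Solver.solve-∀

  +ᶻ-cancelʳ : ∀ {x y} z → x +ᶻ z ≡ y +ᶻ z → x ≡ y
  +ᶻ-cancelʳ {x} {y} z = ∙-cancelʳ z x y
    where open import Algebra.Properties.AbelianGroup ℤₚ.+-0-abelianGroup using (∙-cancelʳ)

  indicator : {P : Set} → Dec P → ℤ
  indicator (yes _) = 1ℤ
  indicator (no _)  = 0ℤ

-- The group ring of ℤ/K, its action on periodic functions, and its quotients

module GroupRing where

  open IntegerSums
  open MonoidSums
  open import Algebra.Bundles using (CommutativeSemiring)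
  open import Data.Fin using (Fin; zero; suc; toℕ; fromℕ<)
  open import Data.Fin.Properties using (toℕ-fromℕ<; toℕ-injective)
  open import Data.Integer as ℤ using (ℤ; 0ℤ) renaming (_+_ to _+ᶻ_; _*_ to _*ᶻ_)
  import Data.Integer.Properties as ℤₚ
  import Data.Integer.Tactic.RingSolver as ℤ-Solver
  open import Data.Nat using (ℕ; zero; suc; _+_; _*_; _<_; _≟_; NonZero)
  open import Data.Nat.DivMod using (_%_; _/_; m%n<n; m≡m%n+[m/n]*n)
  open import Data.Nat.Properties
  open import Data.Nat.Tactic.RingSolver using (solve-∀)
  open import Data.Product using (_,_)
  open import Level using (0ℓ)
  open import Relation.Binary.PropositionalEquality
  open import Relation.Nullary using (yes; no; contradiction)

  module CyclicGroupRing (K : ℕ) {{K≢0 : NonZero K}} where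

    ∑-kronecker : ∀ m → m < K → (f : ℕ → ℤ) → sum {K} (λ c → indicator (m ≟ toℕ c) *ᶻ f (toℕ c)) ≡ f m
    ∑-kronecker m m<K f = trans (sum-single ℤₚ.+-0-commutativeMonoid i _ off) on
      where
      i : Fin K
      i = fromℕ< m<K
      off : ∀ j → j ≢ i → indicator (m ≟ toℕ j) *ᶻ f (toℕ j) ≡ 0ℤ
      off j j≢i with m ≟ toℕ j
      ... | yes m≡j = contradiction (toℕ-injective (trans (sym m≡j) (sym (toℕ-fromℕ< m<K)))) j≢i
      ... | no _    = ℤₚ.*-zeroˡ (f (toℕ j))
      on : indicator (m ≟ toℕ i) *ᶻ f (toℕ i) ≡ f m
      on with m ≟ toℕ i
      ... | yes m≡i = trans (ℤₚ.*-identityˡ _) (cong f (sym m≡i))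
      ... | no m≢i  = contradiction (sym (toℕ-fromℕ< m<K)) m≢i

    R : Set
    R = Fin K → ℤ

    Periodic : (ℕ → ℤ) → Set
    Periodic φ = ∀ i → φ (i + K) ≡ φ i

    periodic-* : ∀ {φ} → Periodic φ → ∀ x i → φ (i + x * K) ≡ φ i
    periodic-* {φ} per zero    i = cong φ (+-identityʳ i)
    periodic-* {φ} per (suc x) i = trans (cong φ (sym (+-assoc i K (x * K))))
      (trans (periodic-* per x (i + K)) (per i))

    periodic-% : ∀ {φ} → Periodic φ → ∀ m x → φ (m % K + x) ≡ φ (m + x)
    periodic-% {φ} per m x = begin
      φ (m % K + x)  ≡⟨ periodic-* per (m / K) _ ⟨
      φ (m % K + x + m / K * K)  ≡⟨ cong φ (swap (m % K) x (m / K * K)) ⟩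
      φ (m % K + m / K * K + x)  ≡⟨ cong (λ z → φ (z + x)) (m≡m%n+[m/n]*n m K) ⟨
      φ (m + x)  ∎
      where
      open ≡-Reasoning
      swap : ∀ a b c → a + b + c ≡ a + c + b
      swap = solve-∀

    -- The action of ℤ[x]/(x^K − 1) in which x shifts: x ▷ φ = φ ∘ suc.
    infixr 8 _▷_

    _▷_ : R → (ℕ → ℤ) → ℕ → ℤ
    (r ▷ φ) b = sum {K} (λ a → r a *ᶻ φ (toℕ a + b))

    0ᴿ : R
    0ᴿ _ = 0ℤ

    infixl 6 _+ᴿ_
    infixl 7 _*ᴿ_ _·ᴿ_

    _+ᴿ_ : R → R → R
    (r +ᴿ s) a = r a +ᶻ s a

    -- The structure constants of the basis of monomials, whose exponents add modulo K. As explicit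
    -- coefficients 0 and 1 they can later be constants of a program expression.
    carry : Fin K → Fin K → Fin K → ℤ
    carry a b c = indicator ((toℕ a + toℕ b) % K ≟ toℕ c)

    _*ᴿ_ : R → R → R
    (r *ᴿ s) c = sum {K} (λ a → sum {K} (λ b → carry a b c *ᶻ (r a *ᶻ s b)))

    monomial : ℕ → R
    monomial e a = indicator (e % K ≟ toℕ a)

    _·ᴿ_ : ℤ → R → R
    (z ·ᴿ r) a = z *ᶻ r a

    ▷-cong : ∀ r {φ ψ} → (∀ i → φ i ≡ ψ i) → ∀ b → (r ▷ φ) b ≡ (r ▷ ψ) b
    ▷-cong r h b = ∑-cong {K} (λ a → cong (r a *ᶻ_) (h (toℕ a + b)))

    ▷-periodic : ∀ r {φ} → Periodic φ → Periodic (r ▷ φ)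
    ▷-periodic r {φ} per b = ∑-cong {K} (λ a → cong (r a *ᶻ_)
      (trans (cong φ (sym (+-assoc (toℕ a) b K))) (per (toℕ a + b))))

    ▷-+ : ∀ r s φ b → ((r +ᴿ s) ▷ φ) b ≡ (r ▷ φ) b +ᶻ (s ▷ φ) b
    ▷-+ r s φ b = trans (∑-cong {K} (λ a → ℤₚ.*-distribʳ-+ (φ (toℕ a + b)) (r a) (s a)))
      (∑-distrib-+ {K} _ _)

    ▷-· : ∀ z r φ b → ((z ·ᴿ r) ▷ φ) b ≡ z *ᶻ (r ▷ φ) b
    ▷-· z r φ b = trans (∑-cong {K} (λ a → ℤₚ.*-assoc z (r a) (φ (toℕ a + b))))
      (sym (*-distribˡ-sum {K} z _))

    ▷-0 : ∀ φ b → (0ᴿ ▷ φ) b ≡ 0ℤ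
    ▷-0 φ b = ∑-zero {K} (λ a → ℤₚ.*-zeroˡ (φ (toℕ a + b)))

    ▷-monomial : ∀ e {φ} → Periodic φ → ∀ b → (monomial e ▷ φ) b ≡ φ (e + b)
    ▷-monomial e {φ} per b = trans (∑-kronecker (e % K) (m%n<n e K) (λ c → φ (c + b)))
      (periodic-% per e b)

    ▷-comm : ∀ r s φ b → (r ▷ (s ▷ φ)) b ≡ (s ▷ (r ▷ φ)) b
    ▷-comm r s φ x = begin
      sum {K} (λ a → r a *ᶻ sum {K} (λ b → s b *ᶻ φ (toℕ b + (toℕ a + x))))
        ≡⟨ ∑-cong {K} (λ a → *-distribˡ-sum {K} (r a) _) ⟩
      sum {K} (λ a → sum {K} (λ b → r a *ᶻ (s b *ᶻ φ (toℕ b + (toℕ a + x)))))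
        ≡⟨ ∑-comm {K} {K} _ ⟩
      sum {K} (λ b → sum {K} (λ a → r a *ᶻ (s b *ᶻ φ (toℕ b + (toℕ a + x)))))
        ≡⟨ ∑-cong {K} (λ b → ∑-cong {K} (λ a → trans
             (cong (λ z → r a *ᶻ (s b *ᶻ φ z)) (swap (toℕ b) (toℕ a) x))
             (swapᶻ (r a) (s b) _))) ⟩
      sum {K} (λ b → sum {K} (λ a → s b *ᶻ (r a *ᶻ φ (toℕ a + (toℕ b + x)))))
        ≡⟨ ∑-cong {K} (λ b → sym (*-distribˡ-sum {K} (s b) _)) ⟩
      sum {K} (λ b → s b *ᶻ sum {K} (λ a → r a *ᶻ φ (toℕ a + (toℕ b + x)))) ∎
      where
      open ≡-Reasoning
      swap : ∀ a b c → a + (b + c) ≡ b + (a + c)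
      swap = solve-∀
      swapᶻ : ∀ a b c → a *ᶻ (b *ᶻ c) ≡ b *ᶻ (a *ᶻ c)
      swapᶻ = ℤ-Solver.solve-∀

    -- The product wraps exponents around modulo K, and periodicity of φ makes this invisible: the
    -- sum over c collapses to the term with c = (a + b) % K.
    ▷-* : ∀ r s {φ} → Periodic φ → ∀ b → ((r *ᴿ s) ▷ φ) b ≡ (r ▷ (s ▷ φ)) b
    ▷-* r s {φ} per x = begin
      sum {K} (λ c → (r *ᴿ s) c *ᶻ φ (toℕ c + x))
        ≡⟨ ∑-cong {K} (λ c → trans (*-distribʳ-sum {K} (φ (toℕ c + x)) _)
            (∑-cong {K} (λ a → trans (*-distribʳ-sum {K} (φ (toℕ c + x)) (λ b → carry a b c *ᶻ (r a *ᶻ s b)))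
               (∑-cong {K} (λ b → swapᶻ (carry a b c) (r a) (s b) (φ (toℕ c + x))))))) ⟩
      sum {K} (λ c → sum {K} (λ a → sum {K} (λ b → r a *ᶻ (s b *ᶻ (carry a b c *ᶻ φ (toℕ c + x))))))
        ≡⟨ ∑-comm {K} {K} _ ⟩
      sum {K} (λ a → sum {K} (λ c → sum {K} (λ b → r a *ᶻ (s b *ᶻ (carry a b c *ᶻ φ (toℕ c + x))))))
        ≡⟨ ∑-cong {K} (λ a → ∑-comm {K} {K} _) ⟩
      sum {K} (λ a → sum {K} (λ b → sum {K} (λ c → r a *ᶻ (s b *ᶻ (carry a b c *ᶻ φ (toℕ c + x))))))
        ≡⟨ ∑-cong {K} (λ a → trans (∑-cong {K} (λ b → trans (sym (*-distribˡ-sum {K} (r a) _))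
             (cong (r a *ᶻ_) (trans (sym (*-distribˡ-sum {K} (s b) _)) (cong (s b *ᶻ_) (inner a b))))))
             (sym (*-distribˡ-sum {K} (r a) _))) ⟩
      (r ▷ (s ▷ φ)) x ∎
      where
      open ≡-Reasoning
      swapᶻ : ∀ a b c d → (a *ᶻ (b *ᶻ c)) *ᶻ d ≡ b *ᶻ (c *ᶻ (a *ᶻ d))
      swapᶻ = ℤ-Solver.solve-∀
      swap : ∀ a b c → a + b + c ≡ b + (a + c)
      swap = solve-∀
      inner : ∀ a b → sum {K} (λ c → carry a b c *ᶻ φ (toℕ c + x)) ≡ φ (toℕ b + (toℕ a + x))
      inner a b = begin
        sum {K} (λ c → carry a b c *ᶻ φ (toℕ c + x))
          ≡⟨ ∑-kronecker _ (m%n<n (toℕ a + toℕ b) K) (λ c → φ (c + x)) ⟩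
        φ ((toℕ a + toℕ b) % K + x)  ≡⟨ periodic-% per (toℕ a + toℕ b) x ⟩
        φ (toℕ a + toℕ b + x)  ≡⟨ cong φ (swap (toℕ a) (toℕ b) x) ⟩
        φ (toℕ b + (toℕ a + x))  ∎

    module Quotient (v : ℕ → ℤ) (per : Periodic v) where

      -- ℤ[x]/(x^K − 1) itself has no principal K-th root of unity; this quotient
      -- has one, namely x, if v sums to 0 over the cosets of every nontrivial subgroup.
      infix 4 _≈_

      record _≈_ (r s : R) : Set where
        constructor pointwise
        field at : ∀ b → (r ▷ v) b ≡ (s ▷ v) b

      open _≈_ public

      -- Agreement at every b, not only at 0, makes the kernel the annihilator of v, which is an
      -- ideal. Since the actions commute, each factor in turn can be brought next to v and replaced
      -- there.
      *ᴿ-cong : ∀ {r r′ s s′} → r ≈ r′ → s ≈ s′ → r *ᴿ s ≈ r′ *ᴿ s′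
      *ᴿ-cong {r} {r′} {s} {s′} p q .at b = begin
        ((r *ᴿ s) ▷ v) b  ≡⟨ ▷-* r s per b ⟩
        (r ▷ (s ▷ v)) b  ≡⟨ ▷-cong r (at q) b ⟩
        (r ▷ (s′ ▷ v)) b  ≡⟨ ▷-comm r s′ v b ⟩
        (s′ ▷ (r ▷ v)) b  ≡⟨ ▷-cong s′ (at p) b ⟩
        (s′ ▷ (r′ ▷ v)) b  ≡⟨ ▷-comm r′ s′ v b ⟨
        (r′ ▷ (s′ ▷ v)) b  ≡⟨ ▷-* r′ s′ per b ⟨
        ((r′ *ᴿ s′) ▷ v) b  ∎
        where open ≡-Reasoning

      *ᴿ-assoc : ∀ r s t → (r *ᴿ s) *ᴿ t ≈ r *ᴿ (s *ᴿ t)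
      *ᴿ-assoc r s t .at b = begin
        (((r *ᴿ s) *ᴿ t) ▷ v) b  ≡⟨ ▷-* (r *ᴿ s) t per b ⟩
        ((r *ᴿ s) ▷ (t ▷ v)) b  ≡⟨ ▷-* r s (▷-periodic t per) b ⟩
        (r ▷ (s ▷ (t ▷ v))) b  ≡⟨ ▷-cong r (▷-* s t per) b ⟨
        (r ▷ ((s *ᴿ t) ▷ v)) b  ≡⟨ ▷-* r (s *ᴿ t) per b ⟨
        ((r *ᴿ (s *ᴿ t)) ▷ v) b  ∎
        where open ≡-Reasoning

      *ᴿ-comm : ∀ r s → r *ᴿ s ≈ s *ᴿ r
      *ᴿ-comm r s .at b = trans (▷-* r s per b) (trans (▷-comm r s v b) (sym (▷-* s r per b)))

      *ᴿ-identityˡ : ∀ r → monomial 0 *ᴿ r ≈ r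
      *ᴿ-identityˡ r .at b = trans (▷-* (monomial 0) r per b) (▷-monomial 0 (▷-periodic r per) b)

      *ᴿ-distribʳ : ∀ r s t → (s +ᴿ t) *ᴿ r ≈ s *ᴿ r +ᴿ t *ᴿ r
      *ᴿ-distribʳ r s t .at b = begin
        (((s +ᴿ t) *ᴿ r) ▷ v) b  ≡⟨ ▷-* (s +ᴿ t) r per b ⟩
        ((s +ᴿ t) ▷ (r ▷ v)) b  ≡⟨ ▷-+ s t (r ▷ v) b ⟩
        (s ▷ (r ▷ v)) b +ᶻ (t ▷ (r ▷ v)) b  ≡⟨ cong₂ _+ᶻ_ (▷-* s r per b) (▷-* t r per b) ⟨
        ((s *ᴿ r) ▷ v) b +ᶻ ((t *ᴿ r) ▷ v) b  ≡⟨ ▷-+ (s *ᴿ r) (t *ᴿ r) v b ⟨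
        ((s *ᴿ r +ᴿ t *ᴿ r) ▷ v) b  ∎
        where open ≡-Reasoning

      *ᴿ-zeroˡ : ∀ r → 0ᴿ *ᴿ r ≈ 0ᴿ
      *ᴿ-zeroˡ r .at b = trans (▷-* 0ᴿ r per b) (trans (▷-0 (r ▷ v) b) (sym (▷-0 v b)))

      open import Algebra.Structures.Biased _≈_ using (isCommutativeSemiringˡ)

      commutativeSemiring : CommutativeSemiring 0ℓ 0ℓ
      commutativeSemiring .CommutativeSemiring.Carrier = R
      commutativeSemiring .CommutativeSemiring._≈_ = _≈_
      commutativeSemiring .CommutativeSemiring._+_ = _+ᴿ_
      commutativeSemiring .CommutativeSemiring._*_ = _*ᴿ_
      commutativeSemiring .CommutativeSemiring.0# = 0ᴿ
      commutativeSemiring .CommutativeSemiring.1# = monomial 0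
      commutativeSemiring .CommutativeSemiring.isCommutativeSemiring = isCommutativeSemiringˡ record
          { +-isCommutativeMonoid = record
            { isMonoid = record
              { isSemigroup = record
                { isMagma = record
                  { isEquivalence = ≈-isEquivalence
                  ; ∙-cong = λ {r} {r′} {s} {s′} p q → pointwise (λ b →
                      trans (▷-+ r s v b) (trans (cong₂ _+ᶻ_ (at p b) (at q b)) (sym (▷-+ r′ s′ v b))))
                  }
                ; assoc = λ r s t → fromPointwise (λ a → ℤₚ.+-assoc (r a) (s a) (t a))
                }
              ; identity = (λ r → fromPointwise (λ a → ℤₚ.+-identityˡ (r a)))
                         , (λ r → fromPointwise (λ a → ℤₚ.+-identityʳ (r a)))
              }
            ; comm = λ r s → fromPointwise (λ a → ℤₚ.+-comm (r a) (s a))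
            }
          ; *-isCommutativeMonoid = record
            { isMonoid = record
              { isSemigroup = record
                { isMagma = record
                  { isEquivalence = ≈-isEquivalence
                  ; ∙-cong = *ᴿ-cong
                  }
                ; assoc = *ᴿ-assoc
                }
              ; identity = *ᴿ-identityˡ
                         , (λ r → ≈-trans (*ᴿ-comm r (monomial 0)) (*ᴿ-identityˡ r))
              }
            ; comm = *ᴿ-comm
            }
          ; distribʳ = *ᴿ-distribʳ
          ; zeroˡ = *ᴿ-zeroˡ
          }
        where
        open import Relation.Binary.Structures using (IsEquivalence)
        ≈-trans : ∀ {r s t} → r ≈ s → s ≈ t → r ≈ t
        ≈-trans p q = pointwise (λ b → trans (at p b) (at q b))
        ≈-isEquivalence : IsEquivalence _≈_
        ≈-isEquivalence = record
          { refl  = pointwise (λ _ → refl)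
          ; sym   = λ p → pointwise (λ b → sym (at p b))
          ; trans = ≈-trans
          }
        fromPointwise : ∀ {r s} → (∀ a → r a ≡ s a) → r ≈ s
        fromPointwise h = pointwise (λ b → ∑-cong {K} (λ a → cong (_*ᶻ v (toℕ a + b)) (h a)))

-- An integer weight on ℤ/K for which x is a principal root of unity

module PrimitiveWeight where

  open IntegerSums
  open GroupRing
  open import Data.Empty using (⊥-elim)
  open import Data.Fin using (toℕ)
  open import Data.Integer as ℤ using (ℤ; 0ℤ; 1ℤ) renaming (_+_ to _+ᶻ_; _*_ to _*ᶻ_; _-_ to _-ᶻ_; _≟_ to _≟ᶻ_)
  import Data.Integer.Properties as ℤₚ
  open import Data.Nat using (ℕ; zero; suc; _+_; _*_; _≤_; _<_; s≤s; NonZero; ≢-nonZero⁻¹)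
  open import Data.Nat.Base using (_!)
  open import Data.Nat.Divisibility
  open import Data.Nat.GCD using (gcd; gcd[m,n]∣m; gcd[m,n]∣n; gcd-GCD; module Bézout)
  open import Data.Nat.Primality
  open import Data.Nat.Primality.Factorisation using (factorise)
  open import Data.Nat.Properties
  open import Data.Nat.ListAction using (product)
  open import Data.Nat.Tactic.RingSolver using (solve-∀)
  open import Data.List using ([]; _∷_)
  open import Data.List.Relation.Unary.All using ([]; _∷_)
  open import Data.Product using (∃-syntax; _×_; _,_)
  open import Data.Sum using (inj₁; inj₂; [_,_]′)
  open import Function using (_∘_)
  open import Relation.Binary.PropositionalEquality
  open import Relation.Nullary using (Dec; yes; no; contradiction; _×-dec_)

  prime-divisor : ∀ n .{{_ : NonZero n}} → n ≢ 1 → ∃[ p ] Prime p × p ∣ n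
  prime-divisor n n≢1 with factorise n
  ... | record { factors = [] ; isFactorisation = eq } = ⊥-elim (n≢1 eq)
  ... | record { factors = p ∷ ps ; isFactorisation = eq ; factorsPrime = pr ∷ _ } =
    p , pr , subst (p ∣_) (sym eq) (m∣m*n (product ps))

  prime∤! : ∀ {p} → Prime p → ∀ r → r < p → p ∤ r !
  prime∤! pr zero    _   p∣1 = contradiction (subst Prime (∣1⇒≡1 p∣1) pr) ¬prime[1]
  prime∤! pr (suc r) r<p p∣ with euclidsLemma (suc r) (r !) pr p∣
  ... | inj₁ p∣r = contradiction (∣⇒≤ p∣r) (<⇒≱ r<p)
  ... | inj₂ p∣! = prime∤! pr r (<-trans (n<1+n r) r<p) p∣!

  module _ (K : ℕ) where

    difference : ∀ {p} → Dec (Prime p × p ∣ K) → (ℕ → ℤ) → ℕ → ℤ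
    difference (yes (_ , p∣K)) w i = w i -ᶻ w (i + quotient p∣K)
    difference (no _)          w i = w i

    -- weight r is the product of the operators 1 − T^(K/p), over the primes
    -- p ≤ r dividing K, applied to the indicator of the multiples of K,
    -- where T is the shift.
    weight : ℕ → ℕ → ℤ
    weight zero    i = indicator (K ∣? i)
    weight (suc r) i = difference (prime? (suc r) ×-dec suc r ∣? K) (weight r) i

    weight-periodic : ∀ r i → weight r (i + K) ≡ weight r i
    weight-periodic zero i with K ∣? i + K | K ∣? i
    ... | yes _ | yes _ = refl
    ... | no _  | no _  = refl
    ... | yes p | no q  = contradiction (∣m+n∣m⇒∣n (subst (K ∣_) (+-comm i K) p) ∣-refl) q
    ... | no p  | yes q = contradiction (∣m∣n⇒∣m+n q ∣-refl) p
    weight-periodic (suc r) i with prime? (suc r) ×-dec suc r ∣? K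
    ... | no _          = weight-periodic r i
    ... | yes (_ , p∣K) = cong₂ _-ᶻ_ (weight-periodic r i)
      (trans (cong (weight r) (swap i K (quotient p∣K))) (weight-periodic r (i + quotient p∣K)))
      where
      swap : ∀ a b c → a + b + c ≡ a + c + b
      swap = solve-∀

    -- Each operator moves the support only by K/p for a prime p ≤ r, and K divides (K/p) r!. This
    -- coarse control of the support is what `weight≡1` uses.
    weight-support : ∀ r i → weight r i ≢ 0ℤ → K ∣ i * r !
    weight-support zero i w≢0 with K ∣? i
    ... | yes p = ∣m⇒∣m*n 1 p
    ... | no _  = contradiction refl w≢0
    weight-support (suc r) i w≢0 with prime? (suc r) ×-dec suc r ∣? K
    ... | no _ = subst (K ∣_) (lemma (suc r) i (r !)) (∣n⇒∣m*n (suc r) (weight-support r i w≢0))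
      where
      lemma : ∀ p i f → p * (i * f) ≡ i * (p * f)
      lemma = solve-∀
    ... | yes (_ , divides t K≡t*p) with weight r i ≟ᶻ 0ℤ | weight r (i + t) ≟ᶻ 0ℤ
    ...   | yes p | yes q = contradiction (cong₂ _-ᶻ_ p q) w≢0
    ...   | no p  | _     = subst (K ∣_) (lemma (suc r) i (r !)) (∣n⇒∣m*n (suc r) (weight-support r i p))
      where
      lemma : ∀ p i f → p * (i * f) ≡ i * (p * f)
      lemma = solve-∀
    -- Multiplying by p = `suc r` turns the shift t = K/p into a multiple of K, which is then
    -- subtracted.
    ...   | yes _ | no q  = ∣m+n∣m⇒∣n
      (subst (K ∣_) (lemma (suc r) i t (r !)) (∣n⇒∣m*n (suc r) (weight-support r (i + t) q)))
      (subst (λ z → K ∣ z * r !) K≡t*p (m∣m*n (r !)))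
      where
      lemma : ∀ p i t f → p * ((i + t) * f) ≡ t * p * f + i * (p * f)
      lemma = solve-∀

    module _ {{K≢0 : NonZero K}} where

      -- The operator for p = `suc r` changes the value at 0 only by `weight r` at K/p. Were that
      -- value nonzero, K would divide (K/p) r!, so the prime p would divide r!, which has only
      -- smaller factors. The value 1 is what later allows an integer to be read off at 0.
      weight≡1 : ∀ r → weight r 0 ≡ 1ℤ
      weight≡1 zero with K ∣? 0
      ... | yes _ = refl
      ... | no ¬p = contradiction (K ∣0) ¬p
      weight≡1 (suc r) with prime? (suc r) ×-dec suc r ∣? K
      ... | no _ = weight≡1 r
      ... | yes (pr , divides t K≡t*p) with weight r t ≟ᶻ 0ℤ
      ...   | yes w≡0 = cong₂ _-ᶻ_ (weight≡1 r) w≡0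
      ...   | no w≢0  = contradiction p∣r! (prime∤! pr r ≤-refl)
        where
        t≢0 : NonZero t
        t≢0 = m*n≢0⇒m≢0 t {{subst NonZero K≡t*p K≢0}}
        p∣r! : suc r ∣ r !
        p∣r! = *-cancelˡ-∣ t {{t≢0}} (subst (_∣ t * r !) K≡t*p (weight-support r t w≢0))

      -- The operator for p makes the sum over a coset of the subgroup of order p telescope. Every
      -- later operator only subtracts two such sums, so they stay 0.
      weight-kill : ∀ r p t a → Prime p → p ≤ r → K ≡ t * p →
        sum {p} (λ j → weight r (a + toℕ j * t)) ≡ 0ℤ
      weight-kill zero p t a pr p≤0 K≡t*p with n≤0⇒n≡0 p≤0
      ... | refl = refl
      weight-kill (suc r) p t a pr p≤r K≡t*p with prime? (suc r) ×-dec suc r ∣? K | m≤n⇒m<n∨m≡n p≤r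
      ... | no _ | inj₁ (s≤s p≤r′) = weight-kill r p t a pr p≤r′ K≡t*p
      ... | no ¬pr | inj₂ refl = contradiction (pr , divides t K≡t*p) ¬pr
      ... | yes (_ , divides t′ _) | inj₁ (s≤s p≤r′) = begin
        sum {p} (λ j → weight r (a + toℕ j * t) -ᶻ weight r (a + toℕ j * t + t′))
          ≡⟨ ∑-distrib-- {p} _ _ ⟩
        sum {p} (λ j → weight r (a + toℕ j * t)) -ᶻ sum {p} (λ j → weight r (a + toℕ j * t + t′))
          ≡⟨ cong₂ _-ᶻ_ (weight-kill r p t a pr p≤r′ K≡t*p)
            (trans (∑-cong {p} (λ j → cong (weight r) (swap a (toℕ j * t) t′)))
                   (weight-kill r p t (a + t′) pr p≤r′ K≡t*p)) ⟩
        0ℤ ∎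
        where
        open ≡-Reasoning
        swap : ∀ a b c → a + b + c ≡ a + c + b
        swap = solve-∀
      -- The operator for p itself: t′ is t, and the differences of consecutive values of φ cancel
      -- around the cycle because p * t is K.
      ... | yes (_ , divides t′ K≡t′*p) | inj₂ refl = begin
        sum {p} (λ j → φ (toℕ j) -ᶻ weight r (a + toℕ j * t + t′))
          ≡⟨ ∑-distrib-- {p} (φ ∘ toℕ) (λ j → weight r (a + toℕ j * t + t′)) ⟩
        sum {p} (φ ∘ toℕ) -ᶻ sum {p} (λ j → weight r (a + toℕ j * t + t′))
          ≡⟨ cong (sum {p} (φ ∘ toℕ) -ᶻ_) (∑-cong {p} (λ j → cong (weight r) (next (toℕ j)))) ⟩
        sum {p} (φ ∘ toℕ) -ᶻ sum {p} (λ i → φ (suc (toℕ i)))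
          ≡⟨ cancel (sum {p} (φ ∘ toℕ)) (sum {p} (λ j → φ (suc (toℕ j)))) (φ 0) (trans (∑-shift p φ) (cong (λ z → sum {p} (φ ∘ toℕ) +ᶻ z) φp≡φ0)) ⟩
        0ℤ ∎
        where
        open ≡-Reasoning
        φ : ℕ → ℤ
        φ j = weight r (a + j * t)
        t′≡t : t′ ≡ t
        t′≡t = *-cancelʳ-≡ t′ t (suc r) (trans (sym K≡t′*p) K≡t*p)
        next : ∀ j → a + j * t + t′ ≡ a + suc j * t
        next j rewrite t′≡t = lemma a (j * t) t
          where
          lemma : ∀ a b c → a + b + c ≡ a + (c + b)
          lemma = solve-∀
        φp≡φ0 : φ p ≡ φ 0
        φp≡φ0 = begin
          weight r (a + p * t)  ≡⟨ cong (λ z → weight r (a + z)) (trans (*-comm p t) (sym K≡t*p)) ⟩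
          weight r (a + K)  ≡⟨ weight-periodic r a ⟩
          weight r a  ≡⟨ cong (weight r) (+-identityʳ a) ⟨
          φ 0  ∎
        cancel : ∀ x y z → y +ᶻ z ≡ x +ᶻ z → x -ᶻ y ≡ 0ℤ
        cancel x y z eq = ℤₚ.i≡j⇒i-j≡0 {x} {y} (sym (+ᶻ-cancelʳ z eq))

      primitive-weight : ℕ → ℤ
      primitive-weight = weight K

      periodic : ∀ i → primitive-weight (i + K) ≡ primitive-weight i
      periodic = weight-periodic K

      periodic* : ∀ x i → primitive-weight (i + x * K) ≡ primitive-weight i
      periodic* = CyclicGroupRing.periodic-* K periodic

      module _ (k s : ℕ) (K∣ks : K ∣ k * s) (K∤s : K ∤ s) where

        private
          S : ℕ → ℤ
          S a = sum {k} (λ l → primitive-weight (a + toℕ l * s))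

          S-s : ∀ a → S (a + s) ≡ S a
          S-s a = +ᶻ-cancelʳ (φ 0) (begin
            S (a + s) +ᶻ φ 0  ≡⟨ cong (_+ᶻ φ 0) (∑-cong {k} (λ l → cong primitive-weight (+-assoc a s _))) ⟩
            sum {k} (λ i → φ (suc (toℕ i))) +ᶻ φ 0  ≡⟨ ∑-shift k φ ⟩
            S a +ᶻ φ k  ≡⟨ cong (λ z → S a +ᶻ z) φk≡φ0 ⟩
            S a +ᶻ φ 0  ∎)
            where
            open ≡-Reasoning
            φ : ℕ → ℤ
            φ j = primitive-weight (a + j * s)
            φk≡φ0 : φ k ≡ φ 0
            φk≡φ0 = trans (cong (λ z → primitive-weight (a + z)) (m∣n⇒n≡quotient*m K∣ks))
              (trans (periodic* (quotient K∣ks) a) (cong primitive-weight (sym (+-identityʳ a))))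

          S-s* : ∀ x a → S (a + x * s) ≡ S a
          S-s* zero    a = cong S (+-identityʳ a)
          S-s* (suc x) a = trans (cong S (sym (+-assoc a s (x * s)))) (trans (S-s* x (a + s)) (S-s a))

          S-K* : ∀ x a → S (a + x * K) ≡ S a
          S-K* x a = ∑-cong {k} (λ l → trans (cong primitive-weight (swap a (x * K) (toℕ l * s))) (periodic* x _))
            where
            swap : ∀ a b c → a + b + c ≡ a + c + b
            swap = solve-∀

          g : ℕ
          g = gcd s K

          -- S has the periods s and K, hence by Bézout their gcd. Natural numbers have no negative
          -- multiples, so each sign pattern of the identity is handled by adding a period on the
          -- side where it is missing.
          S-g : ∀ a → S (a + g) ≡ S a
          S-g a with Bézout.identity (gcd-GCD s K)
          ... | Bézout.+- x y eq = begin
            S (a + g)  ≡⟨ S-K* y (a + g) ⟨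
            S (a + g + y * K)  ≡⟨ cong S (trans (+-assoc a g _) (cong (a +_) eq)) ⟩
            S (a + x * s)  ≡⟨ S-s* x a ⟩
            S a  ∎
            where open ≡-Reasoning
          ... | Bézout.-+ x y eq = begin
            S (a + g)  ≡⟨ S-s* x (a + g) ⟨
            S (a + g + x * s)  ≡⟨ cong S (trans (+-assoc a g _) (cong (a +_) eq)) ⟩
            S (a + y * K)  ≡⟨ S-K* y a ⟩
            S a  ∎
            where open ≡-Reasoning

          S-g* : ∀ x a → S (a + x * g) ≡ S a
          S-g* zero    a = cong S (+-identityʳ a)
          S-g* (suc x) a = trans (cong S (sym (+-assoc a g (x * g)))) (trans (S-g* x (a + g)) (S-g a))

        -- The sum S a is invariant under adding gcd s K to a, hence under adding
        -- some K/p, and averaging over the multiples of K/p gives 0.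
        primitive-weight-kill : ∀ a → S a ≡ 0ℤ
        primitive-weight-kill a = go (gcd[m,n]∣n s K)
          where
          go : g ∣ K → S a ≡ 0ℤ
          go (divides h K≡h*g) = go′ (prime-divisor h {{h≢0}} h≢1)
            where
            h≢0 : NonZero h
            h≢0 = m*n≢0⇒m≢0 h {{subst NonZero K≡h*g K≢0}}
            h≢1 : h ≢ 1
            h≢1 refl = K∤s (subst (_∣ s) (sym (trans K≡h*g (+-identityʳ g))) (gcd[m,n]∣m s K))
            go′ : (∃[ p ] Prime p × p ∣ h) → S a ≡ 0ℤ
            -- With t = K/p a period of S, p copies of S a are a double sum whose inner sums run
            -- over cosets of the subgroup of order p. As ℤ has no zero divisors, p then cancels.
            go′ (p , pr , divides x h≡x*p) = [ (λ p≡0 → contradiction (ℤₚ.+-injective p≡0) (≢-nonZero⁻¹ p)) , (λ eq → eq) ]′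
              (ℤₚ.i*j≡0⇒i≡0∨j≡0 (ℤ.+ p) (begin
                ℤ.+ p *ᶻ S a  ≡⟨ ∑-const p (S a) ⟨
                sum {p} (λ _ → S a)  ≡⟨ ∑-cong {p} (λ j → sym (S-t (toℕ j))) ⟩
                sum {p} (λ j → S (a + toℕ j * t))  ≡⟨ ∑-comm {p} {k} _ ⟩
                sum {k} (λ l → sum {p} (λ j → primitive-weight (a + toℕ j * t + toℕ l * s)))
                  ≡⟨ ∑-zero {k} (λ l → trans (∑-cong {p} (λ j → cong primitive-weight (swap a (toℕ j * t) (toℕ l * s))))
                      (weight-kill K p t (a + toℕ l * s) pr p≤K K≡t*p)) ⟩
                0ℤ  ∎))
              where
              open ≡-Reasoning
              instance
                p≢0 : NonZero p
                p≢0 = prime⇒nonZero pr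
              t : ℕ
              t = x * g
              K≡t*p : K ≡ t * p
              K≡t*p = trans K≡h*g (trans (cong (_* g) h≡x*p) (lemma x p g))
                where
                lemma : ∀ a b c → a * b * c ≡ a * c * b
                lemma = solve-∀
              p≤K : p ≤ K
              p≤K = ∣⇒≤ (divides t K≡t*p)
              S-t : ∀ j → S (a + j * t) ≡ S a
              S-t j = trans (cong (λ z → S (a + z)) (sym (*-assoc j x g))) (S-g* (j * x) a)
              swap : ∀ a b c → a + b + c ≡ a + c + b
              swap = solve-∀

-- Tensor powers of matrices and Yates' algorithm

module YatesTransform where

  open import Algebra.Bundles using (CommutativeSemiring)
  open import Data.Fin using (Fin; toℕ)
  open import Data.Fin.Properties using (toℕ-injective; toℕ<n; toℕ-fromℕ<)
  open import Data.Nat as ℕ using (ℕ; zero; suc; NonZero; _^_)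
  open import Data.Nat.DivMod using (_mod_; _/_; _%_; [m+kn]%n≡m%n; m<n⇒m%n≡m; m<n⇒m/n≡0; +-distrib-/-∣ʳ; m*n/n≡m; m%n<n)
  open import Data.Nat.Divisibility using (n∣m*n)
  import Data.Nat.Properties as ℕₚ
  open import Data.Nat.Tactic.RingSolver using (solve-∀)
  open import Data.Vec using (Vec; []; _∷_)
  open import Level using (0ℓ)
  open import Relation.Binary.PropositionalEquality as ≡ using (_≡_; cong; cong₂)

  [q*t+y]mod-t : ∀ {t} {{_ : NonZero t}} q (y : Fin t) → (q ℕ.* t ℕ.+ toℕ y) mod t ≡ y
  [q*t+y]mod-t {t} q y = toℕ-injective (≡.trans (toℕ-fromℕ< (m%n<n _ t))
    (≡.trans (cong (_% t) (ℕₚ.+-comm (q ℕ.* t) (toℕ y)))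
    (≡.trans ([m+kn]%n≡m%n (toℕ y) q t) (m<n⇒m%n≡m (toℕ<n y)))))

  [q*t+y]/t : ∀ {t} {{_ : NonZero t}} q (y : Fin t) → (q ℕ.* t ℕ.+ toℕ y) / t ≡ q
  [q*t+y]/t {t} q y = ≡.trans (cong (_/ t) (ℕₚ.+-comm (q ℕ.* t) (toℕ y)))
    (≡.trans (+-distrib-/-∣ʳ (toℕ y) {d = t} (n∣m*n q))
    (cong₂ ℕ._+_ (m<n⇒m/n≡0 (toℕ<n y)) (m*n/n≡m q t)))

  -- Base-s notation with the first coordinate most significant, so that it agrees with the
  -- lexicographic order of `tuples`.
  index : ∀ {s j} → Vec (Fin s) j → ℕ
  index                 []       = 0
  index {s} {suc j} (x ∷ xs) = toℕ x ℕ.* s ^ j ℕ.+ index xs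

  module _ (𝓢 : CommutativeSemiring 0ℓ 0ℓ) where

    open CommutativeSemiring 𝓢
    open import Algebra.Properties.Semiring.Sum semiring
    open import Relation.Binary.Reasoning.Setoid setoid
    open import Algebra.Solver.CommutativeMonoid *-commutativeMonoid using (solve; _⊕_; _⊜_)

    ∑ⱽ : ∀ {s} j → (Vec (Fin s) j → Carrier) → Carrier
    ∑ⱽ     zero    φ = φ []
    ∑ⱽ {s} (suc j) φ = sum {s} (λ u → ∑ⱽ j (λ us → φ (u ∷ us)))

    ∑ⱽ-cong : ∀ {s} j {φ ψ : Vec (Fin s) j → Carrier} → (∀ us → φ us ≈ ψ us) → ∑ⱽ j φ ≈ ∑ⱽ j ψ
    ∑ⱽ-cong     zero    h = h []
    ∑ⱽ-cong {s} (suc j) h = sum-cong-≋ {s} (λ u → ∑ⱽ-cong j (λ us → h (u ∷ us)))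

    ∑ⱽ-distribˡ : ∀ {s} j x (φ : Vec (Fin s) j → Carrier) → x * ∑ⱽ j φ ≈ ∑ⱽ j (λ us → x * φ us)
    ∑ⱽ-distribˡ     zero    x φ = refl
    ∑ⱽ-distribˡ {s} (suc j) x φ = trans (*-distribˡ-sum {s} x _)
      (sum-cong-≋ {s} (λ u → ∑ⱽ-distribˡ j x (λ us → φ (u ∷ us))))

    ∑ⱽ-distribʳ : ∀ {s} j x (φ : Vec (Fin s) j → Carrier) → ∑ⱽ j φ * x ≈ ∑ⱽ j (λ us → φ us * x)
    ∑ⱽ-distribʳ j x φ = trans (*-comm _ x)
      (trans (∑ⱽ-distribˡ j x φ) (∑ⱽ-cong j (λ us → *-comm x (φ us))))

    ∑ⱽ-∑-comm : ∀ {s t} j (φ : Fin t → Vec (Fin s) j → Carrier) →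
      ∑ⱽ j (λ us → sum {t} (λ y → φ y us)) ≈ sum {t} (λ y → ∑ⱽ j (φ y))
    ∑ⱽ-∑-comm         zero    φ = refl
    ∑ⱽ-∑-comm {s} {t} (suc j) φ = trans
      (sum-cong-≋ {s} (λ u → ∑ⱽ-∑-comm {t = t} j (λ y us → φ y (u ∷ us))))
      (∑-comm {s} {t} _)

    ∑ⱽ-comm : ∀ {s t} i j (φ : Vec (Fin t) i → Vec (Fin s) j → Carrier) →
      ∑ⱽ i (λ ys → ∑ⱽ j (φ ys)) ≈ ∑ⱽ j (λ us → ∑ⱽ i (λ ys → φ ys us))
    ∑ⱽ-comm         zero    j φ = refl
    ∑ⱽ-comm {s} {t} (suc i) j φ = trans
      (sum-cong-≋ {t} (λ y → ∑ⱽ-comm i j (λ ys → φ (y ∷ ys))))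
      (sym (∑ⱽ-∑-comm {t = t} j _))

    module _ {t s : ℕ} (M : Fin t → Fin s → Carrier) where

      -- The entries of the j-th Kronecker power of M.
      power : ∀ {j} → Vec (Fin t) j → Vec (Fin s) j → Carrier
      power []       []       = 1#
      power (y ∷ ys) (u ∷ us) = M y u * power ys us

      module _ {{_ : NonZero t}} where

        -- Transforms the leading coordinate and moves it to the end.
        layer : ℕ → (ℕ → Carrier) → ℕ → Carrier
        layer Q F p = sum {s} (λ u → M (p mod t) u * F (toℕ u ℕ.* Q ℕ.+ p / t))

        -- `A` counts the values of the coordinates already transformed, which occupy the low end of
        -- a position. Since every layer rotates the coordinates by one place, all layers have the
        -- same form, and the original order is restored at the end.
        yates : ℕ → ℕ → (ℕ → Carrier) → ℕ → Carrier
        yates zero    A F = F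
        yates (suc j) A F = yates j (A ℕ.* t) (layer (s ^ j ℕ.* A) F)

        -- For the induction, b encodes the coordinates already transformed: they stand behind the
        -- untransformed ones in the input and in front of the new ones in the output. A layer
        -- replaces b by b * t + y.
        yates-correct : ∀ j A F (ys : Vec (Fin t) j) b →
          yates j A F (b ℕ.* t ^ j ℕ.+ index ys) ≈ ∑ⱽ j (λ us → power ys us * F (index us ℕ.* A ℕ.+ b))
        yates-correct zero    A F []       b =
          trans (reflexive (cong F (≡.trans (ℕₚ.+-identityʳ _) (ℕₚ.*-identityʳ b)))) (sym (*-identityˡ (F b)))
        yates-correct (suc j) A F (y ∷ ys) b = begin
          yates j (A ℕ.* t) F′ (b ℕ.* t ^ suc j ℕ.+ (toℕ y ℕ.* t ^ j ℕ.+ index ys))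
            ≡⟨ cong (yates j (A ℕ.* t) F′) (position b (t ^ j) t (toℕ y) (index ys)) ⟩
          yates j (A ℕ.* t) F′ ((b ℕ.* t ℕ.+ toℕ y) ℕ.* t ^ j ℕ.+ index ys)
            ≈⟨ yates-correct j (A ℕ.* t) F′ ys (b ℕ.* t ℕ.+ toℕ y) ⟩
          ∑ⱽ j (λ us → power ys us * F′ (index us ℕ.* (A ℕ.* t) ℕ.+ (b ℕ.* t ℕ.+ toℕ y)))
            ≈⟨ ∑ⱽ-cong j (λ us → trans (*-congˡ (layer-value (index us)))
                 (trans (*-distribˡ-sum {s} (power ys us) _)
                   (sum-cong-≋ {s} (λ u → trans
                     (rearrange (power ys us) (M y u) _)
                     (*-congˡ (reflexive (cong F (address (toℕ u) (s ^ j) A (index us) b)))))))) ⟩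
          ∑ⱽ j (λ us → sum {s} (λ u → (M y u * power ys us) * F (index (u ∷ us) ℕ.* A ℕ.+ b)))
            ≈⟨ ∑ⱽ-∑-comm {t = s} j _ ⟩
          sum {s} (λ u → ∑ⱽ j (λ us → (M y u * power ys us) * F (index (u ∷ us) ℕ.* A ℕ.+ b))) ∎
          where
          F′ : ℕ → Carrier
          F′ = layer (s ^ j ℕ.* A) F
          position : ∀ b T t y i → b ℕ.* (t ℕ.* T) ℕ.+ (y ℕ.* T ℕ.+ i) ≡ (b ℕ.* t ℕ.+ y) ℕ.* T ℕ.+ i
          position = solve-∀
          address : ∀ u S A i b → u ℕ.* (S ℕ.* A) ℕ.+ (i ℕ.* A ℕ.+ b) ≡ (u ℕ.* S ℕ.+ i) ℕ.* A ℕ.+ b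
          address = solve-∀
          regroup : ∀ i A t b y → i ℕ.* (A ℕ.* t) ℕ.+ (b ℕ.* t ℕ.+ y) ≡ (i ℕ.* A ℕ.+ b) ℕ.* t ℕ.+ y
          regroup = solve-∀
          layer-value : ∀ i → F′ (i ℕ.* (A ℕ.* t) ℕ.+ (b ℕ.* t ℕ.+ toℕ y)) ≈
            sum {s} (λ u → M y u * F (toℕ u ℕ.* (s ^ j ℕ.* A) ℕ.+ (i ℕ.* A ℕ.+ b)))
          layer-value i rewrite regroup i A t b (toℕ y) = sum-cong-≋ {s} (λ u → reflexive (cong₂ _*_
            (cong (λ z → M z u) ([q*t+y]mod-t (i ℕ.* A ℕ.+ b) y))
            (cong (λ z → F (toℕ u ℕ.* (s ^ j ℕ.* A) ℕ.+ z)) ([q*t+y]/t (i ℕ.* A ℕ.+ b) y))))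
          rearrange : ∀ x y z → x * (y * z) ≈ (y * x) * z
          rearrange = solve 3 (λ x y z → x ⊕ (y ⊕ z) ⊜ (y ⊕ x) ⊕ z) refl

    module _ {c d : ℕ} (α β : Fin c → Fin d → Carrier) (γ : Fin d → Fin c → Carrier)
      (T : Fin d → Fin d → Fin d → Carrier)
      (decomposition : ∀ v u w → sum {c} (λ y → γ v y * (α y u * β y w)) ≈ T v u w) where

      tensorPower : ∀ {j} → Vec (Fin d) j → Vec (Fin d) j → Vec (Fin d) j → Carrier
      tensorPower []       []       []       = 1#
      tensorPower (v ∷ vs) (u ∷ us) (w ∷ ws) = T v u w * tensorPower vs us ws

      -- A tensor product of rank decompositions is a rank decomposition: the sum over y ∷ ys of a
      -- product of coordinatewise factors splits into a product of sums.
      power-decomposition : ∀ j (vs us ws : Vec (Fin d) j) →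
        ∑ⱽ j (λ ys → power γ vs ys * (power α ys us * power β ys ws)) ≈ tensorPower vs us ws
      power-decomposition zero    []       []       []       =
        trans (*-identityˡ _) (*-identityˡ _)
      power-decomposition (suc j) (v ∷ vs) (u ∷ us) (w ∷ ws) = begin
        sum {c} (λ y → ∑ⱽ j (λ ys → (γ v y * power γ vs ys) * ((α y u * power α ys us) * (β y w * power β ys ws))))
          ≈⟨ sum-cong-≋ {c} (λ y → trans (∑ⱽ-cong j (λ ys → rearrange _ _ _ _ _ _)) (sym (∑ⱽ-distribˡ j _ _))) ⟩
        sum {c} (λ y → (γ v y * (α y u * β y w)) * ∑ⱽ j (λ ys → power γ vs ys * (power α ys us * power β ys ws)))
          ≈⟨ *-distribʳ-sum {c} _ _ ⟨
        sum {c} (λ y → γ v y * (α y u * β y w)) * ∑ⱽ j (λ ys → power γ vs ys * (power α ys us * power β ys ws))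
          ≈⟨ *-cong (decomposition v u w) (power-decomposition j vs us ws) ⟩
        T v u w * tensorPower vs us ws ∎
        where
        rearrange : ∀ a a′ b b′ c c′ → (a * a′) * ((b * b′) * (c * c′)) ≈ (a * (b * c)) * (a′ * (b′ * c′))
        rearrange = solve 6 (λ a a′ b b′ c c′ →
          (a ⊕ a′) ⊕ ((b ⊕ b′) ⊕ (c ⊕ c′)) ⊜ (a ⊕ (b ⊕ c)) ⊕ (a′ ⊕ (b′ ⊕ c′))) refl

      -- After expanding and exchanging the sums, the sum over ys is innermost and no longer meets g
      -- or h except as a constant factor, so `power-decomposition` evaluates it.
      bilinear : ∀ j (g h : Vec (Fin d) j → Carrier) (vs : Vec (Fin d) j) →
        ∑ⱽ j (λ ys → power γ vs ys * (∑ⱽ j (λ us → power α ys us * g us) * ∑ⱽ j (λ ws → power β ys ws * h ws)))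
          ≈ ∑ⱽ j (λ us → ∑ⱽ j (λ ws → tensorPower vs us ws * (g us * h ws)))
      bilinear j g h vs = begin
        ∑ⱽ j (λ ys → power γ vs ys * (∑ⱽ j (λ us → power α ys us * g us) * ∑ⱽ j (λ ws → power β ys ws * h ws)))
          ≈⟨ ∑ⱽ-cong j (λ ys → trans (*-congˡ (trans (∑ⱽ-distribʳ j _ _) (∑ⱽ-cong j (λ us → ∑ⱽ-distribˡ j _ _))))
               (trans (∑ⱽ-distribˡ j _ _) (∑ⱽ-cong j (λ us → trans (∑ⱽ-distribˡ j _ _)
                 (∑ⱽ-cong j (λ ws → rearrange _ _ _ _ _)))))) ⟩
        ∑ⱽ j (λ ys → ∑ⱽ j (λ us → ∑ⱽ j (λ ws → (power γ vs ys * (power α ys us * power β ys ws)) * (g us * h ws))))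
          ≈⟨ ∑ⱽ-comm j j _ ⟩
        ∑ⱽ j (λ us → ∑ⱽ j (λ ys → ∑ⱽ j (λ ws → (power γ vs ys * (power α ys us * power β ys ws)) * (g us * h ws))))
          ≈⟨ ∑ⱽ-cong j (λ us → trans (∑ⱽ-comm j j _) (∑ⱽ-cong j (λ ws →
               trans (sym (∑ⱽ-distribʳ j _ _)) (*-congʳ (power-decomposition j vs us ws))))) ⟩
        ∑ⱽ j (λ us → ∑ⱽ j (λ ws → tensorPower vs us ws * (g us * h ws))) ∎
        where
        rearrange : ∀ a b g c h → a * ((b * g) * (c * h)) ≈ (a * (b * c)) * (g * h)
        rearrange = solve 5 (λ a b g c h → a ⊕ ((b ⊕ g) ⊕ (c ⊕ h)) ⊜ (a ⊕ (b ⊕ c)) ⊕ (g ⊕ h)) refl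

-- The rank decomposition given by a cyclic partition

module RankDecomposition where

  open IntegerSums
  open MonoidSums
  open PrimitiveWeight
  open GroupRing
  open import Algebra.Bundles using (CommutativeMonoid; CommutativeSemiring)
  open import Data.Bool.Properties using (T?)
  open import Data.Fin using (Fin; zero; suc; toℕ; splitAt; _↑ˡ_; _↑ʳ_)
  open import Data.Fin.Properties using (toℕ<n; toℕ-fromℕ<; toℕ-injective; splitAt-↑ˡ; splitAt-↑ʳ)
  open import Data.Integer as ℤ using (ℤ; 0ℤ) renaming (_+_ to _+ᶻ_; _*_ to _*ᶻ_)
  import Data.Integer.Properties as ℤₚ
  import Data.Integer.Tactic.RingSolver as ℤ-Solver
  open import Data.List using (tabulate)
  open import Data.Nat using (ℕ; zero; suc; _+_; _*_; _∸_; _≤_; _<_; NonZero)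
  open import Data.Nat.Base using (_!)
  open import Data.Nat.DivMod using (_%_; _/_; m%n<n; m≡m%n+[m/n]*n; m/n*n≡m)
  open import Data.Nat.Divisibility
  import Data.Nat.ListAction as ℕ-List
  open import Data.Nat.Properties
  open import Data.Nat.Tactic.RingSolver using (solve-∀)
  open import Data.Product using (Σ; _,_; proj₁; proj₂; uncurry)
  open import Data.Sum using (_⊎_; inj₁; inj₂; map₂)
  open import Function.Bundles using (_↔_; Inverse)
  open import Relation.Binary.PropositionalEquality
  open import Relation.Nullary using (Dec; yes; no; contradiction)

  indicator-cong : ∀ {P Q : Set} (p : Dec P) (q : Dec Q) → (P → Q) → (Q → P) → indicator p ≡ indicator q
  indicator-cong (yes _) (yes _) _ _ = refl
  indicator-cong (no _)  (no _)  _ _ = refl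
  indicator-cong (yes p) (no ¬q) f _ = contradiction (f p) ¬q
  indicator-cong (no ¬p) (yes q) _ g = contradiction (g q) ¬p

  place : ∀ {m} (k : Fin (suc m) → ℕ) → Fin (k zero) ⊎ Σ (Fin m) (λ i → Fin (k (suc i))) → Σ (Fin (suc m)) (λ i → Fin (k i))
  place k (inj₁ z)       = zero , z
  place k (inj₂ (i , z)) = suc i , z

  -- The transformed coordinate ranges over consecutive blocks, one of length `k i` per minor; the
  -- result is the minor and the frequency within it.
  locate : ∀ {m} (k : Fin m → ℕ) → Fin (ℕ-List.sum (tabulate k)) → Σ (Fin m) (λ i → Fin (k i))
  locate {suc m} k y = place k (map₂ (locate (λ i → k (suc i))) (splitAt (k zero) y))

  module _ {c ℓ} (M : CommutativeMonoid c ℓ) where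
    open CommutativeMonoid M renaming (refl to ≈-refl; sym to ≈-sym; trans to ≈-trans)
    open import Algebra.Properties.CommutativeMonoid.Sum M using (sum-cong-≋) renaming (sum to ∑)

    sum-splitAt : ∀ a b (φ : Fin (a + b) → Carrier) →
      ∑ {a + b} φ ≈ ∑ {a} (λ i → φ (i ↑ˡ b)) ∙ ∑ {b} (λ i → φ (a ↑ʳ i))
    sum-splitAt zero    b φ = ≈-sym (identityˡ _)
    sum-splitAt (suc a) b φ = ≈-trans (∙-congˡ (sum-splitAt a b (λ i → φ (suc i)))) (≈-sym (assoc _ _ _))

    sum-locate : ∀ {m} (k : Fin m → ℕ) (Φ : (i : Fin m) → Fin (k i) → Carrier) →
      ∑ (λ y → uncurry Φ (locate k y)) ≈ ∑ {m} (λ i → ∑ {k i} (Φ i))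
    sum-locate {zero}  k Φ = ≈-refl
    sum-locate {suc m} k Φ = ≈-trans (sum-splitAt (k zero) rest _) (∙-cong
      (sum-cong-≋ {k zero} (λ z → reflexive (cong value (splitAt-↑ˡ (k zero) z rest))))
      (≈-trans (sum-cong-≋ {rest} (λ y → reflexive (cong value (splitAt-↑ʳ (k zero) rest y))))
               (sum-locate (λ i → k (suc i)) (λ i → Φ (suc i)))))
      where
      rest : ℕ
      rest = ℕ-List.sum (tabulate (λ i → k (suc i)))
      value : Fin (k zero) ⊎ Fin rest → Carrier
      value x = uncurry Φ (place k (map₂ (locate (λ i → k (suc i))) x))

  -- Here k ∸ x stands for -x. With r = e % k, the number r + (k ∸ x) lies strictly between 0 and
  -- 2k, so k divides it only if it equals k.
  k∣residue⇒≡ : ∀ k {{_ : NonZero k}} e x → x < k → k ∣ e + (k ∸ x) → x ≡ e % k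
  k∣residue⇒≡ k e x x<k k∣ = go (∣m+n∣m⇒∣n (subst (k ∣_) shuffle k∣) (n∣m*n (e / k)))
    where
    r = e % k
    shuffle : e + (k ∸ x) ≡ e / k * k + (r + (k ∸ x))
    shuffle = trans (cong (_+ (k ∸ x)) (m≡m%n+[m/n]*n e k)) (lemma r (e / k * k) (k ∸ x))
      where
      lemma : ∀ a b c → a + b + c ≡ b + (a + c)
      lemma = solve-∀
    go : k ∣ r + (k ∸ x) → x ≡ r
    go (divides zero eq) = contradiction (m+n≡0⇒n≡0 r eq) (m>n⇒m∸n≢0 x<k)
    go (divides 1 eq) = +-cancelʳ-≡ k x r (trans (+-comm x k) (sym (begin
      r + k  ≡⟨ cong (r +_) (m∸n+n≡m (<⇒≤ x<k)) ⟨
      r + (k ∸ x + x)  ≡⟨ +-assoc r (k ∸ x) x ⟨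
      r + (k ∸ x) + x  ≡⟨ cong (_+ x) (trans eq (*-identityˡ k)) ⟩
      k + x  ∎)))
      where open ≡-Reasoning
    go (divides (suc (suc j)) eq) = contradiction eq (<⇒≢ (begin-strict
      r + (k ∸ x)  <⟨ +-mono-<-≤ (m%n<n e k) (m∸n≤m k x) ⟩
      k + k  ≤⟨ +-monoʳ-≤ k (m≤m+n k (j * k)) ⟩
      suc (suc j) * k  ∎))
      where open ≤-Reasoning

  k∣e+[k∸e%k] : ∀ k {{_ : NonZero k}} e → k ∣ e + (k ∸ e % k)
  k∣e+[k∸e%k] k e = divides (suc (e / k)) (begin
    e + (k ∸ e % k)  ≡⟨ cong (_+ (k ∸ e % k)) (m≡m%n+[m/n]*n e k) ⟩
    e % k + e / k * k + (k ∸ e % k)  ≡⟨ lemma (e % k) (e / k * k) (k ∸ e % k) ⟩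
    (k ∸ e % k + e % k) + e / k * k  ≡⟨ cong (_+ e / k * k) (m∸n+n≡m (<⇒≤ (m%n<n e k))) ⟩
    suc (e / k) * k  ∎)
    where
    open ≡-Reasoning
    lemma : ∀ a b c → a + b + c ≡ (c + a) + b
    lemma = solve-∀

  module Decomposition {D : Set} {d : ℕ} (enum : D ↔ Fin d) (f : D → D → D) (P : CyclicPartition f)
    (K : ℕ) {{K≢0 : NonZero K}} (k∣K : ∀ i → NonZero (CyclicPartition.k P i) → CyclicPartition.k P i ∣ K) where

    open CyclicPartition P
    open CyclicGroupRing K
    open Convolution enum using (_≟ᴰ_)
    private
      module Cyclic i = IsCyclic (isCyclic i)
      from : Fin d → D
      from = Inverse.from enum

    v : ℕ → ℤ
    v = primitive-weight K

    open Quotient v (periodic K) public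

    𝓡 : CommutativeSemiring _ _
    𝓡 = commutativeSemiring

    open CommutativeSemiring 𝓡 using (+-commutativeMonoid) renaming
      (_≈_ to _≈ᴿ_; refl to ≈-refl; sym to ≈-sym; trans to ≈-trans; *-cong to *-≈-cong; zeroˡ to ≈-zeroˡ; zeroʳ to ≈-zeroʳ)
    open import Algebra.Properties.CommutativeMonoid.Sum +-commutativeMonoid using (sum-cong-≋) renaming (sum to ∑ᴿ)

    -- The exponent for which x^(K/k) serves as k-th root of unity. The value at 0 is a default: a
    -- minor with k = 0 contributes no coordinate.
    scale : ℕ → ℕ
    scale zero      = 0
    scale k@(suc _) = K / k

    scale-*-k : ∀ i → Fin (k i) → scale (k i) * k i ≡ K
    scale-*-k i z with k i | k∣K i
    ... | suc _ | k∣K = m/n*n≡m (k∣K _)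

    -- The value at e of the z-th character of ℤ/k, written with the root of unity x^(K/k).
    character : ∀ i → Fin (k i) → ℕ → R
    character i z e = monomial (toℕ z * (scale (k i) * e))

    restricted : ∀ {P : Set} → Dec P → (P → R) → R
    restricted (yes p) r = r p
    restricted (no _)  r = 0ᴿ

    -- α and β are the Fourier transforms of the minors, and γ is K times the inverse.
    αᵢ βᵢ : ∀ i → Fin (k i) → Fin d → R
    αᵢ i z u = restricted (T? (A i (from u))) (λ p → character i z (toℕ (Cyclic.σA i (from u , p))))
    βᵢ i z w = restricted (T? (B i (from w))) (λ p → character i z (toℕ (Cyclic.σB i (from w , p))))

    γᵢ : ∀ i → Fin (k i) → Fin d → R
    -- The factor K/k replaces 1/k, so no division occurs and all minors share the factor K. The
    -- exponent `k i ∸ toℕ y` stands for -y, and the indicator pulls the output x back along σC.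
    γᵢ i z x = ((ℤ.+ scale (k i)) ·ᴿ ∑ᴿ {k i} (λ y →
      (indicator (from x ≟ᴰ Cyclic.σC i y) ·ᴿ character i z (k i ∸ toℕ y))))

    α β : Fin (cost P) → Fin d → R
    α y = uncurry αᵢ (locate k y)
    β y = uncurry βᵢ (locate k y)

    γ : Fin d → Fin (cost P) → R
    γ x y = uncurry (λ i z → γᵢ i z x) (locate k y)

    tensor : Fin d → Fin d → Fin d → ℤ
    tensor x u w = ℤ.+ K *ᶻ indicator (from x ≟ᴰ f (from u) (from w))

    ▷-∑ᴿ : ∀ {n} (r : Fin n → R) φ b → (∑ᴿ r ▷ φ) b ≡ sum (λ i → (r i ▷ φ) b)
    ▷-∑ᴿ {zero}  r φ b = ▷-0 φ b
    ▷-∑ᴿ {suc n} r φ b = trans (▷-+ (r zero) (∑ᴿ (λ i → r (suc i))) φ b)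
      (cong ((r zero ▷ φ) b +ᶻ_) (▷-∑ᴿ (λ i → r (suc i)) φ b))

    private
      module Block (i : Fin m) (x u w : Fin d) (p : from u ∈ A i) (q : from w ∈ B i) where

        kᵢ τ a b : ℕ
        kᵢ = k i
        τ = scale kᵢ
        a = toℕ (Cyclic.σA i (from u , p))
        b = toℕ (Cyclic.σB i (from w , q))

        ι : Fin kᵢ → ℤ
        ι y = indicator (from x ≟ᴰ Cyclic.σC i y)

        term : Fin kᵢ → R
        term z = γᵢ i z x *ᴿ (character i z a *ᴿ character i z b)

        -- The geometric sum over z of the powers of x^(τ(a + b - y)), acting on v.
        orbit : ℕ → Fin kᵢ → ℤ
        orbit b′ y = sum {kᵢ} (λ z → v (b′ + toℕ z * (τ * (a + b + (kᵢ ∸ toℕ y)))))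

        term-▷ : ∀ z b′ → (term z ▷ v) b′ ≡
          sum {kᵢ} (λ y → ℤ.+ τ *ᶻ (ι y *ᶻ v (b′ + toℕ z * (τ * (a + b + (kᵢ ∸ toℕ y))))))
        term-▷ z b′ = begin
          (term z ▷ v) b′
            ≡⟨ ▷-* (γᵢ i z x) _ (periodic K) b′ ⟩
          (γᵢ i z x ▷ ((character i z a *ᴿ character i z b) ▷ v)) b′
            ≡⟨ ▷-cong (γᵢ i z x) (λ e → trans (▷-* (character i z a) (character i z b) (periodic K) e)
                 (trans (▷-monomial (toℕ z * (τ * a)) (▷-periodic (character i z b) (periodic K)) e)
                        (▷-monomial (toℕ z * (τ * b)) (periodic K) _))) b′ ⟩
          (γᵢ i z x ▷ ψ) b′
            ≡⟨ trans (▷-· (ℤ.+ τ) _ ψ b′) (cong (ℤ.+ τ *ᶻ_) (▷-∑ᴿ {kᵢ} _ ψ b′)) ⟩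
          ℤ.+ τ *ᶻ sum {kᵢ} (λ y → ((ι y ·ᴿ character i z (kᵢ ∸ toℕ y)) ▷ ψ) b′)
            ≡⟨ *-distribˡ-sum {kᵢ} (ℤ.+ τ) _ ⟩
          sum {kᵢ} (λ y → ℤ.+ τ *ᶻ ((ι y ·ᴿ character i z (kᵢ ∸ toℕ y)) ▷ ψ) b′)
            ≡⟨ ∑-cong {kᵢ} (λ y → cong (ℤ.+ τ *ᶻ_) (trans (▷-· (ι y) _ ψ b′) (cong (ι y *ᶻ_)
                 (trans (▷-monomial (toℕ z * (τ * (kᵢ ∸ toℕ y))) ψ-periodic b′)
                        (cong v (exponent (toℕ z) τ a b (kᵢ ∸ toℕ y) b′)))))) ⟩
          sum {kᵢ} (λ y → ℤ.+ τ *ᶻ (ι y *ᶻ v (b′ + toℕ z * (τ * (a + b + (kᵢ ∸ toℕ y)))))) ∎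
          where
          open ≡-Reasoning
          ψ : ℕ → ℤ
          ψ e = v (toℕ z * (τ * b) + (toℕ z * (τ * a) + e))
          ψ-periodic : Periodic ψ
          ψ-periodic e = trans (cong v (lemma (toℕ z * (τ * b)) (toℕ z * (τ * a)) e K)) (periodic K _)
            where
            lemma : ∀ s t e K → s + (t + (e + K)) ≡ s + (t + e) + K
            lemma = solve-∀
          exponent : ∀ z τ a b c e → z * (τ * b) + (z * (τ * a) + (z * (τ * c) + e)) ≡ e + z * (τ * (a + b + c))
          exponent = solve-∀

        ∑-term : ∀ b′ → (∑ᴿ {kᵢ} term ▷ v) b′ ≡ sum {kᵢ} (λ y → ℤ.+ τ *ᶻ (ι y *ᶻ orbit b′ y))
        ∑-term b′ = begin
          (∑ᴿ {kᵢ} term ▷ v) b′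
            ≡⟨ trans (▷-∑ᴿ {kᵢ} term v b′) (∑-cong {kᵢ} (λ z → term-▷ z b′)) ⟩
          sum {kᵢ} (λ z → sum {kᵢ} (λ y → ℤ.+ τ *ᶻ (ι y *ᶻ v (b′ + toℕ z * (τ * (a + b + (kᵢ ∸ toℕ y)))))))
            ≡⟨ ∑-comm {kᵢ} {kᵢ} _ ⟩
          sum {kᵢ} (λ y → sum {kᵢ} (λ z → ℤ.+ τ *ᶻ (ι y *ᶻ v (b′ + toℕ z * (τ * (a + b + (kᵢ ∸ toℕ y)))))))
            ≡⟨ ∑-cong {kᵢ} (λ y → trans (sym (*-distribˡ-sum {kᵢ} (ℤ.+ τ) _))
                 (cong (ℤ.+ τ *ᶻ_) (sym (*-distribˡ-sum {kᵢ} (ι y) _)))) ⟩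
          sum {kᵢ} (λ y → ℤ.+ τ *ᶻ (ι y *ᶻ orbit b′ y)) ∎
          where open ≡-Reasoning

        instance
          kᵢ≢0 : NonZero kᵢ
          kᵢ≢0 with kᵢ | Cyclic.σA i (from u , p)
          ... | suc _ | _ = _

        τ*kᵢ≡K : τ * kᵢ ≡ K
        τ*kᵢ≡K = scale-*-k i (Cyclic.σA i (from u , p))

        y₀ : Fin kᵢ
        y₀ = Cyclic.σA i (from u , p) ⊞ Cyclic.σB i (from w , q)

        toℕ-⊞ : ∀ {k} {{_ : NonZero k}} (s t : Fin k) → toℕ (s ⊞ t) ≡ (toℕ s + toℕ t) % k
        toℕ-⊞ {suc k} s t = toℕ-fromℕ< (m%n<n (toℕ s + toℕ t) (suc k))

        -- Orthogonality of characters: K divides kᵢ * s, and it divides s only if y is a + b modulo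
        -- kᵢ. For every other y the sum is one of those that `primitive-weight-kill` makes vanish.
        orbit-off : ∀ b′ y → y ≢ y₀ → orbit b′ y ≡ 0ℤ
        orbit-off b′ y y≢y₀ = primitive-weight-kill K kᵢ s K∣kᵢs K∤s b′
          where
          s = τ * (a + b + (kᵢ ∸ toℕ y))
          K∣kᵢs : K ∣ kᵢ * s
          K∣kᵢs = subst₂ _∣_ τ*kᵢ≡K (lemma τ kᵢ _) (m∣m*n (a + b + (kᵢ ∸ toℕ y)))
            where
            lemma : ∀ t k e → t * k * e ≡ k * (t * e)
            lemma = solve-∀
          τ≢0 : NonZero τ
          τ≢0 = m*n≢0⇒m≢0 τ {{subst NonZero (sym τ*kᵢ≡K) K≢0}}
          K∤s : K ∤ s
          K∤s K∣s = y≢y₀ (toℕ-injective (trans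
            (k∣residue⇒≡ kᵢ (a + b) (toℕ y) (toℕ<n y) (*-cancelˡ-∣ τ {{τ≢0}} (subst (_∣ s) (sym τ*kᵢ≡K) K∣s)))
            (sym (toℕ-⊞ (Cyclic.σA i (from u , p)) (Cyclic.σB i (from w , q))))))

        orbit-on : ∀ b′ → orbit b′ y₀ ≡ ℤ.+ kᵢ *ᶻ v b′
        orbit-on b′ = trans (∑-cong {kᵢ} constant) (∑-const kᵢ (v b′))
          where
          k∣ : kᵢ ∣ a + b + (kᵢ ∸ toℕ y₀)
          k∣ = subst (λ t → kᵢ ∣ a + b + (kᵢ ∸ t)) (sym (toℕ-⊞ (Cyclic.σA i (from u , p)) (Cyclic.σB i (from w , q))))
            (k∣e+[k∸e%k] kᵢ (a + b))
          constant : ∀ z → v (b′ + toℕ z * (τ * (a + b + (kᵢ ∸ toℕ y₀)))) ≡ v b′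
          constant z = trans (cong (λ t → v (b′ + t)) (begin
              toℕ z * (τ * (a + b + (kᵢ ∸ toℕ y₀)))  ≡⟨ cong (λ t → toℕ z * (τ * t)) (m∣n⇒n≡quotient*m k∣) ⟩
              toℕ z * (τ * (quotient k∣ * kᵢ))  ≡⟨ lemma (toℕ z) τ (quotient k∣) kᵢ ⟩
              (toℕ z * quotient k∣) * (τ * kᵢ)  ≡⟨ cong ((toℕ z * quotient k∣) *_) τ*kᵢ≡K ⟩
              (toℕ z * quotient k∣) * K  ∎))
            (periodic* K (toℕ z * quotient k∣) b′)
            where
            open ≡-Reasoning
            lemma : ∀ z t x k → z * (t * (x * k)) ≡ (z * x) * (t * k)
            lemma = solve-∀

        -- Fourier inversion on one minor. Only `y₀`, the sum of the two residues, survives the sum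
        -- over y; the factors τ and kᵢ multiply to K; and `factorises` identifies the image of `y₀`
        -- under σC with the value of f.
        block : ∑ᴿ {kᵢ} term ≈ᴿ tensor x u w ·ᴿ monomial 0
        block = pointwise λ b′ → begin
          (∑ᴿ {kᵢ} term ▷ v) b′
            ≡⟨ ∑-term b′ ⟩
          sum {kᵢ} (λ y → ℤ.+ τ *ᶻ (ι y *ᶻ orbit b′ y))
            ≡⟨ sum-single ℤₚ.+-0-commutativeMonoid y₀ _ (λ y y≢y₀ → trans
                 (cong (λ t → ℤ.+ τ *ᶻ (ι y *ᶻ t)) (orbit-off b′ y y≢y₀))
                 (trans (cong (ℤ.+ τ *ᶻ_) (ℤₚ.*-zeroʳ (ι y))) (ℤₚ.*-zeroʳ (ℤ.+ τ)))) ⟩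
          ℤ.+ τ *ᶻ (ι y₀ *ᶻ orbit b′ y₀)
            ≡⟨ cong (λ t → ℤ.+ τ *ᶻ (ι y₀ *ᶻ t)) (orbit-on b′) ⟩
          ℤ.+ τ *ᶻ (ι y₀ *ᶻ (ℤ.+ kᵢ *ᶻ v b′))
            ≡⟨ lemma (ℤ.+ τ) (ι y₀) (ℤ.+ kᵢ) (v b′) ⟩
          ((ℤ.+ τ *ᶻ ℤ.+ kᵢ) *ᶻ ι y₀) *ᶻ v b′
            ≡⟨ cong (_*ᶻ v b′) (cong₂ _*ᶻ_ (trans (sym (ℤₚ.pos-* τ kᵢ)) (cong ℤ.+_ τ*kᵢ≡K))
                 (indicator-cong _ _ (λ e → trans e (sym factor)) (λ e → trans e factor))) ⟩
          tensor x u w *ᶻ v b′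
            ≡⟨ cong (tensor x u w *ᶻ_) (▷-monomial 0 (periodic K) b′) ⟨
          tensor x u w *ᶻ (monomial 0 ▷ v) b′
            ≡⟨ ▷-· (tensor x u w) (monomial 0) v b′ ⟨
          ((tensor x u w ·ᴿ monomial 0) ▷ v) b′ ∎
          where
          open ≡-Reasoning
          factor : f (from u) (from w) ≡ Cyclic.σC i y₀
          factor = Cyclic.factorises i (from u , p) (from w , q)
          lemma : ∀ t i k x → t *ᶻ (i *ᶻ (k *ᶻ x)) ≡ ((t *ᶻ k) *ᶻ i) *ᶻ x
          lemma = ℤ-Solver.solve-∀

    absorb : ∀ r s → s ≈ᴿ 0ᴿ → (r *ᴿ s) ≈ᴿ 0ᴿ
    absorb r s s≈0 = ≈-trans (*-≈-cong {r} {r} {s} {0ᴿ} ≈-refl s≈0) (≈-zeroʳ r)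

    -- Exactly one minor contains the pair given by u and w. In the blocks of all others α or β is
    -- 0, since u lies outside A or w outside B.
    decomposition : ∀ x u w →
      ∑ᴿ {cost P} (λ y → (γ x y *ᴿ (α y u *ᴿ β y w))) ≈ᴿ tensor x u w ·ᴿ monomial 0
    decomposition x u w = ≈-trans (sum-locate +-commutativeMonoid k summand)
      (≈-trans (sum-single +-commutativeMonoid i₀ _ off) on)
      where
      summand : ∀ i → Fin (k i) → R
      summand i z = γᵢ i z x *ᴿ (αᵢ i z u *ᴿ βᵢ i z w)
      i₀ = proj₁ (partition (from u) (from w))
      member = proj₁ (proj₂ (partition (from u) (from w)))
      unique = proj₂ (proj₂ (partition (from u) (from w)))
      off : ∀ i → i ≢ i₀ → ∑ᴿ {k i} (summand i) ≈ᴿ 0ᴿ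
      off i i≢i₀ = sum-zero +-commutativeMonoid {k i} vanish
        where
        vanish : ∀ z → summand i z ≈ᴿ 0ᴿ
        vanish z = go (T? (A i (from u))) (T? (B i (from w))) _ _
          where
          go : (p : Dec (from u ∈ A i)) (q : Dec (from w ∈ B i)) (r : from u ∈ A i → R) (s : from w ∈ B i → R) →
            (γᵢ i z x *ᴿ (restricted p r *ᴿ restricted q s)) ≈ᴿ 0ᴿ
          go (yes p) (yes q) r s = contradiction (sym (unique (p , q))) i≢i₀
          go (yes p) (no _)  r s = absorb (γᵢ i z x) _ (≈-zeroʳ (r p))
          go (no _)  q       r s = absorb (γᵢ i z x) _ (≈-zeroˡ (restricted q s))
      on : ∑ᴿ {k i₀} (summand i₀) ≈ᴿ tensor x u w ·ᴿ monomial 0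
      on with T? (A i₀ (from u)) | T? (B i₀ (from w))
      ... | yes p | yes q = Block.block i₀ x u w p q
      ... | no ¬p | _     = contradiction (proj₁ member) ¬p
      ... | yes _ | no ¬q = contradiction (proj₂ member) ¬q

  ≤-cost : ∀ {m} (k : Fin m → ℕ) i → k i ≤ ℕ-List.sum (tabulate k)
  ≤-cost k zero    = m≤m+n (k zero) _
  ≤-cost k (suc i) = ≤-trans (≤-cost (λ j → k (suc j)) i) (m≤n+m _ (k zero))

  -- A nonzero k is at most the cost and so divides its factorial. This yields one K for all minors,
  -- depending on P alone.
  k∣cost! : ∀ {D : Set} {f : D → D → D} (P : CyclicPartition f) i → NonZero (CyclicPartition.k P i) → CyclicPartition.k P i ∣ cost P !
  k∣cost! P i k≢0 = ∣-trans (k∣k! (CyclicPartition.k P i) {{k≢0}}) (m≤n⇒m!∣n! (≤-cost (CyclicPartition.k P) i))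
    where
    k∣k! : ∀ k {{_ : NonZero k}} → k ∣ k !
    k∣k! (suc k) = m∣m*n (k !)

-- Value lists over Dⁿ as arrays, and the convolution as a sum over index vectors

module TupleLists where

  open IntegerSums
  open YatesTransform
  open import Data.Fin using (Fin; zero; suc; toℕ)
  open import Data.Fin.Properties using (toℕ<n)
  open import Data.Integer as ℤ using (ℤ; ∣_∣) renaming (_+_ to _+ᶻ_; _*_ to _*ᶻ_)
  import Data.Integer.Properties as ℤₚ
  open import Data.List using (List; []; _∷_; _++_; map; filter; applyUpTo; length; tabulate; cartesianProductWith)
  open import Data.List.Properties using (map-++; map-∘; length-++; length-map; length-tabulate)
  open import Data.Nat using (ℕ; zero; suc; _+_; _*_; _^_; _≤_; _<_; z≤n; s≤s)
  open import Data.Nat.Properties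
  open import Data.Product using (_×_; _,_)
  open import Data.Vec as Vec using (Vec; []; _∷_)
  open import Data.Vec.Properties using (≡-dec)
  open import Function.Bundles using (_↔_; Inverse)
  open import Relation.Binary.PropositionalEquality
  open import Relation.Nullary using (yes; no)
  open import Relation.Unary using (Pred; Decidable)
  open import Level using (0ℓ)

  index-bound : ∀ {s j} (us : Vec (Fin s) j) → index us < s ^ j
  index-bound             []       = s≤s z≤n
  index-bound {s} {suc j} (u ∷ us) = begin-strict
    toℕ u * s ^ j + index us  <⟨ +-monoʳ-< (toℕ u * s ^ j) (index-bound us) ⟩
    toℕ u * s ^ j + s ^ j  ≡⟨ +-comm (toℕ u * s ^ j) (s ^ j) ⟩
    suc (toℕ u) * s ^ j  ≤⟨ *-monoˡ-≤ (s ^ j) (toℕ<n u) ⟩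
    s ^ suc j  ∎
    where open ≤-Reasoning

  load-++ˡ : ∀ xs ys i → i < length xs → load (xs ++ ys) i ≡ load xs i
  load-++ˡ (x ∷ xs) ys zero    _         = refl
  load-++ˡ (x ∷ xs) ys (suc i) (s≤s i<n) = load-++ˡ xs ys i i<n

  load-++ʳ : ∀ xs ys i → load (xs ++ ys) (length xs + i) ≡ load ys i
  load-++ʳ []       ys i = refl
  load-++ʳ (x ∷ xs) ys i = load-++ʳ xs ys i

  applyUpTo-+ : ∀ {A : Set} (a : ℕ → A) m n →
    applyUpTo a (m + n) ≡ applyUpTo a m ++ applyUpTo (λ i → a (m + i)) n
  applyUpTo-+ a zero    n = refl
  applyUpTo-+ a (suc m) n = cong (a 0 ∷_) (applyUpTo-+ (λ i → a (suc i)) m n)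

  applyUpTo-cong : ∀ {A : Set} {a b : ℕ → A} n → (∀ i → i < n → a i ≡ b i) → applyUpTo a n ≡ applyUpTo b n
  applyUpTo-cong zero    h = refl
  applyUpTo-cong (suc n) h = cong₂ _∷_ (h 0 (s≤s z≤n)) (applyUpTo-cong n (λ i i<n → h (suc i) (s≤s i<n)))

  module _ {A B C : Set} (_∙_ : A → B → C) (ys : List B) where

    length-product : ∀ xs → length (cartesianProductWith _∙_ xs ys) ≡ length xs * length ys
    length-product []       = refl
    length-product (x ∷ xs) = trans (length-++ (map (x ∙_) ys)) (cong₂ _+_ (length-map (x ∙_) ys) (length-product xs))

    load-product : (g : C → ℤ) → ∀ {m} (φ : Fin m → A) x i → i < length ys →
      load (map g (cartesianProductWith _∙_ (tabulate φ) ys)) (toℕ x * length ys + i) ≡ load (map (λ y → g (φ x ∙ y)) ys) i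
    load-product g φ zero i i<l = begin
      load (map g (map (φ zero ∙_) ys ++ rest)) i  ≡⟨ cong (λ zs → load zs i) (map-++ g (map (φ zero ∙_) ys) rest) ⟩
      load (map g (map (φ zero ∙_) ys) ++ map g rest) i  ≡⟨ cong (λ zs → load (zs ++ map g rest) i) (map-∘ ys) ⟨
      load (map (λ y → g (φ zero ∙ y)) ys ++ map g rest) i
        ≡⟨ load-++ˡ (map (λ y → g (φ zero ∙ y)) ys) (map g rest) i
               (subst (i <_) (sym (length-map (λ y → g (φ zero ∙ y)) ys)) i<l) ⟩
      load (map (λ y → g (φ zero ∙ y)) ys) i  ∎
      where
      open ≡-Reasoning
      rest = cartesianProductWith _∙_ (tabulate (λ i → φ (suc i))) ys
    load-product g φ (suc x) i i<l = begin
      load (map g (map (φ zero ∙_) ys ++ rest)) (length ys + toℕ x * length ys + i)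
        ≡⟨ cong₂ load (map-++ g (map (φ zero ∙_) ys) rest) (+-assoc (length ys) _ i) ⟩
      load (map g (map (φ zero ∙_) ys) ++ map g rest) (length ys + (toℕ x * length ys + i))
        ≡⟨ cong (λ l → load (map g (map (φ zero ∙_) ys) ++ map g rest) (l + (toℕ x * length ys + i)))
             (trans (length-map g (map (φ zero ∙_) ys)) (length-map _ ys)) ⟨
      load (map g (map (φ zero ∙_) ys) ++ map g rest) (length (map g (map (φ zero ∙_) ys)) + (toℕ x * length ys + i))
        ≡⟨ load-++ʳ (map g (map (φ zero ∙_) ys)) (map g rest) _ ⟩
      load (map g rest) (toℕ x * length ys + i)
        ≡⟨ load-product g (λ i → φ (suc i)) x i i<l ⟩
      load (map (λ y → g (φ (suc x) ∙ y)) ys) i ∎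
      where
      open ≡-Reasoning
      rest = cartesianProductWith _∙_ (tabulate (λ i → φ (suc i))) ys

    applyUpTo-product : (g : C → ℤ) → ∀ {m} (φ : Fin m → A) (a : ℕ → ℤ) →
      (∀ x → applyUpTo (λ i → a (toℕ x * length ys + i)) (length ys) ≡ map (λ y → g (φ x ∙ y)) ys) →
      applyUpTo a (m * length ys) ≡ map g (cartesianProductWith _∙_ (tabulate φ) ys)
    applyUpTo-product g {zero}  φ a h = refl
    applyUpTo-product g {suc m} φ a h = begin
      applyUpTo a (length ys + m * length ys)
        ≡⟨ applyUpTo-+ a (length ys) (m * length ys) ⟩
      applyUpTo a (length ys) ++ applyUpTo (λ i → a (length ys + i)) (m * length ys)
        ≡⟨ cong₂ _++_ (trans (h zero) (map-∘ ys))
             (applyUpTo-product g (λ i → φ (suc i)) (λ i → a (length ys + i)) (λ x → trans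
               (applyUpTo-cong (length ys) (λ i _ → cong a (sym (+-assoc (length ys) _ i)))) (h (suc x)))) ⟩
      map g (map (φ zero ∙_) ys) ++ map g rest
        ≡⟨ map-++ g (map (φ zero ∙_) ys) rest ⟨
      map g (map (φ zero ∙_) ys ++ rest) ∎
      where
      open ≡-Reasoning
      rest = cartesianProductWith _∙_ (tabulate (λ i → φ (suc i))) ys

  ∑ⱽᶻ : ∀ {s} j → (Vec (Fin s) j → ℤ) → ℤ
  ∑ⱽᶻ = ∑ⱽ ℤₚ.+-*-commutativeSemiring

  module _ {D : Set} {d : ℕ} (enum : D ↔ Fin d) where

    open Convolution enum

    decode : ∀ {n} → Vec (Fin d) n → Vec D n
    decode = Vec.map (Inverse.from enum)

    length-tuples : ∀ n → length (tuples n) ≡ d ^ n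
    length-tuples zero    = refl
    length-tuples (suc n) = trans (length-product _∷_ (tuples n) elements)
      (cong₂ _*_ (length-tabulate (Inverse.from enum)) (length-tuples n))

    load-values : ∀ n (g : Vec D n → ℤ) us → load (values g) (index us) ≡ g (decode us)
    load-values zero    g []       = refl
    load-values (suc n) g (u ∷ us) = begin
      load (values g) (toℕ u * d ^ n + index us)
        ≡⟨ cong (λ l → load (values g) (toℕ u * l + index us)) (length-tuples n) ⟨
      load (values g) (toℕ u * length (tuples n) + index us)
        ≡⟨ load-product _∷_ (tuples n) g (Inverse.from enum) u (index us)
             (subst (index us <_) (sym (length-tuples n)) (index-bound us)) ⟩
      load (values (λ vs → g (Inverse.from enum u ∷ vs))) (index us)
        ≡⟨ load-values n _ us ⟩
      g (decode (u ∷ us)) ∎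
      where open ≡-Reasoning

    applyUpTo-values : ∀ n (g : Vec D n → ℤ) (a : ℕ → ℤ) → (∀ us → a (index us) ≡ g (decode us)) →
      applyUpTo a (length (tuples n)) ≡ values g
    applyUpTo-values zero    g a h = cong (_∷ []) (h [])
    applyUpTo-values (suc n) g a h = trans
      (cong (applyUpTo a) (trans (length-product _∷_ (tuples n) elements)
        (cong (_* length (tuples n)) (length-tabulate (Inverse.from enum)))))
      (applyUpTo-product _∷_ (tuples n) g (Inverse.from enum) a (λ u →
        applyUpTo-values n (λ vs → g (Inverse.from enum u ∷ vs)) _ (λ us →
          trans (cong (λ l → a (toℕ u * l + index us)) (length-tuples n)) (h (u ∷ us)))))

    sumᶻ-++ : ∀ xs ys → sumᶻ (xs ++ ys) ≡ sumᶻ xs +ᶻ sumᶻ ys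
    sumᶻ-++ []       ys = sym (ℤₚ.+-identityˡ _)
    sumᶻ-++ (x ∷ xs) ys = trans (cong (x +ᶻ_) (sumᶻ-++ xs ys)) (sym (ℤₚ.+-assoc x _ _))

    sumᶻ-product : ∀ {A B C : Set} (_∙_ : A → B → C) (ψ : C → ℤ) xs ys →
      sumᶻ (map ψ (cartesianProductWith _∙_ xs ys)) ≡ sumᶻ (map (λ x → sumᶻ (map (λ y → ψ (x ∙ y)) ys)) xs)
    sumᶻ-product _∙_ ψ []       ys = refl
    sumᶻ-product _∙_ ψ (x ∷ xs) ys = trans
      (cong sumᶻ (map-++ ψ (map (x ∙_) ys) (cartesianProductWith _∙_ xs ys)))
      (trans (sumᶻ-++ (map ψ (map (x ∙_) ys)) _)
             (cong₂ _+ᶻ_ (cong sumᶻ (sym (map-∘ ys))) (sumᶻ-product _∙_ ψ xs ys)))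

    sumᶻ-filter : ∀ {A : Set} {P : Pred A 0ℓ} (P? : Decidable P) (ψ : A → ℤ) xs →
      sumᶻ (map ψ (filter P? xs)) ≡ sumᶻ (map (λ x → indicator (P? x) *ᶻ ψ x) xs)
    sumᶻ-filter P? ψ []       = refl
    sumᶻ-filter P? ψ (x ∷ xs) with P? x
    ... | yes _ = cong₂ _+ᶻ_ (sym (ℤₚ.*-identityˡ (ψ x))) (sumᶻ-filter P? ψ xs)
    ... | no _  = trans (sumᶻ-filter P? ψ xs) (trans (sym (ℤₚ.+-identityˡ _)) (cong (_+ᶻ sumᶻ (map (λ y → indicator (P? y) *ᶻ ψ y) xs)) (sym (ℤₚ.*-zeroˡ (ψ x)))))

    sumᶻ-tabulate : ∀ {m} (φ : Fin m → D) (ψ : D → ℤ) → sumᶻ (map ψ (tabulate φ)) ≡ sum (λ i → ψ (φ i))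
    sumᶻ-tabulate {zero}  φ ψ = refl
    sumᶻ-tabulate {suc m} φ ψ = cong (ψ (φ zero) +ᶻ_) (sumᶻ-tabulate (λ i → φ (suc i)) ψ)

    sumᶻ-tuples : ∀ n (ψ : Vec D n → ℤ) → sumᶻ (values ψ) ≡ ∑ⱽᶻ n (λ us → ψ (decode us))
    sumᶻ-tuples zero    ψ = ℤₚ.+-identityʳ (ψ [])
    sumᶻ-tuples (suc n) ψ = trans (sumᶻ-product _∷_ ψ elements (tuples n))
      (trans (sumᶻ-tabulate (Inverse.from enum) _)
             (∑-cong {d} (λ u → sumᶻ-tuples n (λ vs → ψ (Inverse.from enum u ∷ vs)))))

    -- Replacing the filter by an indicator makes the coefficient of each product an entry of a
    -- tensor, which is the form that `bilinear` delivers.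
    convolution-sum : ∀ f n (g h : Vec D n → ℤ) v → convolution f g h v ≡
      ∑ⱽᶻ n (λ us → ∑ⱽᶻ n (λ ws →
        indicator (≡-dec _≟ᴰ_ v (Vec.zipWith f (decode us) (decode ws))) *ᶻ (g (decode us) *ᶻ h (decode ws))))
    convolution-sum f n g h v = trans (sumᶻ-filter matches? (λ (u , w) → g u *ᶻ h w) (cartesianProductWith _,_ (tuples n) (tuples n)))
      (trans (sumᶻ-product _,_ summand (tuples n) (tuples n))
        (trans (sumᶻ-tuples n _) (∑ⱽ-cong ℤₚ.+-*-commutativeSemiring n (λ us → sumᶻ-tuples n (λ w → summand (decode us , w))))))
      where
      matches? : Decidable {A = Vec D n × Vec D n} (λ (u , w) → v ≡ Vec.zipWith f u w)
      matches? (u , w) = ≡-dec _≟ᴰ_ v (Vec.zipWith f u w)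
      summand : Vec D n × Vec D n → ℤ
      summand (u , w) = indicator (matches? (u , w)) *ᶻ (g u *ᶻ h w)

    ∣load∣≤maxAbs : ∀ zs i → ∣ load zs i ∣ ≤ maxAbs zs
    ∣load∣≤maxAbs []       i       = z≤n
    ∣load∣≤maxAbs (z ∷ zs) zero    = m≤m⊔n ∣ z ∣ _
    ∣load∣≤maxAbs (z ∷ zs) (suc i) = ≤-trans (∣load∣≤maxAbs zs i) (m≤n⊔m ∣ z ∣ _)

    maxAbs-++ˡ : ∀ xs ys → maxAbs xs ≤ maxAbs (xs ++ ys)
    maxAbs-++ˡ []       ys = z≤n
    maxAbs-++ˡ (x ∷ xs) ys = ⊔-monoʳ-≤ ∣ x ∣ (maxAbs-++ˡ xs ys)

    maxAbs-++ʳ : ∀ xs ys → maxAbs ys ≤ maxAbs (xs ++ ys)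
    maxAbs-++ʳ []       ys = ≤-refl
    maxAbs-++ʳ (x ∷ xs) ys = ≤-trans (maxAbs-++ʳ xs ys) (m≤n⊔m ∣ x ∣ _)

-- The f-convolution on Dⁿ as a tensor power

module TensorPowers where

  open IntegerSums
  open PrimitiveWeight
  open GroupRing
  open YatesTransform
  open RankDecomposition
  open TupleLists
  open import Algebra.Bundles using (CommutativeSemiring)
  open import Data.Fin using (Fin; zero; suc)
  open import Data.Integer as ℤ using (ℤ; 0ℤ; 1ℤ) renaming (_+_ to _+ᶻ_; _*_ to _*ᶻ_)
  import Data.Integer.Properties as ℤₚ
  import Data.Integer.Tactic.RingSolver as ℤ-Solver
  open import Data.Nat as ℕ using (ℕ; zero; suc; _^_; NonZero)
  import Data.Nat.Properties as ℕₚ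
  open import Data.Vec as Vec using (Vec; []; _∷_)
  open import Data.Vec.Properties using (≡-dec)
  open import Function.Bundles using (_↔_; Inverse)
  open import Level using (0ℓ)
  open import Relation.Binary.PropositionalEquality as ≡ using (_≡_; cong; cong₂)
  open import Relation.Nullary using (yes; no)

  -- A semiring homomorphism from ℤ. It links the inputs and the convolution, which are integers, to
  -- the decomposition, which holds only in 𝓢.
  record Embedding (𝓢 : CommutativeSemiring 0ℓ 0ℓ) : Set where
    open CommutativeSemiring 𝓢
    field
      embed   : ℤ → Carrier
      embed-0 : embed 0ℤ ≈ 0#
      embed-1 : embed 1ℤ ≈ 1#
      embed-+ : ∀ x y → embed (x +ᶻ y) ≈ embed x + embed y
      embed-* : ∀ x y → embed (x *ᶻ y) ≈ embed x * embed y

  module TensorPower {D : Set} {d : ℕ} (enum : D ↔ Fin d) (f : D → D → D)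
    (𝓢 : CommutativeSemiring 0ℓ 0ℓ) (embedding : Embedding 𝓢) where

    open CommutativeSemiring 𝓢 hiding (zero)
    open Embedding embedding
    open Convolution enum
    open import Algebra.Properties.CommutativeMonoid.Sum +-commutativeMonoid
      using (sum-cong-≋) renaming (sum to ∑)

    private
      from : Fin d → D
      from = Inverse.from enum

    embed-∑ : ∀ {n} (φ : Fin n → ℤ) → embed (sum φ) ≈ ∑ (λ i → embed (φ i))
    embed-∑ {zero}  φ = embed-0
    embed-∑ {suc n} φ = trans (embed-+ (φ zero) (sum (λ i → φ (suc i))))
      (+-congˡ (embed-∑ (λ i → φ (suc i))))

    embed-∑ⱽ : ∀ {s} j (φ : Vec (Fin s) j → ℤ) → embed (∑ⱽᶻ j φ) ≈ ∑ⱽ 𝓢 j (λ us → embed (φ us))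
    embed-∑ⱽ     zero    φ = refl
    embed-∑ⱽ {s} (suc j) φ = trans (embed-∑ {s} _) (sum-cong-≋ {s} (λ u → embed-∑ⱽ j (λ us → φ (u ∷ us))))

    matches : ∀ {n} → Vec (Fin d) n → Vec (Fin d) n → Vec (Fin d) n → ℤ
    matches vs us ws = indicator (≡-dec _≟ᴰ_ (decode enum vs) (Vec.zipWith f (decode enum us) (decode enum ws)))

    match : Fin d → Fin d → Fin d → ℤ
    match x u w = indicator (from x ≟ᴰ f (from u) (from w))

    -- The relation v = u ⊕ w is decided coordinate by coordinate, so its indicator is a product.
    -- This is why the convolution on Dⁿ is a tensor power of the one on D.
    matches-∷ : ∀ {n} x u w (vs us ws : Vec (Fin d) n) →
      matches (x ∷ vs) (u ∷ us) (w ∷ ws) ≡ match x u w *ᶻ matches vs us ws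
    matches-∷ x u w vs us ws with from x ≟ᴰ f (from u) (from w)
                                | ≡-dec _≟ᴰ_ (decode enum vs) (Vec.zipWith f (decode enum us) (decode enum ws))
    ... | yes _ | yes _ = ≡.refl
    ... | yes _ | no _  = ≡.refl
    ... | no _  | yes _ = ≡.refl
    ... | no _  | no _  = ≡.refl

    module _ (K : ℕ) {c : ℕ} (α β : Fin c → Fin d → Carrier) (γ : Fin d → Fin c → Carrier)
      (decomposition : ∀ x u w → ∑ {c} (λ y → γ x y * (α y u * β y w)) ≈ embed (ℤ.+ K *ᶻ match x u w)) where

      private
        tensor : Fin d → Fin d → Fin d → Carrier
        tensor x u w = embed (ℤ.+ K *ᶻ match x u w)
        tensors : ∀ {n} → Vec (Fin d) n → Vec (Fin d) n → Vec (Fin d) n → Carrier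
        tensors = tensorPower 𝓢 α β γ tensor decomposition

      tensorPower-embed : ∀ {n} (vs us ws : Vec (Fin d) n) →
        tensors vs us ws ≈ embed (ℤ.+ (K ^ n) *ᶻ matches vs us ws)
      tensorPower-embed [] [] [] = sym embed-1
      tensorPower-embed {suc n} (x ∷ vs) (u ∷ us) (w ∷ ws) = trans
        (*-congˡ (tensorPower-embed vs us ws))
        (trans (sym (embed-* (ℤ.+ K *ᶻ match x u w) (ℤ.+ (K ^ n) *ᶻ matches vs us ws))) (reflexive (cong embed (begin
          (ℤ.+ K *ᶻ match x u w) *ᶻ (ℤ.+ (K ^ n) *ᶻ matches vs us ws)
            ≡⟨ lemma (ℤ.+ K) (match x u w) (ℤ.+ (K ^ n)) (matches vs us ws) ⟩
          (ℤ.+ K *ᶻ ℤ.+ (K ^ n)) *ᶻ (match x u w *ᶻ matches vs us ws)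
            ≡⟨ cong₂ _*ᶻ_ (ℤₚ.pos-* K (K ^ n)) (matches-∷ x u w vs us ws) ⟨
          ℤ.+ (K ^ suc n) *ᶻ matches (x ∷ vs) (u ∷ us) (w ∷ ws) ∎))))
        where
        open ≡.≡-Reasoning
        lemma : ∀ a b c e → (a *ᶻ b) *ᶻ (c *ᶻ e) ≡ (a *ᶻ c) *ᶻ (b *ᶻ e)
        lemma = ℤ-Solver.solve-∀

      module _ {{_ : NonZero c}} {{_ : NonZero d}} where

        yates-sum : ∀ {t s} (M : Fin t → Fin s → Carrier) {{_ : NonZero t}} n F (φ : Vec (Fin s) n → Carrier) →
          (∀ us → F (index us) ≈ φ us) → ∀ ys → yates 𝓢 M n 1 F (index ys) ≈ ∑ⱽ 𝓢 n (λ us → power 𝓢 M ys us * φ us)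
        yates-sum M n F φ h ys = trans (yates-correct 𝓢 M n 1 F ys 0)
          (∑ⱽ-cong 𝓢 n (λ us → *-congˡ
            (trans (reflexive (cong F (≡.trans (ℕₚ.+-identityʳ _) (ℕₚ.*-identityʳ (index us))))) (h us))))

        product : ℕ → (ℕ → Carrier) → (ℕ → Carrier) → ℕ → Carrier
        product n G H p = yates 𝓢 α n 1 G p * yates 𝓢 β n 1 H p

        result : ℕ → (ℕ → Carrier) → (ℕ → Carrier) → ℕ → Carrier
        result n G H = yates 𝓢 γ n 1 (product n G H)

        -- The three transforms become sums against `power`, which `bilinear` contracts to the
        -- tensor power. Every coordinate contributes one factor K, and the resulting K ^ n leaves
        -- both sums.
        result-correct : ∀ n (g h : Vec D n → ℤ) (G H : ℕ → Carrier) →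
          (∀ us → G (index us) ≈ embed (g (decode enum us))) → (∀ us → H (index us) ≈ embed (h (decode enum us))) →
          ∀ vs → result n G H (index vs) ≈ embed (ℤ.+ (K ^ n) *ᶻ convolution f g h (decode enum vs))
        result-correct n g h G H G≈ H≈ vs = begin
          result n G H (index vs)
            ≈⟨ yates-sum γ n (product n G H) _ (λ ys → *-cong (yates-sum α n G _ G≈ ys) (yates-sum β n H _ H≈ ys)) vs ⟩
          ∑ⱽ 𝓢 n (λ ys → power 𝓢 γ vs ys *
            (∑ⱽ 𝓢 n (λ us → power 𝓢 α ys us * embed (g′ us)) * ∑ⱽ 𝓢 n (λ ws → power 𝓢 β ys ws * embed (h′ ws))))
            ≈⟨ bilinear 𝓢 α β γ tensor decomposition n (λ us → embed (g′ us)) (λ ws → embed (h′ ws)) vs ⟩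
          ∑ⱽ 𝓢 n (λ us → ∑ⱽ 𝓢 n (λ ws → tensors vs us ws * (embed (g′ us) * embed (h′ ws))))
            ≈⟨ ∑ⱽ-cong 𝓢 n (λ us → ∑ⱽ-cong 𝓢 n (λ ws → trans
                 (*-cong (tensorPower-embed vs us ws) (sym (embed-* (g′ us) (h′ ws))))
                 (trans (sym (embed-* (ℤ.+ (K ^ n) *ᶻ matches vs us ws) (g′ us *ᶻ h′ ws)))
                   (reflexive (cong embed (ℤₚ.*-assoc (ℤ.+ (K ^ n)) (matches vs us ws) (g′ us *ᶻ h′ ws))))))) ⟩
          ∑ⱽ 𝓢 n (λ us → ∑ⱽ 𝓢 n (λ ws → embed (ℤ.+ (K ^ n) *ᶻ (matches vs us ws *ᶻ (g′ us *ᶻ h′ ws)))))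
            ≈⟨ trans (∑ⱽ-cong 𝓢 n (λ us → sym (embed-∑ⱽ n _))) (sym (embed-∑ⱽ n _)) ⟩
          embed (∑ⱽᶻ n (λ us → ∑ⱽᶻ n (λ ws → ℤ.+ (K ^ n) *ᶻ (matches vs us ws *ᶻ (g′ us *ᶻ h′ ws)))))
            ≡⟨ cong embed (≡.trans
                 (∑ⱽ-cong ℤₚ.+-*-commutativeSemiring n (λ us → ≡.sym (∑ⱽ-distribˡ ℤₚ.+-*-commutativeSemiring n (ℤ.+ (K ^ n)) (λ ws → matches vs us ws *ᶻ (g′ us *ᶻ h′ ws)))))
                 (≡.trans (≡.sym (∑ⱽ-distribˡ ℤₚ.+-*-commutativeSemiring n (ℤ.+ (K ^ n)) (λ us → ∑ⱽᶻ n (λ ws → matches vs us ws *ᶻ (g′ us *ᶻ h′ ws)))))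
                        (cong (ℤ.+ (K ^ n) *ᶻ_) (≡.sym (convolution-sum enum f n g h (decode enum vs)))))) ⟩
          embed (ℤ.+ (K ^ n) *ᶻ convolution f g h (decode enum vs)) ∎
          where
          open import Relation.Binary.Reasoning.Setoid setoid
          g′ h′ : Vec (Fin d) n → ℤ
          g′ us = g (decode enum us)
          h′ ws = h (decode enum ws)

-- Reading the integer result off a ring element

module ResultExtraction where

  open IntegerSums
  open PrimitiveWeight
  open GroupRing
  open YatesTransform
  open RankDecomposition
  open TupleLists
  open TensorPowers
  open import Data.Fin using (Fin)
  open import Data.Integer as ℤ using (ℤ; 0ℤ; 1ℤ) renaming (_+_ to _+ᶻ_; _*_ to _*ᶻ_)
  import Data.Integer.Properties as ℤₚ
  open import Data.Nat using (ℕ; _^_; NonZero)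
  open import Data.Nat.Divisibility using (_∣_)
  open import Data.Vec using (Vec)
  open import Function.Bundles using (_↔_)
  open import Relation.Binary.PropositionalEquality

  module Extraction {D : Set} {d : ℕ} (enum : D ↔ Fin d) (f : D → D → D) (P : CyclicPartition f)
    (K : ℕ) {{K≢0 : NonZero K}} (k∣K : ∀ i → NonZero (CyclicPartition.k P i) → CyclicPartition.k P i ∣ K) where

    open CyclicGroupRing K
    open Decomposition enum f P K k∣K
    open Convolution enum using (convolution)

    embed : ℤ → R
    embed z = z ·ᴿ monomial 0

    embed-▷ : ∀ z b → (embed z ▷ v) b ≡ z *ᶻ v b
    embed-▷ z b = trans (▷-· z (monomial 0) v b) (cong (z *ᶻ_) (▷-monomial 0 (periodic K) b))

    embed-+ : ∀ x y → embed (x +ᶻ y) ≈ embed x +ᴿ embed y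
    embed-+ x y .at b = begin
      (embed (x +ᶻ y) ▷ v) b  ≡⟨ embed-▷ (x +ᶻ y) b ⟩
      (x +ᶻ y) *ᶻ v b  ≡⟨ ℤₚ.*-distribʳ-+ (v b) x y ⟩
      x *ᶻ v b +ᶻ y *ᶻ v b  ≡⟨ cong₂ _+ᶻ_ (embed-▷ x b) (embed-▷ y b) ⟨
      (embed x ▷ v) b +ᶻ (embed y ▷ v) b  ≡⟨ ▷-+ (embed x) (embed y) v b ⟨
      ((embed x +ᴿ embed y) ▷ v) b  ∎
      where open ≡-Reasoning

    embed-* : ∀ x y → embed (x *ᶻ y) ≈ embed x *ᴿ embed y
    embed-* x y .at b = begin
      (embed (x *ᶻ y) ▷ v) b  ≡⟨ embed-▷ (x *ᶻ y) b ⟩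
      (x *ᶻ y) *ᶻ v b  ≡⟨ ℤₚ.*-assoc x y (v b) ⟩
      x *ᶻ (y *ᶻ v b)  ≡⟨ cong (x *ᶻ_) (embed-▷ y b) ⟨
      x *ᶻ φ b  ≡⟨ cong (x *ᶻ_) (▷-monomial 0 {φ} (▷-periodic (embed y) (periodic K)) b) ⟨
      x *ᶻ (monomial 0 ▷ φ) b  ≡⟨ ▷-· x (monomial 0) φ b ⟨
      (embed x ▷ φ) b  ≡⟨ ▷-* (embed x) (embed y) (periodic K) b ⟨
      ((embed x *ᴿ embed y) ▷ v) b  ∎
      where
      open ≡-Reasoning
      φ : ℕ → ℤ
      φ = (embed y ▷ v)

    embed-0 : embed 0ℤ ≈ 0ᴿ
    embed-0 .at b = trans (embed-▷ 0ℤ b) (trans (ℤₚ.*-zeroˡ (v b)) (sym (▷-0 v b)))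

    embed-1 : embed 1ℤ ≈ monomial 0
    embed-1 .at b = trans (embed-▷ 1ℤ b) (trans (ℤₚ.*-identityˡ (v b)) (sym (▷-monomial 0 (periodic K) b)))

    embedding : Embedding 𝓡
    embedding = record { embed = embed ; embed-0 = embed-0 ; embed-1 = embed-1 ; embed-+ = embed-+ ; embed-* = embed-* }

    module Power = TensorPower enum f 𝓡 embedding

    module _ {{c≢0 : NonZero (cost P)}} {{d≢0 : NonZero d}} where

      -- Depends only on the class of r under `≈`, so the program can apply it to whatever
      -- representative it has computed.
      extract : R → ℤ
      extract r = (r ▷ v) 0

      product : ℕ → (ℕ → R) → (ℕ → R) → ℕ → R
      product = Power.product K α β γ decomposition

      result : ℕ → (ℕ → R) → (ℕ → R) → ℕ → R
      result = Power.result K α β γ decomposition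

      -- An embedded integer z acts on v as multiplication by z, and v takes the value 1 at 0.
      extract-correct : ∀ n (g h : Vec D n → ℤ) (G H : ℕ → R) →
        (∀ us → G (index us) ≈ embed (g (decode enum us))) → (∀ us → H (index us) ≈ embed (h (decode enum us))) →
        ∀ vs → extract (result n G H (index vs)) ≡ ℤ.+ (K ^ n) *ᶻ convolution f g h (decode enum vs)
      extract-correct n g h G H G≈ H≈ vs = trans
        (at (Power.result-correct K α β γ decomposition n g h G H G≈ H≈ vs) 0)
        (trans (embed-▷ z 0) (trans (cong (z *ᶻ_) (weight≡1 K K)) (ℤₚ.*-identityʳ z)))
        where
        z : ℤ
        z = ℤ.+ (K ^ n) *ᶻ convolution f g h (decode enum vs)

-- Bit lengths of sums, products and powers

module LogarithmBounds where

  open import Defs using (log⁺)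
  open import Data.Nat
  open import Data.Nat.Induction using (<-rec)
  open import Data.Nat.Logarithm
  open import Data.Nat.Properties
  open import Data.Nat.Tactic.RingSolver using (solve-∀)
  open import Relation.Binary.PropositionalEquality

  -- Strong induction by halving: n is at most twice ⌈n/2⌉, whose rounded logarithm is smaller by
  -- one.
  n≤2^⌈log₂n⌉ : ∀ n → n ≤ 2 ^ ⌈log₂ n ⌉
  n≤2^⌈log₂n⌉ = <-rec _ go
    where
    go : ∀ n → (∀ {m} → m < n → m ≤ 2 ^ ⌈log₂ m ⌉) → n ≤ 2 ^ ⌈log₂ n ⌉
    go 0 _ = z≤n
    go 1 _ = s≤s z≤n
    go n@(suc (suc n-2)) rec = begin
      n  ≡⟨ ⌊n/2⌋+⌈n/2⌉≡n n ⟨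
      ⌊ n /2⌋ + ⌈ n /2⌉  ≤⟨ +-monoˡ-≤ ⌈ n /2⌉ (⌊n/2⌋≤⌈n/2⌉ n) ⟩
      ⌈ n /2⌉ + ⌈ n /2⌉  ≤⟨ +-mono-≤ half half ⟩
      2 ^ (L ∸ 1) + 2 ^ (L ∸ 1)  ≡⟨ cong (2 ^ (L ∸ 1) +_) (+-identityʳ (2 ^ (L ∸ 1))) ⟨
      2 ^ suc (L ∸ 1)  ≡⟨ cong (2 ^_) (m+[n∸m]≡n L≥1) ⟩
      2 ^ L  ∎
      where
      open ≤-Reasoning
      L = ⌈log₂ n ⌉
      L≥1 : 1 ≤ L
      L≥1 = ⌈log₂⌉-mono-≤ {2} {n} (s≤s (s≤s z≤n))
      half : ⌈ n /2⌉ ≤ 2 ^ (L ∸ 1)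
      half = subst (λ z → ⌈ n /2⌉ ≤ 2 ^ z) (⌈log₂⌈n/2⌉⌉≡⌈log₂n⌉∸1 n) (rec (⌈n/2⌉<n n-2))

  ⌈log₂⌉-≤ : ∀ {n k} → n ≤ 2 ^ k → ⌈log₂ n ⌉ ≤ k
  ⌈log₂⌉-≤ {n} {k} n≤2^k = subst (⌈log₂ n ⌉ ≤_) (⌈log₂2^n⌉≡n k) (⌈log₂⌉-mono-≤ n≤2^k)

  log⁺-mono : ∀ {m n} → m ≤ n → log⁺ m ≤ log⁺ n
  log⁺-mono m≤n = s≤s (⌈log₂⌉-mono-≤ (s≤s m≤n))

  -- Since `log⁺` measures the successor of its argument, a bound between successors is the right
  -- hypothesis: both m + n and m * n satisfy it, even when a factor is 0.
  log⁺-subadditive : ∀ {x} m n → suc x ≤ suc m * suc n → log⁺ x ≤ log⁺ m + log⁺ n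
  log⁺-subadditive {x} m n x≤ = ≤-trans
    (s≤s (⌈log₂⌉-≤ (begin
      suc x  ≤⟨ x≤ ⟩
      suc m * suc n  ≤⟨ *-mono-≤ (n≤2^⌈log₂n⌉ (suc m)) (n≤2^⌈log₂n⌉ (suc n)) ⟩
      2 ^ ⌈log₂ suc m ⌉ * 2 ^ ⌈log₂ suc n ⌉  ≡⟨ ^-distribˡ-+-* 2 ⌈log₂ suc m ⌉ ⌈log₂ suc n ⌉ ⟨
      2 ^ (⌈log₂ suc m ⌉ + ⌈log₂ suc n ⌉)  ∎)))
    (+-monoʳ-≤ (suc ⌈log₂ suc m ⌉) (n≤1+n ⌈log₂ suc n ⌉))
    where open ≤-Reasoning

  log⁺-+ : ∀ m n → log⁺ (m + n) ≤ log⁺ m + log⁺ n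
  log⁺-+ m n = log⁺-subadditive m n (subst (suc (m + n) ≤_) (lemma m n) (m≤m+n (suc (m + n)) (m * n)))
    where
    lemma : ∀ m n → suc (m + n) + m * n ≡ suc m * suc n
    lemma = solve-∀

  log⁺-* : ∀ m n → log⁺ (m * n) ≤ log⁺ m + log⁺ n
  log⁺-* m n = log⁺-subadditive m n (subst (suc (m * n) ≤_) (lemma m n) (m≤m+n (suc (m * n)) (m + n)))
    where
    lemma : ∀ m n → suc (m * n) + (m + n) ≡ suc m * suc n
    lemma = solve-∀

  log⁺-^ : ∀ m k → log⁺ (m ^ k) ≤ 2 + k * log⁺ m
  log⁺-^ m zero    = ≤-refl
  log⁺-^ m (suc k) = begin
    log⁺ (m * m ^ k)  ≤⟨ log⁺-* m (m ^ k) ⟩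
    log⁺ m + log⁺ (m ^ k)  ≤⟨ +-monoʳ-≤ (log⁺ m) (log⁺-^ m k) ⟩
    log⁺ m + (2 + k * log⁺ m)  ≡⟨ lemma (log⁺ m) (k * log⁺ m) ⟩
    2 + suc k * log⁺ m  ∎
    where
    open ≤-Reasoning
    lemma : ∀ x y → x + (2 + y) ≡ 2 + (x + y)
    lemma = solve-∀

  n<log⁺[2^n] : ∀ n → n < log⁺ (2 ^ n)
  n<log⁺[2^n] n = s≤s (subst (_≤ ⌈log₂ suc (2 ^ n) ⌉) (⌈log₂2^n⌉≡n n) (⌈log₂⌉-mono-≤ (n≤1+n (2 ^ n))))

  1≤log⁺ : ∀ n → 1 ≤ log⁺ n
  1≤log⁺ n = s≤s z≤n

  2≤log⁺ : ∀ {n} → 1 ≤ n → 2 ≤ log⁺ n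
  2≤log⁺ 1≤n = log⁺-mono 1≤n

-- Machine arithmetic and a calculus of timed executions

module Machine where

  open LogarithmBounds
  open import Data.Fin using (zero; suc)
  open import Data.Integer as ℤ using (ℤ; 0ℤ; ∣_∣; +[1+_]; -[1+_]; +<+) renaming (_+_ to _+ᶻ_; _*_ to _*ᶻ_; _-_ to _-ᶻ_)
  import Data.Integer.Properties as ℤₚ
  import Data.Integer.DivMod as ℤ-DivMod
  import Data.Integer.Tactic.RingSolver as ℤ-Solver
  open import Data.Nat
  open import Data.Nat.DivMod using (m/n≤m)
  open import Data.Nat.Properties
  open import Data.Nat.Tactic.RingSolver using (solve-∀)
  open import Data.Product using (_,_)
  open import Relation.Binary.PropositionalEquality
  open import Relation.Nullary using (yes; no; contradiction)

  ∣/ℕ∣≤ : ∀ x d {{_ : NonZero d}} → ∣ x ℤ./ℕ d ∣ ≤ suc ∣ x ∣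
  ∣/ℕ∣≤ (ℤ.+ n)  d = ≤-trans (m/n≤m n d) (n≤1+n n)
  ∣/ℕ∣≤ -[1+ n ] d with suc n % d
  ... | zero  = ≤-trans (≤-reflexive (ℤₚ.∣-i∣≡∣i∣ (ℤ.+ (suc n / d)))) (≤-trans (m/n≤m (suc n) d) (n≤1+n (suc n)))
  ... | suc _ = s≤s (m/n≤m (suc n) d)

  -- A crude bound: the successor pays for rounding a negative quotient down, away from 0.
  ∣÷∣≤ : ∀ x y → ∣ x ÷ y ∣ ≤ suc ∣ x ∣
  ∣÷∣≤ x (ℤ.+ 0)  = z≤n
  ∣÷∣≤ x +[1+ d ] = subst (λ z → ∣ z ∣ ≤ suc ∣ x ∣) (sym (ℤ-DivMod.div-pos-is-/ℕ x (suc d))) (∣/ℕ∣≤ x (suc d))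
  ∣÷∣≤ x -[1+ d ] = subst (_≤ suc ∣ x ∣)
    (sym (trans (cong ∣_∣ (ℤ-DivMod.div-neg-is-neg-/ℕ x (suc d))) (ℤₚ.∣-i∣≡∣i∣ (x ℤ./ℕ suc d)))) (∣/ℕ∣≤ x (suc d))

  +÷+ : ∀ m n {{_ : NonZero n}} → (ℤ.+ m) ÷ (ℤ.+ n) ≡ ℤ.+ (m / n)
  +÷+ m (suc n) = ℤ-DivMod.div-pos-is-/ℕ (ℤ.+ m) (suc n)

  -- For the computed quotient q, k times |x - q| is the remainder, which is less than k; hence q is
  -- x.
  *÷-cancel : ∀ k {{_ : NonZero k}} x → (ℤ.+ k *ᶻ x) ÷ (ℤ.+ k) ≡ x
  *÷-cancel k@(suc _) x = trans (ℤ-DivMod.div-pos-is-/ℕ z k) (sym (ℤₚ.i-j≡0⇒i≡j x q (ℤₚ.∣i∣≡0⇒i≡0 (small (begin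
    k * ∣ x -ᶻ q ∣  ≡⟨ ℤₚ.abs-* (ℤ.+ k) (x -ᶻ q) ⟨
    ∣ ℤ.+ k *ᶻ (x -ᶻ q) ∣  ≡⟨ cong ∣_∣ (distrib (ℤ.+ k) x q) ⟩
    ∣ z -ᶻ ℤ.+ k *ᶻ q ∣  ≡⟨ cong (λ t → ∣ t -ᶻ ℤ.+ k *ᶻ q ∣) (trans (ℤ-DivMod.a≡a%ℕn+[a/ℕn]*n z k) (cong (ℤ.+ r +ᶻ_) (ℤₚ.*-comm q (ℤ.+ k)))) ⟩
    ∣ ℤ.+ r +ᶻ y -ᶻ y ∣  ≡⟨ cong ∣_∣ (trans (ℤₚ.+-assoc (ℤ.+ r) y (ℤ.- y)) (trans (cong (ℤ.+ r +ᶻ_) (ℤₚ.+-inverseʳ y)) (ℤₚ.+-identityʳ (ℤ.+ r)))) ⟩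
    r  ∎)))))
    where
    open ≡-Reasoning
    z q y : ℤ
    z = ℤ.+ k *ᶻ x
    q = z ℤ./ℕ k
    y = ℤ.+ k *ᶻ q
    r : ℕ
    r = z ℤ.%ℕ k
    distrib : ∀ k x q → k *ᶻ (x -ᶻ q) ≡ k *ᶻ x -ᶻ k *ᶻ q
    distrib = ℤ-Solver.solve-∀
    small : k * ∣ x -ᶻ q ∣ ≡ r → ∣ x -ᶻ q ∣ ≡ 0
    small eq with ∣ x -ᶻ q ∣
    ... | zero  = refl
    ... | suc t = contradiction (subst (k ≤_) eq (m≤m*n k (suc t))) (<⇒≱ (ℤ-DivMod.n%ℕd<d z k))

  update-same : ∀ {X : Set} (φ : ℕ → X) i x → update φ i x i ≡ x
  update-same φ i x with i ≟ i
  ... | yes _  = refl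
  ... | no i≢i = contradiction refl i≢i

  update-other : ∀ {X : Set} (φ : ℕ → X) i x {j} → j ≢ i → update φ i x j ≡ φ j
  update-other φ i x {j} j≢i with i ≟ j
  ... | yes i≡j = contradiction (sym i≡j) j≢i
  ... | no _    = refl

  setArr-same : ∀ a i z s → arr (setArr a i z s) a i ≡ z
  setArr-same a i z s = trans (cong (λ φ → φ i) (update-same (arr s) a _)) (update-same (arr s a) i z)

  setArr-other : ∀ a i z s {j} → j ≢ i → arr (setArr a i z s) a j ≡ arr s a j
  setArr-other a i z s {j} j≢i = trans (cong (λ φ → φ j) (update-same (arr s) a _)) (update-other (arr s a) i z j≢i)

  setArr-elsewhere : ∀ a i z s {b} → b ≢ a → ∀ j → arr (setArr a i z s) b j ≡ arr s b j
  setArr-elsewhere a i z s b≢a j = cong (λ φ → φ j) (update-other (arr s) a _ b≢a)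

  m+n≤m*n : ∀ m n → 2 ≤ m → 2 ≤ n → m + n ≤ m * n
  m+n≤m*n (suc (suc m)) (suc (suc n)) (s≤s (s≤s _)) (s≤s (s≤s _)) = subst (suc (suc m) + suc (suc n) ≤_) (lemma m n) (m≤m+n _ (m * n + m + n))
    where
    lemma : ∀ m n → suc (suc m) + suc (suc n) + (m * n + m + n) ≡ suc (suc m) * suc (suc n)
    lemma = solve-∀

  n≤2^n : ∀ n → n ≤ 2 ^ n
  n≤2^n zero    = z≤n
  n≤2^n (suc n) = subst (suc n ≤_) (cong (2 ^ n +_) (sym (+-identityʳ (2 ^ n)))) (+-mono-≤ (m^n>0 2 n) (n≤2^n n))

  -- Under a bound W ≥ 2 on all registers and cells, an expression e takes
  -- values of absolute value at most W ^ degree e.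
  degree : Expr → ℕ
  degree (const z)     = suc ∣ z ∣
  degree (var _)       = 1
  degree (read _ _)    = 1
  degree (bin _ e₁ e₂) = degree e₁ + degree e₂

  degree≥1 : ∀ e → 1 ≤ degree e
  degree≥1 (const _)     = s≤s z≤n
  degree≥1 (var _)       = s≤s z≤n
  degree≥1 (read _ _)    = s≤s z≤n
  degree≥1 (bin _ e₁ e₂) = ≤-trans (degree≥1 e₁) (m≤m+n (degree e₁) (degree e₂))

  -- Values up to W ^ `degree e` have length at most `sizeFactor e` times `log⁺ W`; the extra 1
  -- absorbs the additive 2 of `log⁺-^`.
  sizeFactor : Expr → ℕ
  sizeFactor e = suc (degree e)

  -- Counts units of (`log⁺ W`)², the square being due to multiplication and division. It depends on
  -- the expression only, so it is a constant of the program.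
  costFactor : Expr → ℕ
  costFactor e@(const _)     = sizeFactor e
  costFactor e@(var _)       = sizeFactor e
  costFactor e@(read _ e′)   = costFactor e′ + sizeFactor e′ + sizeFactor e
  costFactor (bin _ e₁ e₂)   = costFactor e₁ + costFactor e₂ + (sizeFactor e₁ + sizeFactor e₂ + sizeFactor e₁ * sizeFactor e₂)

  assignCost : Expr → ℕ
  assignCost e = costFactor e + sizeFactor e

  writeCost : Expr → Expr → ℕ
  writeCost i e = costFactor i + costFactor e + sizeFactor i + sizeFactor e

  module Execution (W : ℕ) (2≤W : 2 ≤ W) where

    record Bounded (s : State) : Set where
      field
        regs : ∀ r → ∣ reg s r ∣ ≤ W
        arrs : ∀ a i → ∣ arr s a i ∣ ≤ W
    open Bounded

    ℓ unit : ℕ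
    ℓ = log⁺ W
    unit = ℓ * ℓ

    instance
      W≢0 : NonZero W
      W≢0 = >-nonZero (≤-trans (s≤s z≤n) 2≤W)

    W^-mono : ∀ {m n} → m ≤ n → W ^ m ≤ W ^ n
    W^-mono = ^-monoʳ-≤ W

    2≤W^ : ∀ {n} → 1 ≤ n → 2 ≤ W ^ n
    2≤W^ {n} 1≤n = ≤-trans 2≤W (subst (_≤ W ^ n) (^-identityʳ W) (W^-mono 1≤n))

    ≤W⇒≤W^ : ∀ {x n} → 1 ≤ n → x ≤ W → x ≤ W ^ n
    ≤W⇒≤W^ {x} {n} 1≤n x≤W = ≤-trans x≤W (subst (_≤ W ^ n) (^-identityʳ W) (W^-mono 1≤n))

    apply-bound : ∀ o x y {m n} → 1 ≤ m → 1 ≤ n → ∣ x ∣ ≤ W ^ m → ∣ y ∣ ≤ W ^ n → ∣ apply o x y ∣ ≤ W ^ (m + n)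
    apply-bound o x y {m} {n} 1≤m 1≤n ∣x∣≤ ∣y∣≤ = subst (∣ apply o x y ∣ ≤_) (sym (^-distribˡ-+-* W m n)) (go o)
      where
      sum-bound : ∣ x ∣ + ∣ y ∣ ≤ W ^ m * W ^ n
      sum-bound = ≤-trans (+-mono-≤ ∣x∣≤ ∣y∣≤) (m+n≤m*n (W ^ m) (W ^ n) (2≤W^ 1≤m) (2≤W^ 1≤n))
      go : ∀ o → ∣ apply o x y ∣ ≤ W ^ m * W ^ n
      go plus  = ≤-trans (ℤₚ.∣i+j∣≤∣i∣+∣j∣ x y) sum-bound
      go minus = ≤-trans (ℤₚ.∣i-j∣≤∣i∣+∣j∣ x y) sum-bound
      go times = ≤-trans (≤-reflexive (ℤₚ.abs-* x y)) (*-mono-≤ ∣x∣≤ ∣y∣≤)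
      go quot  = begin
        ∣ x ÷ y ∣  ≤⟨ ∣÷∣≤ x y ⟩
        1 + ∣ x ∣  ≤⟨ +-mono-≤ {1} {2} (s≤s z≤n) ∣x∣≤ ⟩
        2 + W ^ m  ≤⟨ +-monoˡ-≤ (W ^ m) (2≤W^ 1≤n) ⟩
        W ^ n + W ^ m  ≤⟨ m+n≤m*n (W ^ n) (W ^ m) (2≤W^ 1≤n) (2≤W^ 1≤m) ⟩
        W ^ n * W ^ m  ≡⟨ *-comm (W ^ n) (W ^ m) ⟩
        W ^ m * W ^ n  ∎
        where open ≤-Reasoning

    value-bound : ∀ {s} → Bounded s → ∀ e → ∣ ⟦ e ⟧ s ∣ ≤ W ^ degree e
    value-bound b (const z) = ≤-trans (n≤2^n ∣ z ∣) (≤-trans (^-monoˡ-≤ ∣ z ∣ 2≤W) (W^-mono (n≤1+n ∣ z ∣)))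
    value-bound b (var x) = ≤W⇒≤W^ {n = 1} ≤-refl (regs b x)
    value-bound {s} b (read a e) = ≤W⇒≤W^ {n = 1} ≤-refl (arrs b a ∣ ⟦ e ⟧ s ∣)
    value-bound {s} b (bin o e₁ e₂) = apply-bound o (⟦ e₁ ⟧ s) (⟦ e₂ ⟧ s) (degree≥1 e₁) (degree≥1 e₂) (value-bound b e₁) (value-bound b e₂)

    2≤ℓ : 2 ≤ ℓ
    2≤ℓ = 2≤log⁺ (≤-trans (s≤s z≤n) 2≤W)

    instance
      ℓ≢0 : NonZero ℓ
      ℓ≢0 = _

    ℓ≤unit : ℓ ≤ unit
    ℓ≤unit = m≤m*n ℓ ℓ

    1≤unit : 1 ≤ unit
    1≤unit = ≤-trans (s≤s z≤n) ℓ≤unit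

    size-bound : ∀ {s} → Bounded s → ∀ e → size (⟦ e ⟧ s) ≤ sizeFactor e * ℓ
    size-bound {s} b e = begin
      log⁺ ∣ ⟦ e ⟧ s ∣  ≤⟨ log⁺-mono (value-bound b e) ⟩
      log⁺ (W ^ degree e)  ≤⟨ log⁺-^ W (degree e) ⟩
      2 + degree e * ℓ  ≤⟨ +-monoˡ-≤ (degree e * ℓ) 2≤ℓ ⟩
      sizeFactor e * ℓ  ∎
      where open ≤-Reasoning

    size-unit : ∀ {s} → Bounded s → ∀ e → size (⟦ e ⟧ s) ≤ sizeFactor e * unit
    size-unit b e = ≤-trans (size-bound b e) (*-monoʳ-≤ (sizeFactor e) ℓ≤unit)

    add-units : ∀ {x y} m n → x ≤ m * unit → y ≤ n * unit → x + y ≤ (m + n) * unit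
    add-units {x} {y} m n x≤ y≤ = subst (x + y ≤_) (sym (*-distribʳ-+ unit m n)) (+-mono-≤ x≤ y≤)

    suc-unit : ∀ {x} m → x ≤ m * unit → suc x ≤ suc m * unit
    suc-unit m x≤ = +-mono-≤ 1≤unit x≤

    cost-bound : ∀ {s} → Bounded s → ∀ e → evalCost e s ≤ costFactor e * unit
    cost-bound b e@(const _) = size-unit b e
    cost-bound b e@(var _)   = size-unit b e
    cost-bound b e@(read _ e′) = add-units (costFactor e′ + sizeFactor e′) (sizeFactor e)
      (add-units (costFactor e′) (sizeFactor e′) (cost-bound b e′) (size-unit b e′)) (size-unit b e)
    cost-bound {s} b (bin o e₁ e₂) = add-units (costFactor e₁ + costFactor e₂) _
      (add-units (costFactor e₁) (costFactor e₂) (cost-bound b e₁) (cost-bound b e₂)) (op-bound o)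
      where
      sum-bound : size (⟦ e₁ ⟧ s) + size (⟦ e₂ ⟧ s) ≤ (sizeFactor e₁ + sizeFactor e₂ + sizeFactor e₁ * sizeFactor e₂) * unit
      sum-bound = ≤-trans (add-units (sizeFactor e₁) (sizeFactor e₂) (size-unit b e₁) (size-unit b e₂))
        (*-monoˡ-≤ unit (m≤m+n (sizeFactor e₁ + sizeFactor e₂) _))
      product-bound : size (⟦ e₁ ⟧ s) * size (⟦ e₂ ⟧ s) ≤ (sizeFactor e₁ + sizeFactor e₂ + sizeFactor e₁ * sizeFactor e₂) * unit
      product-bound = ≤-trans (*-mono-≤ (size-bound b e₁) (size-bound b e₂))
        (≤-trans (≤-reflexive (lemma (sizeFactor e₁) (sizeFactor e₂) ℓ))
                 (*-monoˡ-≤ unit (m≤n+m (sizeFactor e₁ * sizeFactor e₂) (sizeFactor e₁ + sizeFactor e₂))))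
        where
        lemma : ∀ x y l → (x * l) * (y * l) ≡ (x * y) * (l * l)
        lemma = solve-∀
      op-bound : ∀ o → opCost o (⟦ e₁ ⟧ s) (⟦ e₂ ⟧ s) ≤ (sizeFactor e₁ + sizeFactor e₂ + sizeFactor e₁ * sizeFactor e₂) * unit
      op-bound plus  = sum-bound
      op-bound minus = sum-bound
      op-bound times = product-bound
      op-bound quot  = product-bound

    -- A total-correctness triple with a time bound. Boundedness by W is part of the conclusion
    -- because the cost bounds of whatever runs next rely on it.
    record Exec (p : Program) (s : State) (Q : State → Set) (c : ℕ) : Set where
      field
        final   : State
        time    : ℕ
        run     : ⟨ p , s ⟩⇓⟨ final , time ⟩
        time≤   : time ≤ c * unit
        bounded : Bounded final
        post    : Q final
    open Exec

    setReg-bounded : ∀ {s} → Bounded s → ∀ x z → ∣ z ∣ ≤ W → Bounded (setReg x z s)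
    setReg-bounded {s} b x z ∣z∣≤W .regs r with x ≟ r
    ... | yes _ = ∣z∣≤W
    ... | no _  = regs b r
    setReg-bounded b x z ∣z∣≤W .arrs = arrs b

    setArr-bounded : ∀ {s} → Bounded s → ∀ a i z → ∣ z ∣ ≤ W → Bounded (setArr a i z s)
    setArr-bounded b a i z ∣z∣≤W .regs = regs b
    setArr-bounded {s} b a i z ∣z∣≤W .arrs a′ i′ with a ≟ a′
    ... | no _ = arrs b a′ i′
    ... | yes _ with i ≟ i′
    ...   | yes _ = ∣z∣≤W
    ...   | no _  = arrs b a i′

    exec-weaken : ∀ {p s Q Q′ c c′} → c ≤ c′ → (∀ {s′} → Q s′ → Q′ s′) → Exec p s Q c → Exec p s Q′ c′
    exec-weaken c≤c′ imp e = record
      { final = final e ; time = time e ; run = run e ; bounded = bounded e ; post = imp (post e)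
      ; time≤ = ≤-trans (time≤ e) (*-monoˡ-≤ unit c≤c′) }

    exec-skip : ∀ {s} {Q : State → Set} → Bounded s → Q s → Exec skip s Q 1
    exec-skip b q = record { run = ⇓skip ; bounded = b ; post = q ; time≤ = ≤-trans 1≤unit (≤-reflexive (sym (*-identityˡ unit))) }

    exec-assign : ∀ {s} {Q : State → Set} x e {z} → Bounded s → ⟦ e ⟧ s ≡ z → ∣ z ∣ ≤ W → Q (setReg x z s) →
      Exec (assign x e) s Q (assignCost e)
    exec-assign x e b refl ∣z∣≤W q = record
      { run = ⇓assign ; bounded = setReg-bounded b x _ ∣z∣≤W ; post = q
      ; time≤ = add-units (costFactor e) (sizeFactor e) (cost-bound b e) (size-unit b e) }

    exec-write : ∀ {s} {Q : State → Set} a i e {j z} → Bounded s → ⟦ i ⟧ s ≡ ℤ.+ j → ⟦ e ⟧ s ≡ z → ∣ z ∣ ≤ W →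
      Q (setArr a j z s) → Exec (write a i e) s Q (writeCost i e)
    exec-write {s} {Q} a i e {j} b i≡ refl ∣z∣≤W q = record
      { run = ⇓write ; bounded = setArr-bounded b a ∣ ⟦ i ⟧ s ∣ (⟦ e ⟧ s) ∣z∣≤W
      ; post = subst (λ t → Q (setArr a ∣ t ∣ (⟦ e ⟧ s) s)) (sym i≡) q
      ; time≤ = add-units (costFactor i + costFactor e + sizeFactor i) (sizeFactor e)
          (add-units (costFactor i + costFactor e) (sizeFactor i)
            (add-units (costFactor i) (costFactor e) (cost-bound b i) (cost-bound b e)) (size-unit b i)) (size-unit b e) }

    exec-seq : ∀ {p q s Q R c c′} → Exec p s Q c → (∀ {s′} → Bounded s′ → Q s′ → Exec q s′ R c′) → Exec (p ⨟ q) s R (c + c′)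
    exec-seq {c = c} {c′} e k = let e′ = k (bounded e) (post e) in record
      { run = ⇓seq (run e) (run e′) ; bounded = bounded e′ ; post = post e′
      ; time≤ = add-units c c′ (time≤ e) (time≤ e′) }

    exec-exit : ∀ {e p s} {Q : State → Set} → Bounded s → ⟦ e ⟧ s ≡ 0ℤ → Q s → Exec (while>0 e loop p) s Q (suc (costFactor e))
    exec-exit {e} b e≡0 q = record
      { run = ⇓exit (λ pos → ℤₚ.<-irrefl (sym e≡0) pos) ; bounded = b ; post = q
      ; time≤ = suc-unit (costFactor e) (cost-bound b e) }

    exec-loop : ∀ {e p s Q R c c′} n → Bounded s → ⟦ e ⟧ s ≡ ℤ.+ suc n → Exec p s Q c →
      (∀ {s′} → Bounded s′ → Q s′ → Exec (while>0 e loop p) s′ R c′) →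
      Exec (while>0 e loop p) s R (suc (costFactor e + c + c′))
    exec-loop {e} {c = c} {c′} n b e≡ x k = let x′ = k (bounded x) (post x) in record
      { run = ⇓loop (subst Positive (sym e≡) (+<+ (s≤s z≤n))) (run x) (run x′) ; bounded = bounded x′ ; post = post x′
      ; time≤ = suc-unit (costFactor e + c + c′) (add-units (costFactor e + c) c′
          (add-units (costFactor e) c (cost-bound b e) (time≤ x)) (time≤ x′)) }

-- Loops that append computed cells to an array

module FillLoops where

  open Machine
  open import Data.Fin using (Fin; zero; suc; toℕ)
  import Data.Fin.Properties
  open import Data.Integer as ℤ using (ℤ; 0ℤ; ∣_∣) renaming (_+_ to _+ᶻ_; _-_ to _-ᶻ_)
  import Data.Integer.Properties as ℤₚ
  open import Data.Nat
  open import Data.Nat.Properties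
  open import Data.Product using (∃-syntax; _×_; _,_)
  open import Data.Sum using (inj₁; inj₂)
  open import Function using (_∘_)
  open import Relation.Binary.PropositionalEquality

  pattern loopReg = 4
  pattern topReg  = 5

  increment : Reg → Program
  increment r = assign r (bin plus (var r) (const (ℤ.+ 1)))

  append : Arr → Expr → Program
  append A e = write A (var topReg) e ⨟ increment topReg

  appends : Arr → (w : ℕ) → (Fin w → Expr) → Program
  appends A zero    es = skip
  appends A (suc w) es = append A (es zero) ⨟ appends A w (es ∘ suc)

  -- topReg holds the next free cell of A; the expressions may read loopReg.
  fill : Arr → Reg → (w : ℕ) → (Fin w → Expr) → Program
  fill A cnt w es = assign loopReg (const 0ℤ) ⨟
    while>0 bin minus (var cnt) (var loopReg) loop (appends A w es ⨟ increment loopReg)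

  +-monus : ∀ m n → ℤ.+ (m + n) -ᶻ ℤ.+ m ≡ ℤ.+ n
  +-monus m n = trans (ℤₚ.m-n≡m⊖n (m + n) m) (trans (ℤₚ.⊖-≥ (m≤m+n m n)) (cong ℤ.+_ (m+n∸m≡n m n)))

  -- A transform layer reads the part of A below τ while it writes the part above. This invariant
  -- says what an expression may read without seeing those writes.
  record Frame (A : Arr) (τ : ℕ) (s₀ s : State) : Set where
    field
      regs   : ∀ r → r ≢ loopReg → r ≢ topReg → reg s r ≡ reg s₀ r
      others : ∀ B → B ≢ A → ∀ i → arr s B i ≡ arr s₀ B i
      below  : ∀ i → i < τ → arr s A i ≡ arr s₀ A i
  open Frame public

  module _ {A : Arr} {τ : ℕ} {s₀ : State} where

    frame-refl : Frame A τ s₀ s₀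
    frame-refl = record { regs = λ _ _ _ → refl ; others = λ _ _ _ → refl ; below = λ _ _ → refl }

    frame-loopReg : ∀ {s z} → Frame A τ s₀ s → Frame A τ s₀ (setReg loopReg z s)
    frame-loopReg {s} φ .regs r r≢q r≢t = trans (update-other (reg s) loopReg _ r≢q) (regs φ r r≢q r≢t)
    frame-loopReg φ .others = others φ
    frame-loopReg φ .below  = below φ

    frame-topReg : ∀ {s z} → Frame A τ s₀ s → Frame A τ s₀ (setReg topReg z s)
    frame-topReg {s} φ .regs r r≢q r≢t = trans (update-other (reg s) topReg _ r≢t) (regs φ r r≢q r≢t)
    frame-topReg φ .others = others φ
    frame-topReg φ .below  = below φ

    frame-setArr : ∀ {s i z} → τ ≤ i → Frame A τ s₀ s → Frame A τ s₀ (setArr A i z s)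
    frame-setArr τ≤i φ .regs = regs φ
    frame-setArr {s} {i} {z} τ≤i φ .others B B≢A j = trans (setArr-elsewhere A i z s B≢A j) (others φ B B≢A j)
    frame-setArr {s} {i} {z} τ≤i φ .below j j<τ = trans (setArr-other A i z s (<⇒≢ (<-≤-trans j<τ τ≤i))) (below φ j j<τ)

  appendCost : Expr → ℕ
  appendCost e = writeCost (var topReg) e + assignCost (bin plus (var topReg) (const (ℤ.+ 1)))

  appendsCost : (w : ℕ) → (Fin w → Expr) → ℕ
  appendsCost zero    es = 1
  appendsCost (suc w) es = appendCost (es zero) + appendsCost w (es ∘ suc)

  guard : Reg → Expr
  guard cnt = bin minus (var cnt) (var loopReg)

  iterationCost : Reg → (w : ℕ) → (Fin w → Expr) → ℕ
  iterationCost cnt w es = costFactor (guard cnt) + (appendsCost w es + assignCost (bin plus (var loopReg) (const (ℤ.+ 1))))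

  fillCost : Reg → (w : ℕ) → (Fin w → Expr) → ℕ → ℕ
  fillCost cnt w es N = assignCost (const 0ℤ) + (N * suc (iterationCost cnt w es) + suc (costFactor (guard cnt)))

  module FillExecution (W : ℕ) (2≤W : 2 ≤ W) where

    open Execution W 2≤W public

    increment-value : ∀ {s} r n → reg s r ≡ ℤ.+ n → ⟦ bin plus (var r) (const (ℤ.+ 1)) ⟧ s ≡ ℤ.+ suc n
    increment-value r n eq = trans (cong (_+ᶻ ℤ.+ 1) eq) (cong ℤ.+_ (+-comm n 1))

    module _ (A : Arr) (τ₀ : ℕ) (s₀ : State) where

      record Appended (s : State) (q τ : ℕ) {w : ℕ} (val : Fin w → ℤ) (s′ : State) : Set where
        field
          kept  : Frame A τ₀ s₀ s′
          loop≡ : reg s′ loopReg ≡ ℤ.+ q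
          end≡  : reg s′ topReg ≡ ℤ.+ (τ + w)
          old   : ∀ i → i < τ → arr s′ A i ≡ arr s A i
          new   : ∀ (i : Fin w) → arr s′ A (τ + toℕ i) ≡ val i
      open Appended

      exec-append : ∀ q τ e z {s} → τ₀ ≤ τ → suc τ ≤ W → ∣ z ∣ ≤ W → Bounded s → Frame A τ₀ s₀ s →
        reg s loopReg ≡ ℤ.+ q → reg s topReg ≡ ℤ.+ τ → ⟦ e ⟧ s ≡ z →
        Exec (append A e) s (λ s′ → (Frame A τ₀ s₀ s′ × reg s′ loopReg ≡ ℤ.+ q × reg s′ topReg ≡ ℤ.+ suc τ)
          × (∀ i → i < τ → arr s′ A i ≡ arr s A i) × arr s′ A τ ≡ z) (appendCost e)
      exec-append q τ e z {s} τ₀≤τ τ<W z≤W b φ q≡ t≡ e≡ =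
        exec-seq (exec-write {Q = Written} A (var topReg) e {τ} {z} b t≡ e≡ z≤W
          ((frame-setArr {s = s} τ₀≤τ φ , q≡ , t≡) , (λ i i<τ → setArr-other A τ z s (<⇒≢ i<τ)) , setArr-same A τ z s))
          (λ {s₁} b₁ ((φ₁ , q₁ , t₁) , old₁ , new₁) →
            exec-assign topReg (bin plus (var topReg) (const (ℤ.+ 1))) {ℤ.+ suc τ} b₁ (increment-value {s₁} topReg τ t₁) τ<W
              ((frame-topReg φ₁ , q₁ , refl) , old₁ , new₁))
        where
        Written : State → Set
        Written s′ = (Frame A τ₀ s₀ s′ × reg s′ loopReg ≡ ℤ.+ q × reg s′ topReg ≡ ℤ.+ τ)
          × (∀ i → i < τ → arr s′ A i ≡ arr s A i) × arr s′ A τ ≡ z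

      exec-appends : ∀ q w es (val : Fin w → ℤ) τ {s} → τ₀ ≤ τ → τ + w ≤ W →
        (∀ i → ∣ val i ∣ ≤ W) →
        (∀ s′ → Frame A τ₀ s₀ s′ → reg s′ loopReg ≡ ℤ.+ q → ∀ i → ⟦ es i ⟧ s′ ≡ val i) →
        Bounded s → Frame A τ₀ s₀ s → reg s loopReg ≡ ℤ.+ q → reg s topReg ≡ ℤ.+ τ →
        Exec (appends A w es) s (Appended s q τ val) (appendsCost w es)
      exec-appends q zero es val τ τ₀≤τ τ+w≤W val≤W sem b φ q≡ t≡ = exec-skip b record
        { kept = φ ; loop≡ = q≡ ; end≡ = trans t≡ (cong ℤ.+_ (sym (+-identityʳ τ))) ; old = λ _ _ → refl ; new = λ () }
      exec-appends q (suc w) es val τ {s} τ₀≤τ τ+w≤W val≤W sem b φ q≡ t≡ =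
        exec-seq (exec-append q τ (es zero) (val zero) τ₀≤τ (≤-trans (m≤m+n (suc τ) w) sucτ+w≤W) (val≤W zero) b φ q≡ t≡ (sem s φ q≡ zero))
          (λ {s₁} b₁ ((φ₁ , q₁ , t₁) , old₁ , new₁) → exec-weaken ≤-refl
            (λ {s₂} r → record
              { kept  = kept r
              ; loop≡ = loop≡ r
              ; end≡  = trans (end≡ r) (cong ℤ.+_ (sym (+-suc τ w)))
              ; old   = λ i i<τ → trans (old r i (<-trans i<τ (n<1+n τ))) (old₁ i i<τ)
              ; new   = λ { zero    → trans (cong (arr s₂ A) (+-identityʳ τ)) (trans (old r τ (n<1+n τ)) new₁)
                          ; (suc i) → trans (cong (arr s₂ A) (+-suc τ (toℕ i))) (new r i) }
              })
            (exec-appends q w (es ∘ suc) (val ∘ suc) (suc τ) (≤-trans τ₀≤τ (n≤1+n τ)) sucτ+w≤W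
              (λ i → val≤W (suc i)) (λ s′ φ′ q′ i → sem s′ φ′ q′ (suc i)) b₁ φ₁ q₁ t₁))
        where
        sucτ+w≤W : suc τ + w ≤ W
        sucτ+w≤W = subst (_≤ W) (+-suc τ w) τ+w≤W

      record Filled (N w : ℕ) (val : ℕ → Fin w → ℤ) (s′ : State) : Set where
        field
          frame : Frame A τ₀ s₀ s′
          top≡  : reg s′ topReg ≡ ℤ.+ (τ₀ + N * w)
          cells : ∀ q → q < N → ∀ (i : Fin w) → arr s′ A (τ₀ + (q * w + toℕ i)) ≡ val q i
      open Filled

      module _ (cnt : Reg) (cnt≢q : cnt ≢ loopReg) (cnt≢t : cnt ≢ topReg) (N w : ℕ) (es : Fin w → Expr)
        (val : ℕ → Fin w → ℤ) (cnt≡ : reg s₀ cnt ≡ ℤ.+ N) (N≤W : N ≤ W) (top≤W : τ₀ + N * w ≤ W)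
        (val≤W : ∀ q i → ∣ val q i ∣ ≤ W)
        (sem : ∀ q → q < N → ∀ s′ → Frame A τ₀ s₀ s′ → reg s′ loopReg ≡ ℤ.+ q → ∀ i → ⟦ es i ⟧ s′ ≡ val q i) where

        private
          loop : Program
          loop = while>0 guard cnt loop (appends A w es ⨟ increment loopReg)

          guard-value : ∀ {s} q r → q + r ≡ N → Frame A τ₀ s₀ s → reg s loopReg ≡ ℤ.+ q → ⟦ guard cnt ⟧ s ≡ ℤ.+ r
          guard-value q r q+r≡N φ q≡ = trans (cong₂ _-ᶻ_ (trans (regs φ cnt cnt≢q cnt≢t) (trans cnt≡ (cong ℤ.+_ (sym q+r≡N)))) q≡) (+-monus q r)

          -- Induction on the number r of iterations left; q + r = N keeps the guard equal to r, so
          -- that the loop stops exactly at 0.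
          exec-iterations : ∀ r q {s} → q + r ≡ N → Bounded s → Frame A τ₀ s₀ s →
            reg s loopReg ≡ ℤ.+ q → reg s topReg ≡ ℤ.+ (τ₀ + q * w) →
            (∀ q′ → q′ < q → ∀ (i : Fin w) → arr s A (τ₀ + (q′ * w + toℕ i)) ≡ val q′ i) →
            Exec loop s (Filled N w val) (r * suc (iterationCost cnt w es) + suc (costFactor (guard cnt)))
          exec-iterations zero q {s} q+0≡N b φ q≡ t≡ done = exec-exit b (guard-value {s} q 0 q+0≡N φ q≡)
            record { frame = φ ; top≡ = trans t≡ (cong (λ n → ℤ.+ (τ₀ + n * w)) q≡N)
                   ; cells = λ q′ q′<N → done q′ (subst (q′ <_) (sym q≡N) q′<N) }
            where
            q≡N : q ≡ N
            q≡N = trans (sym (+-identityʳ q)) q+0≡N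
          exec-iterations (suc r) q {s} q+r≡N b φ q≡ t≡ done = exec-weaken
            (≤-reflexive (cong suc (sym (+-assoc (iterationCost cnt w es) (r * suc (iterationCost cnt w es)) _)))) (λ x → x)
            (exec-loop r b (guard-value {s} q (suc r) q+r≡N φ q≡)
              (exec-seq (exec-appends q w es (val q) τ (m≤m+n τ₀ (q * w)) τ+w≤W (val≤W q) (sem q q<N) b φ q≡ t≡)
                (λ {s₁} b₁ a → exec-assign {Q = Incremented} loopReg (bin plus (var loopReg) (const (ℤ.+ 1))) {ℤ.+ suc q} b₁
                  (increment-value {s₁} loopReg q (loop≡ a)) (≤-trans q<N N≤W) (s₁ , a , refl)))
              (λ { b₂ (s₁ , a , refl) → exec-iterations r (suc q) sucq+r≡N b₂ (frame-loopReg (kept a)) refl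
                    (trans (end≡ a) (cong ℤ.+_ step)) (all-done s₁ a) }))
            where
            -- Incrementing `loopReg` invalidates the field `loop≡`, so the postcondition keeps the
            -- state before the increment as a witness.
            Incremented : State → Set
            Incremented s₂ = ∃[ s₁ ] Appended s q (τ₀ + q * w) (val q) s₁ × s₂ ≡ setReg loopReg (ℤ.+ suc q) s₁
            τ = τ₀ + q * w
            sucq+r≡N : suc q + r ≡ N
            sucq+r≡N = trans (sym (+-suc q r)) q+r≡N
            q<N : q < N
            q<N = subst (suc q ≤_) sucq+r≡N (m≤m+n (suc q) r)
            step : τ + w ≡ τ₀ + suc q * w
            step = trans (+-assoc τ₀ (q * w) w) (cong (τ₀ +_) (+-comm (q * w) w))
            τ+w≤W : τ + w ≤ W
            τ+w≤W = subst (_≤ W) (sym step) (≤-trans (+-monoʳ-≤ τ₀ (*-monoˡ-≤ w q<N)) top≤W)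
            all-done : ∀ s₁ → Appended s q τ (val q) s₁ → ∀ q′ → q′ < suc q → ∀ (i : Fin w) → arr s₁ A (τ₀ + (q′ * w + toℕ i)) ≡ val q′ i
            all-done s₁ a q′ q′<sq i with m≤n⇒m<n∨m≡n (≤-pred q′<sq)
            ... | inj₂ refl = trans (cong (arr s₁ A) (sym (+-assoc τ₀ (q * w) (toℕ i)))) (new a i)
            ... | inj₁ q′<q = trans (old a _ (+-monoʳ-< τ₀ before)) (done q′ q′<q i)
              where
              before : q′ * w + toℕ i < q * w
              before = <-≤-trans (+-monoʳ-< (q′ * w) (Data.Fin.Properties.toℕ<n i))
                (≤-trans (≤-reflexive (+-comm (q′ * w) w)) (*-monoˡ-≤ w q′<q))

        exec-fill : Bounded s₀ → reg s₀ topReg ≡ ℤ.+ τ₀ → Exec (fill A cnt w es) s₀ (Filled N w val) (fillCost cnt w es N)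
        exec-fill b t≡ = exec-seq
          (exec-assign {Q = λ s → Frame A τ₀ s₀ s × reg s loopReg ≡ ℤ.+ 0 × reg s topReg ≡ ℤ.+ τ₀}
            loopReg (const 0ℤ) {ℤ.+ 0} b refl z≤n (frame-loopReg frame-refl , refl , t≡))
          (λ b₁ (φ₁ , q₁ , t₁) → exec-iterations N 0 refl b₁ φ₁ q₁ (trans t₁ (cong ℤ.+_ (sym (+-identityʳ τ₀)))) (λ _ ()))

-- The program for one transform over the group ring

module TransformProgram where

  open IntegerSums
  open GroupRing
  open YatesTransform
  open Machine
  open FillLoops
  open import Algebra.Bundles using (CommutativeSemiring)
  open import Data.Fin using (Fin; zero; suc; toℕ; combine; remQuot)
  open import Data.Fin.Properties using (toℕ<n; toℕ-combine; remQuot-combine; toℕ-fromℕ<)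
  open import Data.Integer as ℤ using (ℤ; 0ℤ; ∣_∣) renaming (_+_ to _+ᶻ_; _*_ to _*ᶻ_; _-_ to _-ᶻ_)
  import Data.Integer.Properties as ℤₚ
  open import Data.Nat
  open import Data.Nat.DivMod using (_mod_; m%n<n; m≡m%n+[m/n]*n; m*n/n≡m; m/n*n≤m)
  open import Data.Nat.Properties
  open import Data.Nat.Tactic.RingSolver using (solve-∀)
  open import Data.Product using (∃-syntax; _×_; _,_; uncurry)
  open import Relation.Binary.PropositionalEquality
  open import Relation.Nullary using (Dec; yes; no)

  pattern nReg = 0
  pattern sizeReg = 1
  pattern scaleReg = 2
  pattern savedReg = 3
  pattern offsetReg = 6
  pattern lengthReg = 7
  pattern strideReg = 8
  pattern countReg = 9
  pattern bufferReg = 10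

  sumE : ∀ {n} → (Fin n → Expr) → Expr
  sumE {zero}  es = const 0ℤ
  sumE {suc n} es = bin plus (es zero) (sumE (λ i → es (suc i)))

  sumE-value : ∀ {n} {es : Fin n → Expr} {xs : Fin n → ℤ} {s} → (∀ i → ⟦ es i ⟧ s ≡ xs i) → ⟦ sumE es ⟧ s ≡ sum xs
  sumE-value {zero}  h = refl
  sumE-value {suc n} h = cong₂ _+ᶻ_ (h zero) (sumE-value (λ i → h (suc i)))

  ∣∑∣≤ : ∀ {n} (φ : Fin n → ℤ) {B} → (∀ i → ∣ φ i ∣ ≤ B) → ∣ sum φ ∣ ≤ n * B
  ∣∑∣≤ {zero}  φ h = z≤n
  ∣∑∣≤ {suc n} φ h = ≤-trans (ℤₚ.∣i+j∣≤∣i∣+∣j∣ (φ zero) _) (+-mono-≤ (h zero) (∣∑∣≤ (λ i → φ (suc i)) (λ i → h (suc i))))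

  ∣indicator∣≤1 : ∀ {P : Set} (p : Dec P) → ∣ indicator p ∣ ≤ 1
  ∣indicator∣≤1 (yes _) = ≤-refl
  ∣indicator∣≤1 (no _)  = z≤n

  decrement : Reg → Expr
  decrement r = bin minus (var r) (const (ℤ.+ 1))

  decrement-value : ∀ {s} r n → reg s r ≡ ℤ.+ suc n → ⟦ decrement r ⟧ s ≡ ℤ.+ n
  decrement-value r n eq = cong (_-ᶻ ℤ.+ 1) eq

  -- Registers 0 to 3 are reserved for n, d ^ n, K ^ n and the position of the first transform,
  -- which have to outlive the phases in between.
  record Preserved (A : Arr) (s₀ s : State) : Set where
    field
      params : ∀ r → r < 4 → reg s r ≡ reg s₀ r
      others : ∀ B → B ≢ A → ∀ i → arr s B i ≡ arr s₀ B i
  open Preserved public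

  preserved-trans : ∀ {A s₀ s₁ s₂} → Preserved A s₀ s₁ → Preserved A s₁ s₂ → Preserved A s₀ s₂
  preserved-trans p q = record
    { params = λ r r<4 → trans (params q r r<4) (params p r r<4)
    ; others = λ B B≢A i → trans (others q B B≢A i) (others p B B≢A i) }

  <4⇒≢ : ∀ {r n} → 4 ≤ n → r < 4 → r ≢ n
  <4⇒≢ 4≤n r<4 = <⇒≢ (<-≤-trans r<4 4≤n)

  module TupleBlocks (K : ℕ) {{K≢0 : NonZero K}} where

    open CyclicGroupRing K

    Tuple : Set
    Tuple = Fin K → Expr

    -- Component a of the i-th tuple of an array block starting at o is the cell o + i K + a.
    cellE : Arr → Reg → Expr → Tuple
    cellE A base position a = read A (bin plus (var base) (bin plus (bin times position (const (ℤ.+ K))) (const (ℤ.+ toℕ a))))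

    -- K is a constant, so each component of a ring product is a single expression of fixed size,
    -- with no loop over components.
    mulE : Tuple → Tuple → Tuple
    mulE r s c = sumE (λ a → sumE (λ b → bin times (const (carry a b c)) (bin times (r a) (s b))))

    Block : State → Arr → ℕ → ℕ → (ℕ → R) → Set
    Block s A o L F = ∀ i → i < L → ∀ a → arr s A (o + (i * K + toℕ a)) ≡ F i a

    record Ready (A : Arr) (o L : ℕ) (F : ℕ → R) (s : State) : Set where
      field
        offset≡ : reg s offsetReg ≡ ℤ.+ o
        length≡ : reg s lengthReg ≡ ℤ.+ L
        top≡    : reg s topReg ≡ ℤ.+ (o + L * K)
        block   : Block s A o L F

    cellE-value : ∀ A base position {s o i} a → reg s base ≡ ℤ.+ o → ⟦ position ⟧ s ≡ ℤ.+ i →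
      ⟦ cellE A base position a ⟧ s ≡ arr s A (o + (i * K + toℕ a))
    cellE-value A base position {s} {o} {i} a o≡ i≡ = cong (λ z → arr s A ∣ z ∣)
      (trans (cong₂ _+ᶻ_ o≡ (cong (_+ᶻ ℤ.+ toℕ a) (trans (cong (_*ᶻ ℤ.+ K) i≡) (sym (ℤₚ.pos-* i K))))) refl)

    mulE-value : ∀ r s {x y : R} {σ} → (∀ a → ⟦ r a ⟧ σ ≡ x a) → (∀ a → ⟦ s a ⟧ σ ≡ y a) →
      ∀ c → ⟦ mulE r s c ⟧ σ ≡ (x *ᴿ y) c
    mulE-value r s r≡ s≡ c = sumE-value (λ a → sumE-value (λ b → cong (carry a b c *ᶻ_) (cong₂ _*ᶻ_ (r≡ a) (s≡ b))))

    ∣*ᴿ∣≤ : ∀ (x y : R) {X Y} → (∀ a → ∣ x a ∣ ≤ X) → (∀ a → ∣ y a ∣ ≤ Y) → ∀ c → ∣ (x *ᴿ y) c ∣ ≤ K * (K * (X * Y))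
    ∣*ᴿ∣≤ x y {X} {Y} x≤ y≤ c = ∣∑∣≤ {K} _ (λ a → ∣∑∣≤ {K} _ (λ b → begin
      ∣ carry a b c *ᶻ (x a *ᶻ y b) ∣  ≡⟨ trans (ℤₚ.abs-* (carry a b c) _) (cong (∣ carry a b c ∣ *_) (ℤₚ.abs-* (x a) (y b))) ⟩
      ∣ carry a b c ∣ * (∣ x a ∣ * ∣ y b ∣)  ≤⟨ *-mono-≤ (∣indicator∣≤1 ((toℕ a + toℕ b) % K ≟ toℕ c)) (*-mono-≤ (x≤ a) (y≤ b)) ⟩
      1 * (X * Y)  ≡⟨ *-identityˡ (X * Y) ⟩
      X * Y  ∎))
      where open ≤-Reasoning

    flatten : ∀ {X : Set} t → (Fin t → Fin K → X) → Fin (t * K) → X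
    flatten t es i = uncurry es (remQuot {t} K i)

    fillTuples : Arr → Reg → (t : ℕ) → (Fin t → Tuple) → Program
    fillTuples A cnt t es = fill A cnt (t * K) (flatten t es)

    module TupleExecution (W : ℕ) (2≤W : 2 ≤ W) where

      open FillExecution W 2≤W public

      record TuplesFilled (A : Arr) (τ : ℕ) (s₀ : State) (L : ℕ) (G : ℕ → R) (s : State) : Set where
        field
          frame : Frame A τ s₀ s
          top≡  : reg s topReg ≡ ℤ.+ (τ + L * K)
          block : Block s A τ L G

      -- Iteration q writes the t tuples at q * t + y. The postcondition re-indexes them by p, with
      -- q = p / t and y = p mod t, as in the definition of `layer`.
      exec-fillTuples : ∀ A τ s₀ (cnt : Reg) → cnt ≢ loopReg → cnt ≢ topReg → ∀ N t {{_ : NonZero t}} (es : Fin t → Tuple)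
        (G : ℕ → R) → reg s₀ cnt ≡ ℤ.+ N → N ≤ W → τ + N * t * K ≤ W → (∀ p a → ∣ G p a ∣ ≤ W) →
        (∀ q → q < N → ∀ s → Frame A τ s₀ s → reg s loopReg ≡ ℤ.+ q → ∀ y a → ⟦ es y a ⟧ s ≡ G (q * t + toℕ y) a) →
        Bounded s₀ → reg s₀ topReg ≡ ℤ.+ τ →
        Exec (fillTuples A cnt t es) s₀ (TuplesFilled A τ s₀ (N * t) G) (fillCost cnt (t * K) (flatten t es) N)
      exec-fillTuples A τ s₀ cnt cnt≢q cnt≢t N t es G cnt≡ N≤W top≤W G≤W sem b top≡ = exec-weaken ≤-refl toTuples
        (exec-fill A τ s₀ cnt cnt≢q cnt≢t N (t * K) (flatten t es) (λ q → flatten t (λ y → G (q * t + toℕ y))) cnt≡ N≤W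
          (subst (λ z → τ + z ≤ W) (*-assoc N t K) top≤W) (λ q i → G≤W _ _) (λ q q<N s φ q≡ i → sem q q<N s φ q≡ _ _) b top≡)
        where
        toTuples : ∀ {s} → Filled A τ s₀ N (t * K) (λ q → flatten t (λ y → G (q * t + toℕ y))) s → TuplesFilled A τ s₀ (N * t) G s
        toTuples {s} filled = record
          { frame = Filled.frame filled
          ; top≡  = trans (Filled.top≡ filled) (cong (λ z → ℤ.+ (τ + z)) (sym (*-assoc N t K)))
          ; block = λ p p<Nt a → let q = p / t ; y = p mod t in begin
              arr s A (τ + (p * K + toℕ a))
                ≡⟨ cong (λ z → arr s A (τ + z)) (position p a) ⟩
              arr s A (τ + (q * (t * K) + toℕ (combine y a)))
                ≡⟨ Filled.cells filled q (quotient-bound p p<Nt) (combine y a) ⟩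
              flatten t (λ y → G (q * t + toℕ y)) (combine y a)
                ≡⟨ cong (uncurry (λ y → G (q * t + toℕ y))) (remQuot-combine y a) ⟩
              G (q * t + toℕ y) a
                ≡⟨ cong (λ z → G z a) (sym (decompose p)) ⟩
              G p a ∎
          }
          where
          open ≡-Reasoning
          decompose : ∀ p → p ≡ p / t * t + toℕ (p mod t)
          decompose p = trans (m≡m%n+[m/n]*n p t) (trans (+-comm (p % t) _) (cong (p / t * t +_) (sym (toℕ-fromℕ< (m%n<n p t)))))
          position : ∀ p a → p * K + toℕ a ≡ p / t * (t * K) + toℕ (combine (p mod t) a)
          position p a = begin
            p * K + toℕ a  ≡⟨ cong (λ z → z * K + toℕ a) (decompose p) ⟩
            (p / t * t + toℕ (p mod t)) * K + toℕ a  ≡⟨ lemma (p / t) t (toℕ (p mod t)) K (toℕ a) ⟩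
            p / t * (t * K) + (K * toℕ (p mod t) + toℕ a)  ≡⟨ cong (p / t * (t * K) +_) (toℕ-combine (p mod t) a) ⟨
            p / t * (t * K) + toℕ (combine (p mod t) a)  ∎
            where
            lemma : ∀ q t y K a → (q * t + y) * K + a ≡ q * (t * K) + (K * y + a)
            lemma = solve-∀
          quotient-bound : ∀ p → p < N * t → p / t < N
          quotient-bound p p<Nt = *-cancelʳ-< t (p / t) N (≤-<-trans (m/n*n≤m p t) p<Nt)

  module Transform (K : ℕ) {{K≢0 : NonZero K}} (v : ℕ → ℤ) (per : CyclicGroupRing.Periodic K v)
    (t s : ℕ) {{t≢0 : NonZero t}} {{s≢0 : NonZero s}} (M : Fin t → Fin s → CyclicGroupRing.R K) where

    open CyclicGroupRing K
    open TupleBlocks K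

    𝓢 : CommutativeSemiring _ _
    𝓢 = Quotient.commutativeSemiring v per

    positionE : Fin s → Expr
    positionE u = bin plus (bin times (const (ℤ.+ toℕ u)) (var strideReg)) (var loopReg)

    layerE : Arr → Fin t → Tuple
    layerE A y a = sumE {s} (λ u → mulE (λ c → const (M y u c)) (cellE A offsetReg (positionE u)) a)

    -- The new block is written directly behind the old one in the same array, so the old one stays
    -- readable. `bufferReg` remembers where the new block begins until it becomes the current one.
    layerProgram : Arr → Program
    layerProgram A =
      assign strideReg (bin quot (var lengthReg) (const (ℤ.+ s))) ⨟
      assign bufferReg (var topReg) ⨟
      fillTuples A strideReg t (layerE A) ⨟
      assign offsetReg (var bufferReg) ⨟
      assign lengthReg (bin times (var strideReg) (const (ℤ.+ t)))

    transform : Arr → Program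
    transform A = assign countReg (var nReg) ⨟
      while>0 var countReg loop (layerProgram A ⨟ assign countReg (decrement countReg))

    strideE lengthE : Expr
    strideE = bin quot (var lengthReg) (const (ℤ.+ s))
    lengthE = bin times (var strideReg) (const (ℤ.+ t))

    layerCost : Arr → ℕ → ℕ
    layerCost A Q = assignCost strideE + (assignCost (var topReg) +
      (fillCost strideReg (t * K) (flatten t (layerE A)) Q + (assignCost (var bufferReg) + assignCost lengthE)))

    roundCost : Arr → ℕ → ℕ
    roundCost A S = costFactor (var countReg) + (layerCost A S + assignCost (decrement countReg))

    transformCost : Arr → ℕ → ℕ → ℕ
    transformCost A n S = assignCost (var nReg) + (n * suc (roundCost A S) + suc (costFactor (var countReg)))

    layer-component : ∀ Q F p a → layer 𝓢 M Q F p a ≡ sum {s} (λ u → (M (p mod t) u *ᴿ F (toℕ u * Q + p / t)) a)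
    layer-component Q F p a = ∑-component {s} (λ u → (M (p mod t) u *ᴿ F (toℕ u * Q + p / t)))
      where
      open import Algebra.Properties.Semiring.Sum (CommutativeSemiring.semiring 𝓢) using () renaming (sum to ∑ᴿ)
      ∑-component : ∀ {n} (r : Fin n → R) → ∑ᴿ r a ≡ sum (λ u → r u a)
      ∑-component {zero}  r = refl
      ∑-component {suc n} r = cong (r zero a +ᶻ_) (∑-component (λ i → r (suc i)))

    module _ (μ : ℕ) (M≤μ : ∀ y u a → ∣ M y u a ∣ ≤ μ) where

      -- A layer adds s ring products, each component of which has K * K terms of size at most μ
      -- times the previous bound. A constant factor per layer means O(n) extra bits after n layers;
      -- the successor keeps it nonzero.
      growth : ℕ
      growth = suc (s * (K * (K * μ)))

      ∣layer∣≤ : ∀ Q F {B} → (∀ p a → ∣ F p a ∣ ≤ B) → ∀ p a → ∣ layer 𝓢 M Q F p a ∣ ≤ growth * B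
      ∣layer∣≤ Q F {B} F≤B p a = begin
        ∣ layer 𝓢 M Q F p a ∣  ≡⟨ cong ∣_∣ (layer-component Q F p a) ⟩
        ∣ sum {s} (λ u → (M (p mod t) u *ᴿ F (toℕ u * Q + p / t)) a) ∣
          ≤⟨ ∣∑∣≤ {s} _ (λ u → ∣*ᴿ∣≤ (M (p mod t) u) (F _) (M≤μ (p mod t) u) (F≤B _) a) ⟩
        s * (K * (K * (μ * B)))  ≡⟨ lemma s K μ B ⟩
        s * (K * (K * μ)) * B  ≤⟨ *-monoˡ-≤ B (n≤1+n (s * (K * (K * μ)))) ⟩
        growth * B  ∎
        where
        open ≤-Reasoning
        lemma : ∀ s K μ B → s * (K * (K * (μ * B))) ≡ s * (K * (K * μ)) * B
        lemma = solve-∀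

      ∣yates∣≤ : ∀ r N F {B} → (∀ p a → ∣ F p a ∣ ≤ B) → ∀ p a → ∣ yates 𝓢 M r N F p a ∣ ≤ growth ^ r * B
      ∣yates∣≤ zero    N F {B} F≤B p a = ≤-trans (F≤B p a) (≤-reflexive (sym (*-identityˡ B)))
      ∣yates∣≤ (suc r) N F {B} F≤B p a = ≤-trans
        (∣yates∣≤ r (N * t) (layer 𝓢 M (s ^ r * N) F) (∣layer∣≤ (s ^ r * N) F F≤B) p a)
        (≤-reflexive (lemma growth (growth ^ r) B))
        where
        lemma : ∀ g x B → x * (g * B) ≡ (g * x) * B
        lemma = solve-∀

      module TransformExecution (W : ℕ) (2≤W : 2 ≤ W) where

        open TupleExecution W 2≤W

        exec-layer : ∀ A o Q F σ → o + s * Q * K + Q * t * K ≤ W → Q * t ≤ W → (∀ p a → ∣ layer 𝓢 M Q F p a ∣ ≤ W) →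
          Bounded σ → Ready A o (s * Q) F σ →
          Exec (layerProgram A) σ (λ σ′ → Ready A (o + s * Q * K) (Q * t) (layer 𝓢 M Q F) σ′ × Preserved A σ σ′ × reg σ′ countReg ≡ reg σ countReg)
            (layerCost A Q)
        exec-layer A o Q F σ top≤W Qt≤W layer≤W b ready =
          exec-seq (exec-assign {Q = _≡ σ₁} strideReg strideE {ℤ.+ Q} b stride-value Q≤W refl) (λ { b₁ refl →
          exec-seq (exec-assign {Q = _≡ σ₂} bufferReg (var topReg) {ℤ.+ τ} b₁ top≡ τ≤W refl) (λ { b₂ refl →
          exec-seq (exec-fillTuples A τ σ₂ strideReg (λ ()) (λ ()) Q t (layerE A) (layer 𝓢 M Q F) refl Q≤W top≤W layer≤W value b₂ top≡)
          (λ {σ₃} b₃ filled → let module T = TuplesFilled filled in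
          exec-seq (exec-assign {Q = _≡ setReg offsetReg (ℤ.+ τ) σ₃} offsetReg (var bufferReg) {ℤ.+ τ} b₃ (regs T.frame bufferReg (λ ()) (λ ())) τ≤W refl) (λ { b₄ refl →
          exec-assign lengthReg lengthE {ℤ.+ (Q * t)} b₄
            (trans (cong (_*ᶻ ℤ.+ t) (regs T.frame strideReg (λ ()) (λ ()))) (sym (ℤₚ.pos-* Q t))) Qt≤W
            ( record { offset≡ = refl ; length≡ = refl ; top≡ = T.top≡ ; block = T.block }
            , record { params = λ r r<4 → unchanged T.frame r r<4 ; others = others-kept T.frame }
            , regs T.frame countReg (λ ()) (λ ())) }) ) }) })
          where
          open Ready ready
          τ = o + s * Q * K
          σ₁ σ₂ : State
          σ₁ = setReg strideReg (ℤ.+ Q) σ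
          σ₂ = setReg bufferReg (ℤ.+ τ) σ₁
          Q≤W : Q ≤ W
          Q≤W = ≤-trans (m≤m*n Q t) Qt≤W
          τ≤W : τ ≤ W
          τ≤W = ≤-trans (m≤m+n τ (Q * t * K)) top≤W
          stride-value : ⟦ strideE ⟧ σ ≡ ℤ.+ Q
          stride-value = trans (cong (_÷ (ℤ.+ s)) length≡)
            (trans (+÷+ (s * Q) s) (cong ℤ.+_ (trans (cong (_/ s) (*-comm s Q)) (m*n/n≡m Q s))))
          others-kept : ∀ {σ₃} → Frame A τ σ₂ σ₃ → ∀ B → B ≢ A → ∀ i → arr σ₃ B i ≡ arr σ B i
          others-kept φ B B≢A i = Frame.others φ B B≢A i
          unchanged : ∀ {σ₃} → Frame A τ σ₂ σ₃ → ∀ r → r < 4 →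
            reg (setReg lengthReg (ℤ.+ (Q * t)) (setReg offsetReg (ℤ.+ τ) σ₃)) r ≡ reg σ r
          unchanged φ 0 _ = regs φ 0 (λ ()) (λ ())
          unchanged φ 1 _ = regs φ 1 (λ ()) (λ ())
          unchanged φ 2 _ = regs φ 2 (λ ()) (λ ())
          unchanged φ 3 _ = regs φ 3 (λ ()) (λ ())
          unchanged φ (suc (suc (suc (suc r)))) (s≤s (s≤s (s≤s (s≤s ()))))
          value : ∀ q → q < Q → ∀ σ₃ → Frame A τ σ₂ σ₃ → reg σ₃ loopReg ≡ ℤ.+ q →
            ∀ y a → ⟦ layerE A y a ⟧ σ₃ ≡ layer 𝓢 M Q F (q * t + toℕ y) a
          value q q<Q σ₃ φ q≡ y a = trans
            (sumE-value {s} (λ u → mulE-value (λ c → const (M y u c)) (cellE A offsetReg (positionE u)) {M y u} {F (toℕ u * Q + q)} {σ₃} (λ _ → refl) (cell u) a))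
            (trans (∑-cong {s} (λ u → cong₂ (λ y′ q′ → (M y′ u *ᴿ F (toℕ u * Q + q′)) a) (sym ([q*t+y]mod-t q y)) (sym ([q*t+y]/t q y))))
                   (sym (layer-component Q F (q * t + toℕ y) a)))
            where
            cell : ∀ u c → ⟦ cellE A offsetReg (positionE u) c ⟧ σ₃ ≡ F (toℕ u * Q + q) c
            cell u c = trans
              (cellE-value A offsetReg (positionE u) {σ₃} {o} {toℕ u * Q + q} c (trans (regs φ offsetReg (λ ()) (λ ())) offset≡)
                (cong₂ _+ᶻ_ (trans (cong (ℤ.+ toℕ u *ᶻ_) (regs φ strideReg (λ ()) (λ ()))) (sym (ℤₚ.pos-* (toℕ u) Q))) q≡))
              -- The cell lies in the old block, below τ, so this layer has not overwritten it.
              (trans (below φ _ inside) (block (toℕ u * Q + q) position<L c))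
              where
              position<L : toℕ u * Q + q < s * Q
              position<L = begin-strict
                toℕ u * Q + q  <⟨ +-monoʳ-< (toℕ u * Q) q<Q ⟩
                toℕ u * Q + Q  ≡⟨ +-comm (toℕ u * Q) Q ⟩
                suc (toℕ u) * Q  ≤⟨ *-monoˡ-≤ Q (toℕ<n u) ⟩
                s * Q  ∎
                where open ≤-Reasoning
              inside : o + ((toℕ u * Q + q) * K + toℕ c) < τ
              inside = +-monoʳ-< o (begin-strict
                (toℕ u * Q + q) * K + toℕ c  <⟨ +-monoʳ-< ((toℕ u * Q + q) * K) (toℕ<n c) ⟩
                (toℕ u * Q + q) * K + K  ≡⟨ +-comm ((toℕ u * Q + q) * K) K ⟩
                suc (toℕ u * Q + q) * K  ≤⟨ *-monoˡ-≤ K position<L ⟩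
                s * Q * K  ∎)
                where open ≤-Reasoning

        layerCost-mono : ∀ A {Q S} → Q ≤ S → layerCost A Q ≤ layerCost A S
        layerCost-mono A Q≤S = +-monoʳ-≤ (assignCost strideE) (+-monoʳ-≤ (assignCost (var topReg)) (+-monoˡ-≤ _
          (+-monoʳ-≤ (assignCost (const 0ℤ)) (+-monoˡ-≤ _ (*-monoˡ-≤ (suc (iterationCost strideReg (t * K) (flatten t (layerE A)))) Q≤S)))))

        module _ (A : Arr) (m S : ℕ) (s≤m : s ≤ m) (t≤m : t ≤ m) (S≤W : S ≤ W) where

          private
            loop : Program
            loop = while>0 var countReg loop (layerProgram A ⨟ assign countReg (decrement countReg))

          Transformed : State → ℕ → (ℕ → R) → State → Set
          Transformed σ L F σ′ = (∃[ o ] Ready A o L F σ′) × Preserved A σ σ′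

          -- N counts the values of the transformed coordinates and s ^ r those of the remaining
          -- ones. As s and t are at most m, the invariant N * m ^ r ≤ S keeps every intermediate
          -- block within S. The other two bounds reserve memory for r more blocks and room for r
          -- more factors `growth`.
          exec-layers : ∀ r N o F B {σ} → N * m ^ r ≤ S → o + s ^ r * N * K + r * (S * K) ≤ W →
            (∀ p a → ∣ F p a ∣ ≤ B) → growth ^ r * B ≤ W →
            Bounded σ → reg σ countReg ≡ ℤ.+ r → Ready A o (s ^ r * N) F σ →
            Exec loop σ (Transformed σ (N * t ^ r) (yates 𝓢 M r N F)) (r * suc (roundCost A S) + suc (costFactor (var countReg)))
          exec-layers zero N o F B {σ} N≤S top≤W F≤B B≤W b r≡ ready = exec-exit b r≡
            ((o , subst (λ L → Ready A o L F σ) (trans (+-identityʳ N) (sym (*-identityʳ N))) ready)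
            , record { params = λ _ _ → refl ; others = λ _ _ _ → refl })
          exec-layers (suc r) N o F B {σ} N≤S top≤W F≤B B≤W b r≡ ready = exec-weaken
            (≤-reflexive (cong suc (sym (+-assoc (roundCost A S) (r * suc (roundCost A S)) _)))) (λ x → x)
            (exec-loop r b r≡
              (exec-seq (exec-weaken (layerCost-mono A Q≤S) (λ x → x)
                  (exec-layer A o Q F σ layer-top (≤-trans Qt≤S S≤W)
                    (λ p a → ≤-trans (∣layer∣≤ Q F F≤B p a) (≤-trans (m≤n*m (growth * B) (growth ^ r) {{m^n≢0 growth r}}) (subst (_≤ W) growth-step B≤W)))
                    b (subst (λ L → Ready A o L F σ) (*-assoc s (s ^ r) N) ready)))
                (λ {σ₁} b₁ (ready₁ , preserved₁ , count₁) →
                  exec-assign {Q = λ σ₂ → Ready A τ (Q * t) F′ σ₂ × Preserved A σ σ₂ × reg σ₂ countReg ≡ ℤ.+ r}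
                    countReg (decrement countReg) b₁
                    (decrement-value {σ₁} countReg r (trans count₁ r≡)) r≤W (count-set ready₁ , count-kept preserved₁ , refl)))
              (λ {σ₂} b₂ (ready₂ , preserved₂ , count₂) → exec-weaken ≤-refl
                (λ {σ₃} (ready₃ , preserved₃) → subst (λ L → ∃[ o′ ] Ready A o′ L (yates 𝓢 M (suc r) N F) σ₃) (*-assoc N t (t ^ r)) ready₃
                  , preserved-trans preserved₂ preserved₃)
                (exec-layers r (N * t) τ F′ (growth * B) Ntm≤S next-top (∣layer∣≤ Q F F≤B) (subst (_≤ W) growth-step B≤W)
                  b₂ count₂ (subst (λ L → Ready A τ L F′ σ₂) (*-assoc (s ^ r) N t) ready₂))))
            where
            Q τ : ℕ
            Q = s ^ r * N
            τ = o + s * Q * K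
            F′ : ℕ → R
            F′ = layer 𝓢 M Q F
            Ntm≤S : N * t * m ^ r ≤ S
            Ntm≤S = ≤-trans (≤-trans (≤-reflexive (*-assoc N t (m ^ r))) (*-monoʳ-≤ N (*-monoˡ-≤ (m ^ r) t≤m))) N≤S
            Qt≤S : Q * t ≤ S
            Qt≤S = begin
              s ^ r * N * t  ≡⟨ trans (*-assoc (s ^ r) N t) (*-comm (s ^ r) (N * t)) ⟩
              N * t * s ^ r  ≤⟨ *-monoʳ-≤ (N * t) (^-monoˡ-≤ r s≤m) ⟩
              N * t * m ^ r  ≤⟨ Ntm≤S ⟩
              S  ∎
              where open ≤-Reasoning
            Q≤S : Q ≤ S
            Q≤S = ≤-trans (m≤m*n Q t) Qt≤S
            top-step : τ + (S * K + r * (S * K)) ≤ W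
            top-step = subst (λ z → o + z * K + (S * K + r * (S * K)) ≤ W) (*-assoc s (s ^ r) N) top≤W
            layer-top : τ + Q * t * K ≤ W
            layer-top = ≤-trans (+-monoʳ-≤ τ (≤-trans (*-monoˡ-≤ K Qt≤S) (m≤m+n (S * K) (r * (S * K))))) top-step
            next-top : τ + s ^ r * (N * t) * K + r * (S * K) ≤ W
            next-top = begin
              τ + s ^ r * (N * t) * K + r * (S * K)  ≡⟨ cong (λ z → τ + z * K + r * (S * K)) (*-assoc (s ^ r) N t) ⟨
              τ + Q * t * K + r * (S * K)  ≤⟨ +-monoˡ-≤ (r * (S * K)) (+-monoʳ-≤ τ (*-monoˡ-≤ K Qt≤S)) ⟩
              τ + S * K + r * (S * K)  ≡⟨ +-assoc τ (S * K) (r * (S * K)) ⟩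
              τ + (S * K + r * (S * K))  ≤⟨ top-step ⟩
              W  ∎
              where open ≤-Reasoning
            growth-step : growth ^ suc r * B ≡ growth ^ r * (growth * B)
            growth-step = lemma growth (growth ^ r) B
              where
              lemma : ∀ g x B → (g * x) * B ≡ x * (g * B)
              lemma = solve-∀
            r≤W : r ≤ W
            r≤W = ≤-trans (n≤1+n r) (subst (λ z → ∣ z ∣ ≤ W) r≡ (Bounded.regs b countReg))
            count-set : ∀ {σ₁ z} → Ready A τ (Q * t) F′ σ₁ → Ready A τ (Q * t) F′ (setReg countReg z σ₁)
            count-set ready₁ = record { offset≡ = R.offset≡ ; length≡ = R.length≡ ; top≡ = R.top≡ ; block = R.block }
              where module R = Ready ready₁
            count-kept : ∀ {σ₁ z} → Preserved A σ σ₁ → Preserved A σ (setReg countReg z σ₁)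
            count-kept {σ₁} p = record
              { params = λ r r<4 → trans (update-other (reg σ₁) countReg _ (<4⇒≢ (s≤s (s≤s (s≤s (s≤s z≤n)))) r<4)) (params p r r<4)
              ; others = others p }

          exec-transform : ∀ n o F B {σ} → m ^ n ≤ S → o + s ^ n * K + n * (S * K) ≤ W →
            (∀ p a → ∣ F p a ∣ ≤ B) → growth ^ n * B ≤ W →
            Bounded σ → reg σ nReg ≡ ℤ.+ n → Ready A o (s ^ n) F σ →
            Exec (transform A) σ (Transformed σ (t ^ n) (yates 𝓢 M n 1 F)) (transformCost A n S)
          exec-transform n o F B {σ} mⁿ≤S top≤W F≤B B≤W b n≡ ready = exec-seq
            (exec-assign {Q = _≡ setReg countReg (ℤ.+ n) σ} countReg (var nReg) b n≡ (subst (λ z → ∣ z ∣ ≤ W) n≡ (Bounded.regs b nReg)) refl)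
            (λ { b₁ refl → exec-weaken ≤-refl
              (λ {σ′} (ready′ , preserved) → subst (λ L → ∃[ o′ ] Ready A o′ L (yates 𝓢 M n 1 F) σ′) (*-identityˡ (t ^ n)) ready′
                , record { params = λ r r<4 → trans (params preserved r r<4) (update-other (reg σ) countReg _ (<4⇒≢ (s≤s (s≤s (s≤s (s≤s z≤n)))) r<4))
                         ; others = others preserved })
              (exec-layers n 1 o F B (subst (_≤ S) (sym (*-identityˡ (m ^ n))) mⁿ≤S)
                (subst (λ z → o + z * K + n * (S * K) ≤ W) (sym (*-identityʳ (s ^ n))) top≤W) F≤B B≤W b₁ refl
                (subst (λ L → Ready A o L F (setReg countReg (ℤ.+ n) σ)) (sym (*-identityʳ (s ^ n))) (record { offset≡ = R.offset≡ ; length≡ = R.length≡ ; top≡ = R.top≡ ; block = R.block }))) })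
            where module R = Ready ready

-- The complete program and its execution

module Implementation where

  open IntegerSums
  open GroupRing
  open YatesTransform
  open Machine
  open FillLoops
  open RankDecomposition
  open ResultExtraction
  open TransformProgram
  open import Data.Fin as Fin using (Fin; toℕ)
  open import Data.Integer as ℤ using (ℤ; 0ℤ; ∣_∣) renaming (_*_ to _*ᶻ_)
  import Data.Integer.Properties as ℤₚ
  open import Data.List using (List)
  open import Data.Nat
  open import Data.Nat.Divisibility using (_∣_)
  open import Data.Nat.Properties
  open import Data.Product using (∃-syntax; _×_; _,_; proj₁; proj₂)
  open import Data.Sum using (inj₁; inj₂)
  open import Function.Bundles using (_↔_)
  open import Relation.Binary.PropositionalEquality

  bounded : ∀ {n} (φ : Fin n → ℕ) → ∃[ B ] ∀ i → φ i ≤ B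
  bounded {zero}  φ = 0 , λ ()
  bounded {suc n} φ = let (B , h) = bounded (λ i → φ (Fin.suc i)) in
    φ Fin.zero + B , λ { Fin.zero → m≤m+n _ B ; (Fin.suc i) → ≤-trans (h i) (m≤n+m B _) }

  bounded₃ : ∀ {l m n} (φ : Fin l → Fin m → Fin n → ℤ) → ∃[ B ] ∀ i j k → ∣ φ i j k ∣ ≤ B
  bounded₃ φ = proj₁ B , λ i j k → ≤-trans (proj₂ (B₂ i j) k) (≤-trans (proj₂ (B₁ i) j) (proj₂ B i))
    where
    B₂ : ∀ i j → ∃[ b ] ∀ k → ∣ φ i j k ∣ ≤ b
    B₂ i j = bounded (λ k → ∣ φ i j k ∣)
    B₁ : ∀ i → ∃[ b ] ∀ j → proj₁ (B₂ i j) ≤ b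
    B₁ i = bounded (λ j → proj₁ (B₂ i j))
    B : ∃[ b ] ∀ i → proj₁ (B₁ i) ≤ b
    B = bounded (λ i → proj₁ (B₁ i))

  module Algorithms {D : Set} {d : ℕ} (enum : D ↔ Fin d) (f : D → D → D) (P : CyclicPartition f)
    (K : ℕ) {{K≢0 : NonZero K}} (k∣K : ∀ i → NonZero (CyclicPartition.k P i) → CyclicPartition.k P i ∣ K)
    {{c≢0 : NonZero (cost P)}} {{d≢0 : NonZero d}} where

    open CyclicGroupRing K
    open Decomposition enum f P K k∣K
    open Extraction enum f P K k∣K
    open TupleBlocks K
    private
      c : ℕ
      c = cost P
      open PrimitiveWeight using (periodic)
      module Tα = Transform K v (periodic K) c d α
      module Tβ = Transform K v (periodic K) c d β
      module Tγ = Transform K v (periodic K) d c γ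
      μα = bounded₃ α
      μβ = bounded₃ β
      μγ = bounded₃ γ
      weights = bounded {K} (λ a → ∣ v (toℕ a + 0) ∣)

    weightBound : ℕ
    weightBound = proj₁ weights

    sizeStep scaleStep : Expr
    sizeStep  = bin times (var sizeReg) (const (ℤ.+ d))
    scaleStep = bin times (var scaleReg) (const (ℤ.+ K))

    -- The input supplies only n; d ^ n is the length of the value lists and K ^ n the final
    -- divisor.
    powersRound powers : Program
    powersRound = assign sizeReg sizeStep ⨟ assign scaleReg scaleStep ⨟ assign countReg (decrement countReg)
    powers = assign sizeReg (const (ℤ.+ 1)) ⨟ assign scaleReg (const (ℤ.+ 1)) ⨟ assign countReg (var nReg) ⨟
      while>0 var countReg loop powersRound

    embedE : Arr → Tuple
    embedE src a = bin times (read src (var loopReg)) (const (monomial 0 a))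

    productE : Tuple
    productE = mulE (cellE 3 savedReg (var loopReg)) (cellE 4 offsetReg (var loopReg))

    -- `extract` unrolled, with the values of v as constants, then division by K ^ n, which is exact
    -- by `extract-correct`.
    quotientE : Expr
    quotientE = bin quot (sumE {K} (λ a → bin times (cellE 5 offsetReg (var loopReg) a) (const (v (toℕ a + 0))))) (var scaleReg)

    loadInto : Arr → Arr → Program
    loadInto A src = assign topReg (const 0ℤ) ⨟ assign offsetReg (const 0ℤ) ⨟ assign lengthReg (var sizeReg) ⨟
      fillTuples A sizeReg 1 (λ _ → embedE src)

    multiply : Program
    multiply = assign topReg (const 0ℤ) ⨟ fillTuples 5 lengthReg 1 (λ _ → productE) ⨟ assign offsetReg (const 0ℤ)

    finish : Program
    finish = assign topReg (const 0ℤ) ⨟ fill 2 lengthReg 1 (λ _ → quotientE)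

    -- Arrays 3 and 4 receive the transforms of the two inputs, 5 the pointwise product and its
    -- back-transform, and 2 the output. The position of the first transform is saved because the
    -- second `loadInto` resets `offsetReg`.
    program : Program
    program = powers ⨟ loadInto 3 0 ⨟ Tα.transform 3 ⨟ assign savedReg (var offsetReg) ⨟
      loadInto 4 1 ⨟ Tβ.transform 4 ⨟ multiply ⨟ Tγ.transform 5 ⨟ finish

    powersRoundCost : ℕ
    powersRoundCost = costFactor (var countReg) + (assignCost sizeStep + (assignCost scaleStep + assignCost (decrement countReg)))

    powersCost : ℕ → ℕ
    powersCost n = assignCost (const (ℤ.+ 1)) + (assignCost (const (ℤ.+ 1)) + (assignCost (var nReg) +
      (n * suc powersRoundCost + suc (costFactor (var countReg)))))

    loadCost : Arr → ℕ → ℕ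
    loadCost src N = assignCost (const 0ℤ) + (assignCost (const 0ℤ) + (assignCost (var sizeReg) +
      fillCost sizeReg (1 * K) (flatten 1 (λ _ → embedE src)) N))

    multiplyCost : ℕ → ℕ
    multiplyCost N = assignCost (const 0ℤ) + (fillCost lengthReg (1 * K) (flatten 1 (λ _ → productE)) N + assignCost (const 0ℤ))

    finishCost : ℕ → ℕ
    finishCost N = assignCost (const 0ℤ) + fillCost lengthReg 1 (λ _ → quotientE) N

    total : ℕ → ℕ
    total n = c ^ n + d ^ n

    programCost : ℕ → ℕ
    programCost n = powersCost n + (loadCost 0 (d ^ n) + (Tα.transformCost 3 n (total n) + (assignCost (var offsetReg) +
      (loadCost 1 (d ^ n) + (Tβ.transformCost 4 n (total n) + (multiplyCost (c ^ n) +
      (Tγ.transformCost 5 n (total n) + finishCost (d ^ n))))))))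

    growthα growthβ growthγ : ℕ
    growthα = Tα.growth (proj₁ μα) (proj₂ μα)
    growthβ = Tβ.growth (proj₁ μβ) (proj₂ μβ)
    growthγ = Tγ.growth (proj₁ μγ) (proj₂ μγ)

    boundα boundβ boundProduct boundγ boundFinal memory : ℕ → ℕ → ℕ
    boundα n X       = growthα ^ n * X
    boundβ n X       = growthβ ^ n * X
    boundProduct n X = K * (K * (boundα n X * boundβ n X))
    boundγ n X       = growthγ ^ n * boundProduct n X
    -- The successor is the one in `∣÷∣≤`.
    boundFinal n X   = suc (K * (boundγ n X * weightBound))
    -- The initial block and one more per layer, each of at most `total n` tuples.
    memory n X       = suc n * (total n * K)

    -- A sum of all bounds dominates each of them, and its logarithm splits by subadditivity. The
    -- leading 2 meets the requirement 2 ≤ W of the cost calculus.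
    limit : ℕ → ℕ → ℕ
    limit n X = 2 + (n + (memory n X + (K ^ n + (boundα n X + (boundβ n X + (boundγ n X + boundFinal n X))))))

    record Fits (n X W : ℕ) : Set where
      field
        2≤W      : 2 ≤ W
        n≤W      : n ≤ W
        memory≤W : memory n X ≤ W
        Kⁿ≤W     : K ^ n ≤ W
        α≤W      : boundα n X ≤ W
        β≤W      : boundβ n X ≤ W
        γ≤W      : boundγ n X ≤ W
        final≤W  : boundFinal n X ≤ W

    limit-fits : ∀ n X → Fits n X (limit n X)
    limit-fits n X = record
      { 2≤W = m≤m+n 2 W₀ ; n≤W = ≤-trans (m≤m+n n W₁) (m≤n+m W₀ 2)
      ; memory≤W = ≤-trans (m≤m+n (memory n X) W₂) W₁≤W ; Kⁿ≤W = ≤-trans (m≤m+n (K ^ n) W₃) W₂≤W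
      ; α≤W = ≤-trans (m≤m+n (boundα n X) W₄) W₃≤W ; β≤W = ≤-trans (m≤m+n (boundβ n X) W₅) W₄≤W
      ; γ≤W = ≤-trans (m≤m+n (boundγ n X) (boundFinal n X)) W₅≤W
      ; final≤W = ≤-trans (m≤n+m (boundFinal n X) (boundγ n X)) W₅≤W }
      where
      W₀ W₁ W₂ W₃ W₄ W₅ : ℕ
      W₅ = boundγ n X + boundFinal n X
      W₄ = boundβ n X + W₅
      W₃ = boundα n X + W₄
      W₂ = K ^ n + W₃
      W₁ = memory n X + W₂
      W₀ = n + W₁
      W₁≤W : W₁ ≤ 2 + W₀
      W₁≤W = ≤-trans (m≤n+m W₁ n) (m≤n+m W₀ 2)
      W₂≤W : W₂ ≤ 2 + W₀
      W₂≤W = ≤-trans (m≤n+m W₂ (memory n X)) W₁≤W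
      W₃≤W : W₃ ≤ 2 + W₀
      W₃≤W = ≤-trans (m≤n+m W₃ (K ^ n)) W₂≤W
      W₄≤W : W₄ ≤ 2 + W₀
      W₄≤W = ≤-trans (m≤n+m W₄ (boundα n X)) W₃≤W
      W₅≤W : W₅ ≤ 2 + W₀
      W₅≤W = ≤-trans (m≤n+m W₅ (boundβ n X)) W₄≤W

    module Run (n X W : ℕ) (fits : Fits n X W) where

      open Fits fits
      open TupleExecution W 2≤W
      private
        module Xα = Tα.TransformExecution (proj₁ μα) (proj₂ μα) W 2≤W
        module Xβ = Tβ.TransformExecution (proj₁ μβ) (proj₂ μβ) W 2≤W
        module Xγ = Tγ.TransformExecution (proj₁ μγ) (proj₂ μγ) W 2≤W

      X≤W : X ≤ W
      X≤W = ≤-trans (m≤n*m X (growthα ^ n) {{m^n≢0 growthα n}}) α≤W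
      product≤W : boundProduct n X ≤ W
      product≤W = ≤-trans (m≤n*m (boundProduct n X) (growthγ ^ n) {{m^n≢0 growthγ n}}) γ≤W

      S : ℕ
      S = total n

      cells≤W : S * K ≤ W
      cells≤W = ≤-trans (m≤m+n (S * K) (n * (S * K))) memory≤W
      S≤W : S ≤ W
      S≤W = ≤-trans (m≤m*n S K) cells≤W
      dⁿ≤S : d ^ n ≤ S
      dⁿ≤S = m≤n+m (d ^ n) (c ^ n)
      cⁿ≤S : c ^ n ≤ S
      cⁿ≤S = m≤m+n (c ^ n) (d ^ n)
      1≤W : 1 ≤ W
      1≤W = ≤-trans (s≤s z≤n) 2≤W

      -- The intermediate blocks of a transform mix factors c and d; the power of the larger one
      -- bounds them all and is itself one of the two summands of S.
      [c⊔d]ⁿ≤S : (c ⊔ d) ^ n ≤ S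
      [c⊔d]ⁿ≤S with ⊔-sel c d
      ... | inj₁ eq rewrite eq = cⁿ≤S
      ... | inj₂ eq rewrite eq = dⁿ≤S

      record Params (σ : State) : Set where
        field
          n≡     : reg σ nReg ≡ ℤ.+ n
          size≡  : reg σ sizeReg ≡ ℤ.+ (d ^ n)
          scale≡ : reg σ scaleReg ≡ ℤ.+ (K ^ n)
      open Params

      params-preserved : ∀ {A σ σ′} → Preserved A σ σ′ → Params σ → Params σ′
      params-preserved p q = record
        { n≡     = trans (params p 0 (s≤s z≤n)) (n≡ q)
        ; size≡  = trans (params p 1 (s≤s (s≤s z≤n))) (size≡ q)
        ; scale≡ = trans (params p 2 (s≤s (s≤s (s≤s z≤n)))) (scale≡ q) }

      record Powers (σ₀ : State) (x y : ℕ) (σ : State) : Set where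
        field
          same-n  : reg σ nReg ≡ reg σ₀ nReg
          size-x  : reg σ sizeReg ≡ ℤ.+ x
          scale-y : reg σ scaleReg ≡ ℤ.+ y
          arrays  : ∀ B i → arr σ B i ≡ arr σ₀ B i
      open Powers

      exec-powersLoop : ∀ σ₀ r x y {σ} → x * d ^ r ≤ W → y * K ^ r ≤ W → Bounded σ → reg σ countReg ≡ ℤ.+ r → Powers σ₀ x y σ →
        Exec (while>0 var countReg loop powersRound) σ (Powers σ₀ (x * d ^ r) (y * K ^ r)) (r * suc powersRoundCost + suc (costFactor (var countReg)))
      exec-powersLoop σ₀ zero x y x≤W y≤W b r≡ p = exec-exit b r≡ record
        { same-n = same-n p ; arrays = arrays p
        ; size-x = trans (size-x p) (cong ℤ.+_ (sym (*-identityʳ x))) ; scale-y = trans (scale-y p) (cong ℤ.+_ (sym (*-identityʳ y))) }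
      exec-powersLoop σ₀ (suc r) x y {σ} x≤W y≤W b r≡ p = exec-weaken
        (≤-reflexive (cong suc (sym (+-assoc powersRoundCost (r * suc powersRoundCost) _)))) (λ q → q)
        (exec-loop r b r≡
          (exec-seq (exec-assign {Q = _≡ σ₁} sizeReg sizeStep b (trans (cong (_*ᶻ ℤ.+ d) (size-x p)) (sym (ℤₚ.pos-* x d)))
              (≤-trans (m≤m*n (x * d) (d ^ r) {{m^n≢0 d r}}) x′≤W) refl) (λ { b₁ refl →
           exec-seq (exec-assign {Q = _≡ σ₂} scaleReg scaleStep b₁ (trans (cong (_*ᶻ ℤ.+ K) (scale-y p)) (sym (ℤₚ.pos-* y K)))
              (≤-trans (m≤m*n (y * K) (K ^ r) {{m^n≢0 K r}}) y′≤W) refl) (λ { b₂ refl →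
           exec-assign {Q = λ σ₃ → reg σ₃ countReg ≡ ℤ.+ r × Powers σ₀ (x * d) (y * K) σ₃} countReg (decrement countReg) b₂
              (decrement-value {σ₂} countReg r r≡) r≤W
              (refl , record { same-n = same-n p ; size-x = refl ; scale-y = refl ; arrays = arrays p }) }) }))
          (λ {σ₃} b₃ (r₃ , p₃) → subst₂ (λ x′ y′ → Exec (while>0 var countReg loop powersRound) σ₃ (Powers σ₀ x′ y′) (r * suc powersRoundCost + suc (costFactor (var countReg))))
            (*-assoc x d (d ^ r)) (*-assoc y K (K ^ r)) (exec-powersLoop σ₀ r (x * d) (y * K) x′≤W y′≤W b₃ r₃ p₃)))
        where
        σ₁ σ₂ : State
        σ₁ = setReg sizeReg (ℤ.+ (x * d)) σ
        σ₂ = setReg scaleReg (ℤ.+ (y * K)) σ₁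
        x′≤W : x * d * d ^ r ≤ W
        x′≤W = subst (_≤ W) (sym (*-assoc x d (d ^ r))) x≤W
        y′≤W : y * K * K ^ r ≤ W
        y′≤W = subst (_≤ W) (sym (*-assoc y K (K ^ r))) y≤W
        r≤W : r ≤ W
        r≤W = ≤-trans (n≤1+n r) (subst (λ z → ∣ z ∣ ≤ W) r≡ (Bounded.regs b countReg))

      exec-powers : ∀ {σ} → Bounded σ → reg σ nReg ≡ ℤ.+ n →
        Exec powers σ (λ σ′ → Params σ′ × (∀ B i → arr σ′ B i ≡ arr σ B i)) (powersCost n)
      exec-powers {σ} b n₀≡ =
        exec-seq (exec-assign {Q = _≡ setReg sizeReg (ℤ.+ 1) σ} sizeReg (const (ℤ.+ 1)) b refl 1≤W refl) (λ { b₁ refl →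
        exec-seq (exec-assign {Q = _≡ setReg scaleReg (ℤ.+ 1) (setReg sizeReg (ℤ.+ 1) σ)} scaleReg (const (ℤ.+ 1)) b₁ refl 1≤W refl) (λ { b₂ refl →
        exec-seq (exec-assign {Q = λ σ₃ → reg σ₃ countReg ≡ ℤ.+ n × Powers σ 1 1 σ₃} countReg (var nReg) b₂ n₀≡ n≤W
          (refl , record { same-n = refl ; size-x = refl ; scale-y = refl ; arrays = λ _ _ → refl })) (λ b₃ (r₃ , p₃) →
        exec-weaken ≤-refl
          (λ p → record { n≡ = trans (same-n p) n₀≡ ; size≡ = trans (size-x p) (cong ℤ.+_ (*-identityˡ (d ^ n)))
                        ; scale≡ = trans (scale-y p) (cong ℤ.+_ (*-identityˡ (K ^ n))) } , arrays p)
          (exec-powersLoop σ n 1 1 (≤-trans (≤-reflexive (*-identityˡ (d ^ n))) (≤-trans dⁿ≤S S≤W))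
            (≤-trans (≤-reflexive (*-identityˡ (K ^ n))) Kⁿ≤W) b₃ r₃ p₃)) }) })

      exec-fillTuple : ∀ A σ₀ (cnt : Reg) → cnt ≢ loopReg → cnt ≢ topReg → ∀ N (es : Tuple) (G : ℕ → R) →
        reg σ₀ cnt ≡ ℤ.+ N → N ≤ S → (∀ p a → ∣ G p a ∣ ≤ W) →
        (∀ q → q < N → ∀ σ → Frame A 0 σ₀ σ → reg σ loopReg ≡ ℤ.+ q → ∀ a → ⟦ es a ⟧ σ ≡ G q a) →
        Bounded σ₀ → reg σ₀ topReg ≡ 0ℤ →
        Exec (fillTuples A cnt 1 (λ _ → es)) σ₀ (TuplesFilled A 0 σ₀ N G) (fillCost cnt (1 * K) (flatten 1 (λ _ → es)) N)
      exec-fillTuple A σ₀ cnt cnt≢q cnt≢t N es G cnt≡ N≤S G≤W sem b top≡ = exec-weaken ≤-refl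
        (λ {σ} → subst (λ L → TuplesFilled A 0 σ₀ L G σ) (*-identityʳ N))
        (exec-fillTuples A 0 σ₀ cnt cnt≢q cnt≢t N 1 (λ _ → es) G cnt≡ (≤-trans N≤S S≤W)
          (≤-trans (*-monoˡ-≤ K (≤-trans (≤-reflexive (*-identityʳ N)) N≤S)) cells≤W) G≤W
          (λ { q q<N σ φ q≡ Fin.zero a → trans (sem q q<N σ φ q≡ a)
                 (cong (λ z → G z a) (sym (trans (+-identityʳ (q * 1)) (*-identityʳ q)))) }) b top≡)

      ∣embed∣≤ : ∀ z → ∣ z ∣ ≤ X → ∀ a → ∣ embed z a ∣ ≤ X
      ∣embed∣≤ z z≤X a = begin
        ∣ z *ᶻ monomial 0 a ∣  ≡⟨ ℤₚ.abs-* z (monomial 0 a) ⟩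
        ∣ z ∣ * ∣ monomial 0 a ∣  ≤⟨ *-mono-≤ z≤X (∣indicator∣≤1 (0 % K ≟ toℕ a)) ⟩
        X * 1  ≡⟨ *-identityʳ X ⟩
        X  ∎
        where open ≤-Reasoning

      exec-load : ∀ A src (φ : ℕ → ℤ) {σ} → src ≢ A → (∀ i → arr σ src i ≡ φ i) → (∀ i → ∣ φ i ∣ ≤ X) →
        Bounded σ → Params σ →
        Exec (loadInto A src) σ (λ σ′ → Ready A 0 (d ^ n) (λ p → embed (φ p)) σ′ × Preserved A σ σ′) (loadCost src (d ^ n))
      exec-load A src φ {σ} src≢A φ≡ φ≤X b p =
        exec-seq (exec-assign {Q = _≡ σ₁} topReg (const 0ℤ) b refl z≤n refl) (λ { b₁ refl →
        exec-seq (exec-assign {Q = _≡ σ₂} offsetReg (const 0ℤ) b₁ refl z≤n refl) (λ { b₂ refl →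
        exec-seq (exec-assign {Q = _≡ σ₃} lengthReg (var sizeReg) b₂ (size≡ p) (≤-trans dⁿ≤S S≤W) refl) (λ { b₃ refl →
        exec-weaken ≤-refl ready
          (exec-fillTuple A σ₃ sizeReg (λ ()) (λ ()) (d ^ n) (embedE src) (λ q → embed (φ q)) (size≡ p) dⁿ≤S
            (λ q a → ≤-trans (∣embed∣≤ (φ q) (φ≤X q) a) X≤W)
            (λ q q<N σ₄ fr q≡ a → cong (_*ᶻ monomial 0 a)
              (trans (cong (λ z → arr σ₄ src ∣ z ∣) q≡) (trans (Frame.others fr src src≢A q) (φ≡ q)))) b₃ refl) }) }) })
        where
        σ₁ σ₂ σ₃ : State
        σ₁ = setReg topReg 0ℤ σ
        σ₂ = setReg offsetReg 0ℤ σ₁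
        σ₃ = setReg lengthReg (ℤ.+ (d ^ n)) σ₂
        ready : ∀ {σ₄} → TuplesFilled A 0 σ₃ (d ^ n) (λ q → embed (φ q)) σ₄ → Ready A 0 (d ^ n) (λ q → embed (φ q)) σ₄ × Preserved A σ σ₄
        ready {σ₄} t = record { offset≡ = regs T.frame offsetReg (λ ()) (λ ()) ; length≡ = regs T.frame lengthReg (λ ()) (λ ())
                         ; top≡ = T.top≡ ; block = T.block }
                , record { params = low ; others = λ B B≢A i → Frame.others T.frame B B≢A i }
          where
          module T = TuplesFilled t
          low : ∀ r → r < 4 → reg σ₄ r ≡ reg σ r
          low 0 _ = regs T.frame 0 (λ ()) (λ ())
          low 1 _ = regs T.frame 1 (λ ()) (λ ())
          low 2 _ = regs T.frame 2 (λ ()) (λ ())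
          low 3 _ = regs T.frame 3 (λ ()) (λ ())
          low (suc (suc (suc (suc r)))) (s≤s (s≤s (s≤s (s≤s ()))))

      exec-multiply : ∀ o₁ o₂ (F G : ℕ → R) {σ} → reg σ savedReg ≡ ℤ.+ o₁ → Block σ 3 o₁ (c ^ n) F → Ready 4 o₂ (c ^ n) G σ →
        (∀ p a → ∣ F p a ∣ ≤ boundα n X) → (∀ p a → ∣ G p a ∣ ≤ boundβ n X) → Bounded σ →
        Exec multiply σ (λ σ′ → Ready 5 0 (c ^ n) (λ p → (F p *ᴿ G p)) σ′ × Preserved 5 σ σ′) (multiplyCost (c ^ n))
      exec-multiply o₁ o₂ F G {σ} saved≡ blockF readyG F≤ G≤ b =
        exec-seq (exec-assign {Q = _≡ σ₁} topReg (const 0ℤ) b refl z≤n refl) (λ { b₁ refl →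
        exec-seq (exec-fillTuple 5 σ₁ lengthReg (λ ()) (λ ()) (c ^ n) productE (λ p → (F p *ᴿ G p)) (Ready.length≡ readyG) cⁿ≤S
            (λ p a → ≤-trans (∣*ᴿ∣≤ (F p) (G p) (F≤ p) (G≤ p) a) product≤W) value b₁ refl)
          (λ {σ₂} b₂ t → let module T = TuplesFilled t in
            exec-assign offsetReg (const 0ℤ) b₂ refl z≤n
              ( record { offset≡ = refl ; length≡ = trans (regs T.frame lengthReg (λ ()) (λ ())) (Ready.length≡ readyG) ; top≡ = T.top≡ ; block = T.block }
              , record { params = low T.frame ; others = λ B B≢5 i → Frame.others T.frame B B≢5 i })) })
        where
        σ₁ : State
        σ₁ = setReg topReg 0ℤ σ
        low : ∀ {σ₂} → Frame 5 0 σ₁ σ₂ → ∀ r → r < 4 → reg (setReg offsetReg 0ℤ σ₂) r ≡ reg σ r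
        low φ 0 _ = regs φ 0 (λ ()) (λ ())
        low φ 1 _ = regs φ 1 (λ ()) (λ ())
        low φ 2 _ = regs φ 2 (λ ()) (λ ())
        low φ 3 _ = regs φ 3 (λ ()) (λ ())
        low φ (suc (suc (suc (suc r)))) (s≤s (s≤s (s≤s (s≤s ()))))
        value : ∀ q → q < c ^ n → ∀ σ₂ → Frame 5 0 σ₁ σ₂ → reg σ₂ loopReg ≡ ℤ.+ q → ∀ a → ⟦ productE a ⟧ σ₂ ≡ (F q *ᴿ G q) a
        value q q<N σ₂ φ q≡ = mulE-value (cellE 3 savedReg (var loopReg)) (cellE 4 offsetReg (var loopReg)) {F q} {G q} {σ₂}
          (λ a → trans (cellE-value 3 savedReg (var loopReg) {σ₂} {o₁} {q} a (trans (regs φ savedReg (λ ()) (λ ())) saved≡) q≡)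
            (trans (Frame.others φ 3 (λ ()) _) (blockF q q<N a)))
          (λ a → trans (cellE-value 4 offsetReg (var loopReg) {σ₂} {o₂} {q} a (trans (regs φ offsetReg (λ ()) (λ ())) (Ready.offset≡ readyG)) q≡)
            (trans (Frame.others φ 4 (λ ()) _) (Ready.block readyG q q<N a)))

      exec-finish : ∀ o (F : ℕ → R) {σ} → Ready 5 o (d ^ n) F σ → (∀ p a → ∣ F p a ∣ ≤ boundγ n X) → Params σ → Bounded σ →
        Exec finish σ (λ σ′ → ∀ q → q < d ^ n → arr σ′ 2 q ≡ extract (F q) ÷ (ℤ.+ (K ^ n))) (finishCost (d ^ n))
      exec-finish o F {σ} readyF F≤ p b =
        exec-seq (exec-assign {Q = _≡ σ₁} topReg (const 0ℤ) b refl z≤n refl) (λ { b₁ refl →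
        exec-weaken ≤-refl
          (λ {σ₂} filled q q<N → trans (cong (arr σ₂ 2) (sym (trans (+-identityʳ (q * 1)) (*-identityʳ q)))) (Filled.cells filled q q<N Fin.zero))
          (exec-fill 2 0 σ₁ lengthReg (λ ()) (λ ()) (d ^ n) 1 (λ _ → quotientE) (λ q _ → extract (F q) ÷ (ℤ.+ (K ^ n)))
            (Ready.length≡ readyF) (≤-trans dⁿ≤S S≤W) (≤-trans (≤-trans (≤-reflexive (*-identityʳ (d ^ n))) dⁿ≤S) S≤W)
            (λ q _ → ≤-trans (∣÷∣≤ (extract (F q)) (ℤ.+ (K ^ n))) (≤-trans (s≤s (∣extract∣≤ q)) final≤W))
            (λ q q<N σ₂ φ q≡ _ → cong₂ _÷_
              (sumE-value {K} (λ a → cong (_*ᶻ v (toℕ a + 0))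
                (trans (cellE-value 5 offsetReg (var loopReg) {σ₂} {o} {q} a (trans (regs φ offsetReg (λ ()) (λ ())) (Ready.offset≡ readyF)) q≡)
                  (trans (Frame.others φ 5 (λ ()) _) (Ready.block readyF q q<N a)))))
              (trans (regs φ scaleReg (λ ()) (λ ())) (scale≡ p))) b₁ refl) })
        where
        σ₁ : State
        σ₁ = setReg topReg 0ℤ σ
        ∣extract∣≤ : ∀ q → ∣ extract (F q) ∣ ≤ K * (boundγ n X * weightBound)
        ∣extract∣≤ q = ∣∑∣≤ {K} _ (λ a → ≤-trans (≤-reflexive (ℤₚ.abs-* (F q a) (v (toℕ a + 0)))) (*-mono-≤ (F≤ q a) (proj₂ weights a)))

      module _ (xs ys : List ℤ) (xs≤X : ∀ i → ∣ load xs i ∣ ≤ X) (ys≤X : ∀ i → ∣ load ys i ∣ ≤ X) where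

        Inputs : State → Set
        Inputs σ = Params σ × (∀ i → arr σ 0 i ≡ load xs i) × (∀ i → arr σ 1 i ≡ load ys i)

        inputs-preserved : ∀ {A σ σ′} → 0 ≢ A → 1 ≢ A → Preserved A σ σ′ → Inputs σ → Inputs σ′
        inputs-preserved 0≢A 1≢A p (q , h₀ , h₁) = params-preserved p q
          , (λ i → trans (others p 0 0≢A i) (h₀ i)) , (λ i → trans (others p 1 1≢A i) (h₁ i))

        G H Ĝ Ĥ : ℕ → R
        G p = embed (load xs p)
        H p = embed (load ys p)
        Ĝ = yates 𝓡 α n 1 G
        Ĥ = yates 𝓡 β n 1 H

        Saved : State → Set
        Saved σ = ∃[ o ] reg σ savedReg ≡ ℤ.+ o × Block σ 3 o (c ^ n) Ĝ

        saved-preserved : ∀ {A σ σ′} → 3 ≢ A → Preserved A σ σ′ → Saved σ → Saved σ′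
        saved-preserved 3≢A p (o , o≡ , block) = o
          , trans (params p 3 (s≤s (s≤s (s≤s (s≤s z≤n))))) o≡
          , λ i i<L a → trans (others p 3 3≢A _) (block i i<L a)

        input-bounded : Bounded (input n xs ys)
        input-bounded = record
          { regs = λ { zero → n≤W ; (suc r) → z≤n }
          ; arrs = λ { 0 i → ≤-trans (xs≤X i) X≤W ; 1 i → ≤-trans (ys≤X i) X≤W ; (suc (suc A)) i → z≤n } }

        top≤W : ∀ L → L ≤ S → 0 + L * K + n * (S * K) ≤ W
        top≤W L L≤S = ≤-trans (+-monoˡ-≤ (n * (S * K)) (*-monoˡ-≤ K L≤S)) memory≤W

        G≤X : ∀ p a → ∣ G p a ∣ ≤ X
        G≤X p = ∣embed∣≤ (load xs p) (xs≤X p)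
        H≤X : ∀ p a → ∣ H p a ∣ ≤ X
        H≤X p = ∣embed∣≤ (load ys p) (ys≤X p)
        Ĝ≤ : ∀ p a → ∣ Ĝ p a ∣ ≤ boundα n X
        Ĝ≤ = Tα.∣yates∣≤ (proj₁ μα) (proj₂ μα) n 1 G G≤X
        Ĥ≤ : ∀ p a → ∣ Ĥ p a ∣ ≤ boundβ n X
        Ĥ≤ = Tβ.∣yates∣≤ (proj₁ μβ) (proj₂ μβ) n 1 H H≤X
        product≤ : ∀ p a → ∣ product n G H p a ∣ ≤ boundProduct n X
        product≤ p = ∣*ᴿ∣≤ (Ĝ p) (Ĥ p) (Ĝ≤ p) (Ĥ≤ p)

        exec-program : Exec program (input n xs ys)
          (λ σ → ∀ q → q < d ^ n → arr σ 2 q ≡ extract (result n G H q) ÷ (ℤ.+ (K ^ n))) (programCost n)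
        exec-program =
          exec-seq (exec-weaken ≤-refl (λ (p , h) → p , (λ i → h 0 i) , (λ i → h 1 i)) (exec-powers input-bounded refl)) (λ {σ₁} b₁ i₁ →
          exec-seq (exec-weaken {Q′ = λ σ → Inputs σ × Ready 3 0 (d ^ n) G σ} ≤-refl (λ (r , p) → inputs-preserved (λ ()) (λ ()) p i₁ , r)
            (exec-load 3 0 (load xs) {σ₁} (λ ()) (proj₁ (proj₂ i₁)) xs≤X b₁ (proj₁ i₁))) (λ {σ₂} b₂ (i₂ , ready₂) →
          exec-seq (exec-weaken {Q′ = λ σ → Inputs σ × ∃[ o ] Ready 3 o (c ^ n) Ĝ σ} ≤-refl (λ (r , p) → inputs-preserved (λ ()) (λ ()) p i₂ , r)
            (Xα.exec-transform 3 (c ⊔ d) S (m≤n⊔m c d) (m≤m⊔n c d) S≤W n 0 G X [c⊔d]ⁿ≤S (top≤W (d ^ n) dⁿ≤S) G≤X α≤W b₂ (n≡ (proj₁ i₂)) ready₂))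
            (λ {σ₃} b₃ (i₃ , o₃ , ready₃) →
          exec-seq (exec-assign {Q = λ σ → Inputs σ × Saved σ} savedReg (var offsetReg) b₃ (Ready.offset≡ ready₃)
              (subst (λ z → ∣ z ∣ ≤ W) (Ready.offset≡ ready₃) (Bounded.regs b₃ offsetReg))
              ((record { n≡ = n≡ (proj₁ i₃) ; size≡ = size≡ (proj₁ i₃) ; scale≡ = scale≡ (proj₁ i₃) } , proj₂ i₃) , o₃ , refl , Ready.block ready₃))
            (λ {σ₄} b₄ (i₄ , saved₄) →
          exec-seq (exec-weaken {Q′ = λ σ → Params σ × Saved σ × Ready 4 0 (d ^ n) H σ} ≤-refl
              (λ (r , p) → params-preserved p (proj₁ i₄) , saved-preserved (λ ()) p saved₄ , r)
            (exec-load 4 1 (load ys) {σ₄} (λ ()) (proj₂ (proj₂ i₄)) ys≤X b₄ (proj₁ i₄))) (λ {σ₅} b₅ (p₅ , saved₅ , ready₅) →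
          exec-seq (exec-weaken {Q′ = λ σ → Params σ × Saved σ × ∃[ o ] Ready 4 o (c ^ n) Ĥ σ} ≤-refl
              (λ (r , p) → params-preserved p p₅ , saved-preserved (λ ()) p saved₅ , r)
            (Xβ.exec-transform 4 (c ⊔ d) S (m≤n⊔m c d) (m≤m⊔n c d) S≤W n 0 H X [c⊔d]ⁿ≤S (top≤W (d ^ n) dⁿ≤S) H≤X β≤W b₅ (n≡ p₅) ready₅))
            (λ {σ₆} b₆ (p₆ , (o₁ , o₁≡ , block₆) , o₂ , ready₆) →
          exec-seq (exec-weaken {Q′ = λ σ → Params σ × Ready 5 0 (c ^ n) (product n G H) σ} ≤-refl (λ (r , p) → params-preserved p p₆ , r)
            (exec-multiply o₁ o₂ Ĝ Ĥ {σ₆} o₁≡ block₆ ready₆ Ĝ≤ Ĥ≤ b₆)) (λ {σ₇} b₇ (p₇ , ready₇) →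
          exec-seq (exec-weaken {Q′ = λ σ → Params σ × ∃[ o ] Ready 5 o (d ^ n) (result n G H) σ} ≤-refl (λ (r , p) → params-preserved p p₇ , r)
            (Xγ.exec-transform 5 (c ⊔ d) S (m≤m⊔n c d) (m≤n⊔m c d) S≤W n 0 (product n G H) (boundProduct n X) [c⊔d]ⁿ≤S (top≤W (c ^ n) cⁿ≤S) product≤ γ≤W b₇ (n≡ p₇) ready₇))
            (λ {σ₈} b₈ (p₈ , o₈ , ready₈) →
          exec-finish o₈ (result n G H) {σ₈} ready₈ (Tγ.∣yates∣≤ (proj₁ μγ) (proj₂ μγ) n 1 (product n G H) product≤) p₈ b₈))))))))

-- Asymptotic bookkeeping

module Asymptotics where

  open import Defs using (log⁺)
  open LogarithmBounds
  open Machine using (n≤2^n)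
  open import Data.Nat
  open import Data.Nat.Properties
  open import Data.Nat.Tactic.RingSolver using (solve-∀)
  open import Data.Product using (∃-syntax; _,_)
  open import Relation.Binary.PropositionalEquality

  infix 4 _≲_

  _≲_ : (ℕ → ℕ) → (ℕ → ℕ) → Set
  φ ≲ ψ = ∃[ C ] ∀ n → φ n ≤ C * ψ n

  ≲-+ : ∀ {ψ φ χ} → φ ≲ ψ → χ ≲ ψ → (λ n → φ n + χ n) ≲ ψ
  ≲-+ {ψ} {φ} {χ} (C , φ≤) (C′ , χ≤) = C + C′ , λ n →
    subst (φ n + χ n ≤_) (sym (*-distribʳ-+ (ψ n) C C′)) (+-mono-≤ (φ≤ n) (χ≤ n))

  ≲-*ʳ : ∀ {ψ φ} k → φ ≲ ψ → (λ n → φ n * k) ≲ ψ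
  ≲-*ʳ {ψ} k (C , φ≤) = k * C , λ n → ≤-trans (*-monoˡ-≤ k (φ≤ n)) (≤-reflexive (lemma C (ψ n) k))
    where
    lemma : ∀ C x k → C * x * k ≡ k * C * x
    lemma = solve-∀

  ≲-const : ∀ {ψ} → (∀ n → 1 ≤ ψ n) → ∀ k → (λ _ → k) ≲ ψ
  ≲-const {ψ} 1≤ψ k = k , λ n → m≤m*n k (ψ n) {{>-nonZero (1≤ψ n)}}

  ≲-≤ : ∀ {ψ φ} → (∀ n → φ n ≤ ψ n) → φ ≲ ψ
  ≲-≤ {ψ} φ≤ψ = 1 , λ n → ≤-trans (φ≤ψ n) (≤-reflexive (sym (*-identityˡ (ψ n))))

  ≲-times-n : ∀ {ψ φ} → φ ≲ ψ → (λ n → n * φ n) ≲ (λ n → suc n * ψ n)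
  ≲-times-n {ψ} (C , φ≤) = C , λ n → ≤-trans (*-mono-≤ (n≤1+n n) (φ≤ n)) (≤-reflexive (lemma (suc n) C (ψ n)))
    where
    lemma : ∀ n C x → n * (C * x) ≡ C * (n * x)
    lemma = solve-∀

  ≲-weaken : ∀ {ψ φ} → φ ≲ ψ → φ ≲ (λ n → suc n * ψ n)
  ≲-weaken {ψ} (C , φ≤) = C , λ n → ≤-trans (φ≤ n) (*-monoʳ-≤ C (m≤n*m (ψ n) (suc n)))

  -- The scale `suc n * log⁺ x` dominates both n and `log⁺ x` and is a single product, so each use
  -- contributes exactly one factor of either kind to the final bound.
  record LogBounded (φ : ℕ → ℕ → ℕ) : Set where
    constructor logBounded
    field
      factor : ℕ
      bound  : ∀ n x → log⁺ (φ n x) ≤ factor * (suc n * log⁺ x)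
  open LogBounded public

  scale≥1 : ∀ n x → NonZero (suc n * log⁺ x)
  scale≥1 n x = m*n≢0 (suc n) (log⁺ x)

  log-const : ∀ k → LogBounded (λ _ _ → k)
  log-const k = logBounded (log⁺ k) (λ n x → m≤m*n (log⁺ k) (suc n * log⁺ x) {{scale≥1 n x}})

  log-combine : ∀ {φ χ} (_∙_ : ℕ → ℕ → ℕ) → (∀ a b → log⁺ (a ∙ b) ≤ log⁺ a + log⁺ b) →
    LogBounded φ → LogBounded χ → LogBounded (λ n x → φ n x ∙ χ n x)
  log-combine {φ} {χ} _∙_ sub (logBounded C φ≤) (logBounded C′ χ≤) = logBounded (C + C′) (λ n x →
    ≤-trans (sub (φ n x) (χ n x)) (subst (log⁺ (φ n x) + log⁺ (χ n x) ≤_) (sym (*-distribʳ-+ (suc n * log⁺ x) C C′))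
      (+-mono-≤ (φ≤ n x) (χ≤ n x))))

  log-+ : ∀ {φ χ} → LogBounded φ → LogBounded χ → LogBounded (λ n x → φ n x + χ n x)
  log-+ = log-combine _+_ log⁺-+

  log-* : ∀ {φ χ} → LogBounded φ → LogBounded χ → LogBounded (λ n x → φ n x * χ n x)
  log-* = log-combine _*_ log⁺-*

  log-n : LogBounded (λ n _ → n)
  log-n = logBounded 2 (λ n x → begin
    log⁺ n  ≤⟨ s≤s (⌈log₂⌉-≤ (n≤2^n (suc n))) ⟩
    suc (suc n)  ≤⟨ s≤s (s≤s (m≤m+n n (n + 0))) ⟩
    suc (suc (n + (n + 0)))  ≡⟨ cong suc (+-suc n (n + 0)) ⟨
    2 * suc n  ≤⟨ *-monoʳ-≤ 2 (m≤m*n (suc n) (log⁺ x)) ⟩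
    2 * (suc n * log⁺ x)  ∎)
    where open ≤-Reasoning

  log-x : LogBounded (λ _ x → x)
  log-x = logBounded 1 (λ n x → ≤-trans (m≤n*m (log⁺ x) (suc n)) (≤-reflexive (sym (*-identityˡ _))))

  log-^ : ∀ k → LogBounded (λ n _ → k ^ n)
  log-^ k = logBounded (2 + log⁺ k) (λ n x → begin
    log⁺ (k ^ n)  ≤⟨ log⁺-^ k n ⟩
    2 + n * log⁺ k  ≤⟨ +-monoˡ-≤ (n * log⁺ k) (m≤m*n 2 (suc n)) ⟩
    2 * suc n + n * log⁺ k  ≤⟨ +-monoʳ-≤ (2 * suc n) (≤-trans (*-monoˡ-≤ (log⁺ k) (n≤1+n n)) (≤-reflexive (*-comm (suc n) (log⁺ k)))) ⟩
    2 * suc n + log⁺ k * suc n  ≡⟨ *-distribʳ-+ (suc n) 2 (log⁺ k) ⟨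
    (2 + log⁺ k) * suc n  ≤⟨ *-monoʳ-≤ (2 + log⁺ k) (m≤m*n (suc n) (log⁺ x)) ⟩
    (2 + log⁺ k) * (suc n * log⁺ x)  ∎)
    where open ≤-Reasoning

open IntegerSums
open GroupRing
open YatesTransform
open TupleLists
open LogarithmBounds
open Machine
open FillLoops
open RankDecomposition
open ResultExtraction
open TransformProgram
open Implementation
open Asymptotics
open import Data.Fin as Fin using (Fin)
open import Data.Integer as ℤ using (ℤ; 0ℤ; 1ℤ; ∣_∣) renaming (_*_ to _*ᶻ_)
import Data.Integer.Properties as ℤₚ
open import Data.List using (length)
open import Data.Nat
open import Data.Nat.Base using (_!)
open import Data.Nat.Divisibility using (_∣_)
open import Data.Nat.Properties
open import Data.Nat.Tactic.RingSolver using (solve-∀)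
open import Data.Product using (∃-syntax; _×_; _,_; proj₁; proj₂)
open import Data.Vec as Vec using (Vec; []; _∷_)
open import Data.Vec.Properties using (≡-dec)
open import Function.Bundles using (_↔_; Inverse)
open import Relation.Binary.PropositionalEquality
open import Relation.Nullary using (yes; no; contradiction)

-- Alphabets with at least two elements

module LargeAlphabet {D : Set} {d : ℕ} (enum : D ↔ Fin d) (f : D → D → D) (P : CyclicPartition f)
  (K : ℕ) {{K≢0 : NonZero K}} (k∣K : ∀ i → NonZero (CyclicPartition.k P i) → CyclicPartition.k P i ∣ K)
  {{c≢0 : NonZero (cost P)}} {{d≢0 : NonZero d}} (2≤d : 2 ≤ d) where

  open CyclicGroupRing K
  open Decomposition enum f P K k∣K
  open Extraction enum f P K k∣K
  open Algorithms enum f P K k∣K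
  open Convolution enum
  private
    c : ℕ
    c = cost P

  1≤total : ∀ n → 1 ≤ total n
  1≤total n = ≤-trans (m^n>0 c n) (m≤m+n (c ^ n) (d ^ n))

  private
    konst : ∀ k → (λ _ → k) ≲ total
    konst = ≲-const 1≤total

    fill-≲ : ∀ cnt w es {φ} → φ ≲ total → (λ n → fillCost cnt w es (φ n)) ≲ total
    fill-≲ cnt w es φ≲ = ≲-+ (konst (assignCost (const 0ℤ)))
      (≲-+ (≲-*ʳ (suc (iterationCost cnt w es)) φ≲) (konst (suc (costFactor (guard cnt)))))

    dⁿ≲ : (λ n → d ^ n) ≲ total
    dⁿ≲ = ≲-≤ (λ n → m≤n+m (d ^ n) (c ^ n))

    cⁿ≲ : (λ n → c ^ n) ≲ total
    cⁿ≲ = ≲-≤ (λ n → m≤m+n (c ^ n) (d ^ n))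

    total≲ : total ≲ total
    total≲ = ≲-≤ (λ n → ≤-refl)

    powers-≲ : powersCost ≲ (λ n → suc n * total n)
    powers-≲ = ≲-+ (k (assignCost (const (ℤ.+ 1)))) (≲-+ (k (assignCost (const (ℤ.+ 1)))) (≲-+ (k (assignCost (var nReg)))
      (≲-+ (≲-times-n (konst (suc powersRoundCost))) (k (suc (costFactor (var countReg)))))))
      where
      k : ∀ k → (λ _ → k) ≲ (λ n → suc n * total n)
      k x = ≲-weaken (konst x)

    load-≲ : ∀ src → (λ n → loadCost src (d ^ n)) ≲ total
    load-≲ src = ≲-+ (konst (assignCost (const 0ℤ))) (≲-+ (konst (assignCost (const 0ℤ))) (≲-+ (konst (assignCost (var sizeReg)))
      (fill-≲ sizeReg (1 * K) (TupleBlocks.flatten K 1 (λ _ → embedE src)) dⁿ≲)))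

    multiply-≲ : (λ n → multiplyCost (c ^ n)) ≲ total
    multiply-≲ = ≲-+ (konst (assignCost (const 0ℤ))) (≲-+ (fill-≲ lengthReg (1 * K) (TupleBlocks.flatten K 1 (λ _ → productE)) cⁿ≲) (konst (assignCost (const 0ℤ))))

    finish-≲ : (λ n → finishCost (d ^ n)) ≲ total
    finish-≲ = ≲-+ (konst (assignCost (const 0ℤ))) (fill-≲ lengthReg 1 (λ _ → quotientE) dⁿ≲)

    module _ {t s : ℕ} {{t≢0 : NonZero t}} {{s≢0 : NonZero s}} (M : Fin t → Fin s → R) where
      open Transform K v (PrimitiveWeight.periodic K) t s M

      transform-≲ : ∀ A → (λ n → transformCost A n (total n)) ≲ (λ n → suc n * total n)
      transform-≲ A = ≲-+ (≲-weaken (konst (assignCost (var nReg))))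
        (≲-+ (≲-times-n (≲-+ (konst 1) (≲-+ (konst (costFactor (var countReg))) (≲-+ layer-≲ (konst (assignCost (decrement countReg)))))))
             (≲-weaken (konst (suc (costFactor (var countReg))))))
        where
        layer-≲ : (λ n → layerCost A (total n)) ≲ total
        layer-≲ = ≲-+ (konst (assignCost strideE)) (≲-+ (konst (assignCost (var topReg))) (≲-+ (fill-≲ strideReg (t * K) (TupleBlocks.flatten K t (layerE A)) total≲)
          (≲-+ (konst (assignCost (var bufferReg))) (konst (assignCost lengthE)))))

  steps : programCost ≲ (λ n → suc n * total n)
  steps = ≲-+ powers-≲ (≲-+ (≲-weaken (load-≲ 0)) (≲-+ (transform-≲ α 3) (≲-+ (≲-weaken (konst (assignCost (var offsetReg))))
    (≲-+ (≲-weaken (load-≲ 1)) (≲-+ (transform-≲ β 4) (≲-+ (≲-weaken multiply-≲) (≲-+ (transform-≲ γ 5) (≲-weaken finish-≲))))))))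

  limit-log : LogBounded limit
  limit-log = log-+ (log-const 2) (log-+ log-n (log-+ memory-log (log-+ (log-^ K) (log-+ α-log (log-+ β-log (log-+ γ-log final-log))))))
    where
    memory-log : LogBounded memory
    memory-log = log-* (log-+ (log-const 1) log-n) (log-* (log-+ (log-^ c) (log-^ d)) (log-const K))
    α-log : LogBounded boundα
    α-log = log-* (log-^ growthα) log-x
    β-log : LogBounded boundβ
    β-log = log-* (log-^ growthβ) log-x
    γ-log : LogBounded boundγ
    γ-log = log-* (log-^ growthγ) (log-* (log-const K) (log-* (log-const K) (log-* α-log β-log)))
    final-log : LogBounded boundFinal
    final-log = log-+ (log-const 1) (log-* (log-const K) (log-* γ-log (log-const weightBound)))

  leading : ℕ
  leading = proj₁ steps * (factor limit-log * factor limit-log)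

  -- There are three factors `suc n`: one from the number of layers and two from the squared word
  -- length. Since 2 ^ n ≤ d ^ n ≤ Z, each is at most `log⁺ Z`, whence the exponent 3. The two
  -- factors `log⁺ X` stay inside Z as its square.
  time-bound : ∀ n X t → t ≤ programCost n * (log⁺ (limit n X) * log⁺ (limit n X)) →
    t ≤ Õ[ leading , 3 ] ((c ^ n + d ^ n) * log⁺ X ^ 2)
  time-bound n X t t≤ = begin
    t  ≤⟨ t≤ ⟩
    programCost n * (log⁺ (limit n X) * log⁺ (limit n X))  ≤⟨ *-mono-≤ (proj₂ steps n) (*-mono-≤ (bound limit-log n X) (bound limit-log n X)) ⟩
    C₁ * (suc n * total n) * (C₂ * (suc n * l) * (C₂ * (suc n * l))) ≡⟨ lemma C₁ C₂ (suc n) (total n) l ⟩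
    leading * Z * (suc n * (suc n * (suc n * 1)))  ≤⟨ *-mono-≤ (*-monoʳ-≤ leading (m≤m⊔n Z 1)) (*-mono-≤ n< (*-mono-≤ n< (*-monoˡ-≤ 1 n<))) ⟩
    leading * (Z ⊔ 1) * log⁺ Z ^ 3  ∎
    where
    open ≤-Reasoning
    C₁ C₂ l Z : ℕ
    C₁ = proj₁ steps
    C₂ = factor limit-log
    l = log⁺ X
    Z = (c ^ n + d ^ n) * l ^ 2
    lemma : ∀ C₁ C₂ m Y l → C₁ * (m * Y) * (C₂ * (m * l) * (C₂ * (m * l))) ≡ C₁ * (C₂ * C₂) * (Y * (l * (l * 1))) * (m * (m * (m * 1)))
    lemma = solve-∀
    n< : suc n ≤ log⁺ Z
    n< = ≤-trans (n<log⁺[2^n] n) (log⁺-mono (begin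
      2 ^ n  ≤⟨ ^-monoˡ-≤ n 2≤d ⟩
      d ^ n  ≤⟨ m≤n+m (d ^ n) (c ^ n) ⟩
      c ^ n + d ^ n  ≤⟨ m≤m*n (c ^ n + d ^ n) (l ^ 2) {{m^n≢0 l 2}} ⟩
      Z  ∎))

  algorithm : ∀ n (g h : Vec D n → ℤ) → ∃[ s ] ∃[ t ]
    ⟨ program , input n (values g) (values h) ⟩⇓⟨ s , t ⟩
    × output (length (tuples n)) s ≡ values (convolution f g h)
    × t ≤ Õ[ leading , 3 ] ((cost P ^ n + d ^ n) * log⁺ (inputMax g h) ^ 2)
  algorithm n g h = Exec.final e , Exec.time e , Exec.run e
    , applyUpTo-values enum n (convolution f g h) (arr (Exec.final e) 2) (λ us → begin
        arr (Exec.final e) 2 (index us)  ≡⟨ Exec.post e (index us) (index-bound us) ⟩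
        extract (result n G H (index us)) ÷ (ℤ.+ (K ^ n))  ≡⟨ cong (_÷ (ℤ.+ (K ^ n))) (extract-correct n g h G H (embedded g) (embedded h) us) ⟩
        (ℤ.+ (K ^ n) *ᶻ convolution f g h (decode enum us)) ÷ (ℤ.+ (K ^ n)) ≡⟨ *÷-cancel (K ^ n) {{m^n≢0 K n}} _ ⟩
        convolution f g h (decode enum us)  ∎)
    , time-bound n X (Exec.time e) (Exec.time≤ e)
    where
    open ≡-Reasoning
    X : ℕ
    X = inputMax g h
    module Runs = Run n X (limit n X) (limit-fits n X)
    open Execution (limit n X) (Fits.2≤W (limit-fits n X)) using (module Exec)
    e = Runs.exec-program (values g) (values h)
      (λ i → ≤-trans (∣load∣≤maxAbs enum (values g) i) (maxAbs-++ˡ enum (values g) (values h)))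
      (λ i → ≤-trans (∣load∣≤maxAbs enum (values h) i) (maxAbs-++ʳ enum (values g) (values h)))
    G H : ℕ → R
    G p = embed (load (values g) p)
    H p = embed (load (values h) p)
    embedded : ∀ g us → embed (load (values g) (index us)) ≈ embed (g (decode enum us))
    embedded g us = pointwise (λ b → cong (λ z → (embed z ▷ v) b) (load-values enum n g us))

-- Alphabets with at most one element

-- The critical case is d = 0 with n positive, where d ^ n is 0. The value lists are then empty, so
-- the left side is 1, and the maximum with 1 covers it.
log²≤ : ∀ {D : Set} {d} (enum : D ↔ Fin d) n c (g h : Vec D n → ℤ) →
  log⁺ (Convolution.inputMax enum g h) ^ 2 ≤ (c + d ^ n) * log⁺ (Convolution.inputMax enum g h) ^ 2 ⊔ 1
log²≤ {d = zero}  enum (suc n) c g h = m≤n⊔m ((c + 0) * 1) 1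
log²≤ {d = zero}  enum zero    c g h = ≤-trans (m≤n*m _ (c + 1) {{>-nonZero (m≤n+m 1 c)}}) (m≤m⊔n _ 1)
log²≤ {d = suc d} enum n       c g h = ≤-trans (m≤n*m _ (c + suc d ^ n) {{>-nonZero (≤-trans (m^n>0 (suc d) n) (m≤n+m _ c))}}) (m≤m⊔n _ 1)

-- If cost P is 1 as well, the time bound does not grow with n, so the program
-- may not even read n.
module SmallAlphabet {D : Set} {d : ℕ} (enum : D ↔ Fin d) (f : D → D → D) (P : CyclicPartition f) (d≤1 : d ≤ 1) where

  open Convolution enum

  first : Arr → Expr
  first A = read A (const 0ℤ)

  -- With at most one tuple the convolution is at most one product. If Dⁿ is empty the output has
  -- length 0, and the cell written lies outside it.
  multiplyFirst : Program
  multiplyFirst = write 2 (const 0ℤ) (bin times (first 0) (first 1))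

  Fin-unique : ∀ {d} → d ≤ 1 → (i j : Fin d) → i ≡ j
  Fin-unique (s≤s z≤n) Fin.zero Fin.zero = refl

  D-unique : (x y : D) → x ≡ y
  D-unique x y = trans (sym (Inverse.strictlyInverseʳ enum x))
    (trans (cong (Inverse.from enum) (Fin-unique d≤1 _ _)) (Inverse.strictlyInverseʳ enum y))

  Vec-unique : ∀ {n} (xs ys : Vec D n) → xs ≡ ys
  Vec-unique []       []       = refl
  Vec-unique (x ∷ xs) (y ∷ ys) = cong₂ _∷_ (D-unique x y) (Vec-unique xs ys)

  sum-single-index : ∀ {d} → d ≤ 1 → (i : Fin d) (φ : Fin d → ℤ) → sum φ ≡ φ i
  sum-single-index (s≤s z≤n) Fin.zero φ = ℤₚ.+-identityʳ (φ Fin.zero)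

  ∑ⱽ-single : ∀ {n} (us : Vec (Fin d) n) (φ : Vec (Fin d) n → ℤ) → ∑ⱽᶻ n φ ≡ φ us
  ∑ⱽ-single []       φ = refl
  ∑ⱽ-single (u ∷ us) φ = trans (sum-single-index d≤1 u _) (∑ⱽ-single us (λ us → φ (u ∷ us)))

  index≡0 : ∀ {n} (us : Vec (Fin d) n) → index us ≡ 0
  index≡0 {n} us = n<1⇒n≡0 (≤-trans (index-bound us) (≤-trans (^-monoˡ-≤ n d≤1) (≤-reflexive (^-zeroˡ n))))

  -- Any two vectors over D agree, so the matching condition holds whatever f is, and both sums have
  -- a single term.
  convolution-single : ∀ {n} (g h : Vec D n → ℤ) us → convolution f g h (decode enum us) ≡ g (decode enum us) *ᶻ h (decode enum us)
  convolution-single {n} g h us = trans (convolution-sum enum f n g h (decode enum us))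
    (trans (∑ⱽ-single us _) (trans (∑ⱽ-single us _)
      (trans (cong (_*ᶻ (g (decode enum us) *ᶻ h (decode enum us))) matched) (ℤₚ.*-identityˡ _))))
    where
    matched : indicator (≡-dec _≟ᴰ_ (decode enum us) (Vec.zipWith f (decode enum us) (decode enum us))) ≡ 1ℤ
    matched with ≡-dec _≟ᴰ_ (decode enum us) (Vec.zipWith f (decode enum us) (decode enum us))
    ... | yes _ = refl
    ... | no ¬p = contradiction (Vec-unique _ _) ¬p

  -- The equation is the cost of `multiplyFirst` written out: `size 0ℤ` is 1, so each `first` costs
  -- 2 plus the size of the value it reads.
  time-bound : ∀ n (g h : Vec D n → ℤ) t →
    t ≡ 1 + (2 + size (load (values g) 0) + (2 + size (load (values h) 0)) + size (load (values g) 0) * size (load (values h) 0))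
      + 1 + size (load (values g) 0 *ᶻ load (values h) 0) →
    t ≤ Õ[ 11 , 0 ] ((cost P ^ n + d ^ n) * log⁺ (inputMax g h) ^ 2)
  time-bound n g h t t≡ = begin
    t  ≡⟨ t≡ ⟩
    1 + (2 + size a + (2 + size b) + size a * size b) + 1 + size (a *ᶻ b)  ≤⟨ +-mono-≤ (+-monoˡ-≤ 1 (+-monoʳ-≤ 1 (+-mono-≤ (+-mono-≤ (+-monoʳ-≤ 2 a≤l) (+-monoʳ-≤ 2 b≤l)) (*-mono-≤ a≤l b≤l)))) ab≤ ⟩
    1 + (2 + l + (2 + l) + l * l) + 1 + (l + l)  ≡⟨ lemma₁ l ⟩
    -- As 1 ≤ l ≤ l * l, the terms add up to 6 + 4 + 1 = 11 copies of l * l.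
    6 + 4 * l + l * l  ≤⟨ +-monoˡ-≤ (l * l) (+-mono-≤ (*-monoʳ-≤ 6 1≤l²) (*-monoʳ-≤ 4 (m≤m*n l l))) ⟩
    6 * (l * l) + 4 * (l * l) + l * l  ≡⟨ lemma₂ l ⟩
    11 * l ^ 2  ≤⟨ *-monoʳ-≤ 11 (log²≤ enum n (cost P ^ n) g h) ⟩
    11 * (Z ⊔ 1)  ≡⟨ *-identityʳ (11 * (Z ⊔ 1)) ⟨
    11 * (Z ⊔ 1) * 1  ∎
    where
    open ≤-Reasoning
    a b : ℤ
    a = load (values g) 0
    b = load (values h) 0
    l Z : ℕ
    l = log⁺ (inputMax g h)
    Z = (cost P ^ n + d ^ n) * l ^ 2
    a≤l : size a ≤ l
    a≤l = log⁺-mono (≤-trans (∣load∣≤maxAbs enum (values g) 0) (maxAbs-++ˡ enum (values g) (values h)))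
    b≤l : size b ≤ l
    b≤l = log⁺-mono (≤-trans (∣load∣≤maxAbs enum (values h) 0) (maxAbs-++ʳ enum (values g) (values h)))
    ab≤ : size (a *ᶻ b) ≤ l + l
    ab≤ = ≤-trans (≤-reflexive (cong log⁺ (ℤₚ.abs-* a b))) (≤-trans (log⁺-* ∣ a ∣ ∣ b ∣) (+-mono-≤ a≤l b≤l))
    1≤l² : 1 ≤ l * l
    1≤l² = *-mono-≤ (1≤log⁺ (inputMax g h)) (1≤log⁺ (inputMax g h))
    lemma₁ : ∀ l → 1 + (2 + l + (2 + l) + l * l) + 1 + (l + l) ≡ 6 + 4 * l + l * l
    lemma₁ = solve-∀
    lemma₂ : ∀ l → 6 * (l * l) + 4 * (l * l) + l * l ≡ 11 * (l * (l * 1))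
    lemma₂ = solve-∀

  algorithm : ∀ n (g h : Vec D n → ℤ) → ∃[ s ] ∃[ t ]
    ⟨ multiplyFirst , input n (values g) (values h) ⟩⇓⟨ s , t ⟩
    × output (length (tuples n)) s ≡ values (convolution f g h)
    × t ≤ Õ[ 11 , 0 ] ((cost P ^ n + d ^ n) * log⁺ (inputMax g h) ^ 2)
  algorithm n g h = s , _ , ⇓write
    , applyUpTo-values enum n (convolution f g h) (arr s 2) (λ us → begin
        arr s 2 (index us)  ≡⟨ cong (arr s 2) (index≡0 us) ⟩
        load (values g) 0 *ᶻ load (values h) 0  ≡⟨ cong (λ i → load (values g) i *ᶻ load (values h) i) (index≡0 us) ⟨
        load (values g) (index us) *ᶻ load (values h) (index us)  ≡⟨ cong₂ _*ᶻ_ (load-values enum n g us) (load-values enum n h us) ⟩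
        g (decode enum us) *ᶻ h (decode enum us)  ≡⟨ convolution-single g h us ⟨
        convolution f g h (decode enum us)  ∎)
    , time-bound n g h _ refl
    where
    open ≡-Reasoning
    s : State
    s = setArr 2 0 (load (values g) 0 *ᶻ load (values h) 0) (input n (values g) (values h))

-- The minor that contains (x, x) has a value of σA in `Fin k`, so its k is positive.
cost-nonZero : ∀ {D : Set} {f : D → D → D} (P : CyclicPartition f) → D → NonZero (cost P)
cost-nonZero P x with CyclicPartition.partition P x x
... | i , (x∈A , _) , _ = >-nonZero (≤-trans (nonEmpty (IsCyclic.σA (CyclicPartition.isCyclic P i) (x , x∈A))) (≤-cost (CyclicPartition.k P) i))
  where
  nonEmpty : ∀ {k} → Fin k → 1 ≤ k
  nonEmpty {suc k} _ = s≤s z≤n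

lemma1p2 : {D : Set} {d : ℕ} (enum : D ↔ Fin d) (f : D → D → D) (P : CyclicPartition f) →
    let open Convolution enum in
    ∃[ program ] ∃[ p ] ∃[ C ] ∃[ q ]
    (∀ n (g h : Vec D n → ℤ) →
    ∃[ s ] ∃[ t ]
    ⟨ program , input n (values g) (values h) ⟩⇓⟨ s , t ⟩
    × output (length (tuples n)) s ≡ values (convolution f g h)
    × t ≤ Õ[ C , q ] ((cost P ^ n + d ^ n) * log⁺ (inputMax g h) ^ p))
lemma1p2 {d = 0} enum f P = multiplyFirst , 2 , 11 , 0 , algorithm
  where open SmallAlphabet enum f P z≤n
lemma1p2 {d = 1} enum f P = multiplyFirst , 2 , 11 , 0 , algorithm
  where open SmallAlphabet enum f P ≤-refl
lemma1p2 {d = suc (suc _)} enum f P = program , 2 , leading , 3 , algorithm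
  where
  instance
    K≢0 : NonZero (cost P !)
    K≢0 = cost P !≢0
    c≢0 : NonZero (cost P)
    c≢0 = cost-nonZero P (Inverse.from enum Fin.zero)
  open LargeAlphabet enum f P (cost P !) (k∣cost! P) (s≤s (s≤s z≤n)) using (leading; algorithm)
  open Algorithms enum f P (cost P !) (k∣cost! P) using (program)
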